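{- Let $M=(E,\mathcal{I})$ be a (finite) matroid of rank $r\geqslant 1$. Let $\mathcal{I}_k$ be the collection of independent sets of size $k$, and let $I_k=|\mathcal{I}_k|$ and $I=|\mathcal{I}|$. For a set $F\in \mathcal{I}_{r-1}$ let $\delta(F)$ be the number of bases of $M$ containing $F$. Then $$\ln \left(\frac{I}{I_r}\right)\geqslant \frac{I_{r-1}}{I_r}\cdot \left[\frac{1}{I_{r-1}}\sum_{F\in \mathcal{I}_{r-1}}\delta(F)\ln \left(1+\frac{1}{\delta(F)}\right)\right].$$ In particular, if $\delta>0$ is such that every set $F\in \mathcal{I}_{r-1}$ is contained in at least $\delta$ bases, then $$\ln \left(\frac{I}{I_r}\right)\geqslant \frac{I_{r-1}}{I_r}\cdot \delta \ln \left(1+\frac{1}{\delta}\right).$$ In particular, $$\frac{I}{I_r}\geqslant 2^{I_{r-1}/I_r}.$$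
   Context: A matroid $M=(E,\mathcal{I})$ is given by its finite ground set $E$ and its family $\mathcal{I}$ of independent sets; its bases are the maximal independent sets, all of size equal to the rank $r$. -}

module Defs where

open import Level using (0ℓ)
open import Data.Nat as ℕ using (ℕ; zero; suc; z≤n; s≤s; _∸_)
import Data.Nat.Properties as ℕₚ
import Data.Integer as ℤ
import Data.Integer.Properties as ℤₚ
import Data.Rational.Unnormalised as ℚᵘ
import Data.Rational.Unnormalised.Properties as ℚᵘₚ
open import Data.Rational as ℚ
  using (ℚ; mkℚ; 0ℚ; 1ℚ; _+_; _*_; _-_; -_; _≤_; _<_; ∣_∣; 1/_; toℚᵘ; ↥_)
open import Data.Rational.Properties
open import Data.Rational.Solver using (module +-*-Solver)
open import Data.Product using (Σ; ∃; _×_; _,_; proj₁; proj₂)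
open import Data.Sum using (inj₁; inj₂)
open import Data.Empty using (⊥-elim)
open import Data.List using (List; []; _∷_; _++_; map; filter; foldr; length)
open import Data.List.Membership.Propositional using () renaming (_∈_ to _∈ˡ_)
open import Data.List.Membership.Propositional.Properties
  using (∈-++⁺ˡ; ∈-++⁺ʳ; ∈-map⁺; ∈-filter⁺)
open import Data.List.Relation.Unary.Any using (here; there)
open import Data.Fin using (Fin)
open import Data.Fin.Subset using (Subset; inside; outside; ⊥; ⁅_⁆; _∪_; _∈_; _∉_; _⊆_; _⊂_)
  renaming (∣_∣ to ∥_∥)
open import Data.Fin.Subset.Properties
  using (_⊆?_; _⊂?_; anySubset?; ∣p∣≤n; p⊂q⇒∣p∣<∣q∣)
open import Data.Vec using ([]; _∷_)
open import Relation.Unary using (Pred; Decidable)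
open import Relation.Nullary using (Dec; yes; no; ¬_; ¬?; _×-dec_; contradiction)
open import Relation.Nullary.Decidable using (map′)
open import Relation.Binary.PropositionalEquality
open +-*-Solver using (solve; _:=_; _:+_; _:*_; _:-_; :-_; con)

fromℕ : ℕ → ℚ
fromℕ n = ℤ.+ n ℚ./ 1

-- Division is total, with p ÷ 0 = 0.  For a matroid of rank r ≥ 1 the
-- numbers I_r, I_{r-1} and δ(F), F ∈ 𝓘_{r-1}, are all positive, so the
-- convention is never used there.
inv : ℚ → ℚ
inv p with p ≟ 0ℚ
... | yes _   = 0ℚ
... | no  p≢0 = (1/ p) {{ℚ.≢-nonZero p≢0}}

infixl 7 _÷_
_÷_ : ℚ → ℚ → ℚ
p ÷ q = p * inv q

fromℕ-+ : ∀ m n → fromℕ (m ℕ.+ n) ≡ fromℕ m + fromℕ n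
fromℕ-+ m n = toℚᵘ-injective (begin
  toℚᵘ (fromℕ (m ℕ.+ n))                ≈⟨ toℚᵘ-fromℚᵘ (ℚᵘ.mkℚᵘ (ℤ.+ (m ℕ.+ n)) 0) ⟩
  ℚᵘ.mkℚᵘ (ℤ.+ (m ℕ.+ n)) 0             ≈⟨ ℚᵘ.*≡* (cong (ℤ._* ℤ.+ 1) eq) ⟩
  ℚᵘ.mkℚᵘ (ℤ.+ m) 0 ℚᵘ.+ ℚᵘ.mkℚᵘ (ℤ.+ n) 0
    ≈⟨ ℚᵘₚ.+-cong (toℚᵘ-fromℚᵘ (ℚᵘ.mkℚᵘ (ℤ.+ m) 0)) (toℚᵘ-fromℚᵘ (ℚᵘ.mkℚᵘ (ℤ.+ n) 0)) ⟨
  toℚᵘ (fromℕ m) ℚᵘ.+ toℚᵘ (fromℕ n)    ≈⟨ toℚᵘ-homo-+ (fromℕ m) (fromℕ n) ⟨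
  toℚᵘ (fromℕ m + fromℕ n)              ∎)
  where
  open ℚᵘₚ.≃-Reasoning
  eq : ℤ.+ (m ℕ.+ n) ≡ ℤ.+ m ℤ.* ℤ.+ 1 ℤ.+ ℤ.+ n ℤ.* ℤ.+ 1
  eq = sym (cong₂ ℤ._+_ (ℤₚ.*-identityʳ (ℤ.+ m)) (ℤₚ.*-identityʳ (ℤ.+ n)))

fromℕ-* : ∀ m n → fromℕ (m ℕ.* n) ≡ fromℕ m * fromℕ n
fromℕ-* zero    n = sym (*-zeroˡ (fromℕ n))
fromℕ-* (suc m) n = begin
  fromℕ (n ℕ.+ m ℕ.* n)          ≡⟨ fromℕ-+ n (m ℕ.* n) ⟩
  fromℕ n + fromℕ (m ℕ.* n)      ≡⟨ cong (fromℕ n +_) (fromℕ-* m n) ⟩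
  fromℕ n + fromℕ m * fromℕ n    ≡⟨ solve 2 (λ a b → b :+ a :* b := (con 1ℚ :+ a) :* b) refl (fromℕ m) (fromℕ n) ⟩
  (1ℚ + fromℕ m) * fromℕ n       ≡⟨ cong (_* fromℕ n) (fromℕ-+ 1 m) ⟨
  fromℕ (suc m) * fromℕ n        ∎
  where open ≡-Reasoning

0≤1 : 0ℚ ≤ 1ℚ
0≤1 = nonNegative⁻¹ 1ℚ

0<1 : 0ℚ < 1ℚ
0<1 = positive⁻¹ 1ℚ

0≤fromℕ : ∀ n → 0ℚ ≤ fromℕ n
0≤fromℕ zero    = ≤-refl
0≤fromℕ (suc n) = subst (0ℚ ≤_) (sym (fromℕ-+ 1 n)) (+-mono-≤ 0≤1 (0≤fromℕ n))

fromℕ-mono : ∀ {m n} → m ℕ.≤ n → fromℕ m ≤ fromℕ n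
fromℕ-mono {n = n} z≤n = 0≤fromℕ n
fromℕ-mono (s≤s {m} {n} m≤n) = subst₂ _≤_ (sym (fromℕ-+ 1 m)) (sym (fromℕ-+ 1 n))
  (+-monoʳ-≤ 1ℚ (fromℕ-mono m≤n))

0<fromℕ : ∀ {n} → 0 ℕ.< n → 0ℚ < fromℕ n
0<fromℕ 0<n = <-≤-trans 0<1 (fromℕ-mono 0<n)

*-mono : ∀ {p q r s} → 0ℚ ≤ r → 0ℚ ≤ q → p ≤ q → r ≤ s → p * r ≤ q * s
*-mono {p} {q} {r} {s} 0≤r 0≤q p≤q r≤s = ≤-trans
  (*-monoʳ-≤-nonNeg r {{ℚ.nonNegative 0≤r}} p≤q)
  (*-monoˡ-≤-nonNeg q {{ℚ.nonNegative 0≤q}} r≤s)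

0≤* : ∀ {p q} → 0ℚ ≤ p → 0ℚ ≤ q → 0ℚ ≤ p * q
0≤* {p} {q} 0≤p 0≤q =
  subst (_≤ p * q) (*-zeroˡ 0ℚ) (*-mono ≤-refl 0≤p 0≤p 0≤q)

0<* : ∀ {p q} → 0ℚ < p → 0ℚ < q → 0ℚ < p * q
0<* {p} {q} 0<p 0<q =
  positive⁻¹ (p * q) {{pos*pos⇒pos p {{ℚ.positive 0<p}} q {{ℚ.positive 0<q}}}}

0<+ : ∀ {p q} → 0ℚ < p → 0ℚ < q → 0ℚ < p + q
0<+ {p} {q} 0<p 0<q = subst (_< p + q) (+-identityˡ 0ℚ) (+-mono-< 0<p 0<q)

*-inv : ∀ {p} → 0ℚ < p → p * inv p ≡ 1ℚ
*-inv {p} 0<p with p ≟ 0ℚ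
... | yes p≡0 = contradiction (sym p≡0) (<⇒≢ 0<p)
... | no  p≢0 = *-inverseʳ p {{ℚ.≢-nonZero p≢0}}

0<inv : ∀ {p} → 0ℚ < p → 0ℚ < inv p
0<inv {p} 0<p with p ≟ 0ℚ
... | yes p≡0 = contradiction (sym p≡0) (<⇒≢ 0<p)
... | no  p≢0 = positive⁻¹ ((1/ p) {{ℚ.≢-nonZero p≢0}}) {{1/pos⇒pos p {{ℚ.positive 0<p}}}}

0≤inv : ∀ p → 0ℚ ≤ p → 0ℚ ≤ inv p
0≤inv p 0≤p with p ≟ 0ℚ
... | yes _   = ≤-refl
... | no  p≢0 = <⇒≤ (positive⁻¹ ((1/ p) {{ℚ.≢-nonZero p≢0}})
        {{1/pos⇒pos p {{nonNeg∧nonZero⇒pos p {{ℚ.nonNegative 0≤p}} {{ℚ.≢-nonZero p≢0}}}}}})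

inv-anti : ∀ {p q} → 0ℚ < p → p ≤ q → inv q ≤ inv p
inv-anti {p} {q} 0<p p≤q = subst₂ _≤_ eq₁ eq₂
  (*-mono (0≤* (<⇒≤ i) (<⇒≤ j)) (<⇒≤ 0<q) p≤q ≤-refl)
  where
  0<q = <-≤-trans 0<p p≤q
  i = 0<inv 0<p
  j = 0<inv 0<q
  eq₁ : p * (inv p * inv q) ≡ inv q
  eq₁ = trans (sym (*-assoc p (inv p) (inv q)))
        (trans (cong (_* inv q) (*-inv 0<p)) (*-identityˡ (inv q)))
  eq₂ : q * (inv p * inv q) ≡ inv p
  eq₂ = trans (solve 3 (λ a b c → a :* (b :* c) := (a :* c) :* b) refl q (inv p) (inv q))
        (trans (cong (_* inv p) (*-inv 0<q)) (*-identityˡ (inv p)))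

∣inv∣≤ : ∀ {p q} → 0ℚ < p → p ≤ q → ∣ inv q ∣ ≤ inv p
∣inv∣≤ 0<p p≤q = subst (_≤ _) (sym (0≤p⇒∣p∣≡p (<⇒≤ (0<inv (<-≤-trans 0<p p≤q))))) (inv-anti 0<p p≤q)

inv-diff : ∀ {p q} → 0ℚ < p → 0ℚ < q → inv p - inv q ≡ (q - p) * (inv p * inv q)
inv-diff {p} {q} 0<p 0<q = sym (begin
  (q - p) * (inv p * inv q)
    ≡⟨ solve 4 (λ a b c d → (b :- a) :* (c :* d) := (b :* d) :* c :- (a :* c) :* d) refl p q (inv p) (inv q) ⟩
  (q * inv q) * inv p - (p * inv p) * inv q
    ≡⟨ cong₂ (λ u v → u * inv p - v * inv q) (*-inv 0<q) (*-inv 0<p) ⟩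
  1ℚ * inv p - 1ℚ * inv q
    ≡⟨ cong₂ _-_ (*-identityˡ (inv p)) (*-identityˡ (inv q)) ⟩
  inv p - inv q ∎)
  where open ≡-Reasoning

∣*∣≤ : ∀ p q {a b} → ∣ p ∣ ≤ a → ∣ q ∣ ≤ b → ∣ p * q ∣ ≤ a * b
∣*∣≤ p q p≤a q≤b = subst (_≤ _) (sym (∣p*q∣≡∣p∣*∣q∣ p q))
  (*-mono (0≤∣p∣ q) (≤-trans (0≤∣p∣ p) p≤a) p≤a q≤b)

∣+∣≤ : ∀ p q {a b} → ∣ p ∣ ≤ a → ∣ q ∣ ≤ b → ∣ p + q ∣ ≤ a + b
∣+∣≤ p q p≤a q≤b = ≤-trans (∣p+q∣≤∣p∣+∣q∣ p q) (+-mono-≤ p≤a q≤b)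

∣-∣-sym : ∀ p q → ∣ p - q ∣ ≡ ∣ q - p ∣
∣-∣-sym p q = trans (sym (∣-p∣≡∣p∣ (p - q)))
  (cong ∣_∣ (solve 2 (λ a b → :- (a :- b) := b :- a) refl p q))

triangle : ∀ p q r {a b} → ∣ p - q ∣ ≤ a → ∣ q - r ∣ ≤ b → ∣ p - r ∣ ≤ a + b
triangle p q r pq qr = subst (λ t → ∣ t ∣ ≤ _)
  (solve 3 (λ a b c → (a :- b) :+ (b :- c) := a :- c) refl p q r) (∣+∣≤ (p - q) (q - r) pq qr)

∣-∣≤ : ∀ p q {a} → p ≤ q + a → q ≤ p + a → ∣ p - q ∣ ≤ a
∣-∣≤ p q {a} p≤ q≤ with ∣p∣≡p∨∣p∣≡-p (p - q)
... | inj₁ eq = subst₂ _≤_ (sym eq) (solve 2 (λ a q → (q :+ a) :- q := a) refl a q) (+-monoˡ-≤ (- q) p≤)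
... | inj₂ eq = subst₂ _≤_ (trans (solve 2 (λ p q → q :- p := :- (p :- q)) refl p q) (sym eq))
  (solve 2 (λ a p → (p :+ a) :- p := a) refl a p) (+-monoˡ-≤ (- p) q≤)

≤fromℕ : ∀ p → ∃ λ N → p ≤ fromℕ N
≤fromℕ p = ℤ.∣ ↥ p ∣ , toℚᵘ-cancel-≤ (ℚᵘₚ.≤-respʳ-≃
  (ℚᵘₚ.≃-sym (toℚᵘ-fromℚᵘ (ℚᵘ.mkℚᵘ (ℤ.+ ℤ.∣ ↥ p ∣) 0))) (le p))
  where
  le : ∀ p → toℚᵘ p ℚᵘ.≤ ℚᵘ.mkℚᵘ (ℤ.+ ℤ.∣ ↥ p ∣) 0
  le (mkℚ (ℤ.+ k) d _) = ℚᵘ.*≤* (ℤₚ.*-monoˡ-≤-nonNeg (ℤ.+ k) (ℤ.+≤+ (s≤s z≤n)))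
  le (mkℚ ℤ.-[1+ k ] d _) = ℚᵘ.*≤* ℤ.-≤+

mesh : ℕ → ℚ
mesh n = inv (fromℕ (suc n))

0≤mesh : ∀ n → 0ℚ ≤ mesh n
0≤mesh n = 0≤inv (fromℕ (suc n)) (0≤fromℕ (suc n))

*-mesh : ∀ n → fromℕ (suc n) * mesh n ≡ 1ℚ
*-mesh n = *-inv (0<fromℕ {suc n} (s≤s z≤n))

mesh-small : ∀ ε → 0ℚ < ε → ∃ λ N → ∀ n → N ℕ.≤ n → mesh n ≤ ε
mesh-small ε 0<ε = N , λ n N≤n → subst₂ _≤_ (*-identityˡ (mesh n)) (eq n)
  (*-monoʳ-≤-nonNeg (mesh n) {{ℚ.nonNegative (0≤mesh n)}} (1≤ n N≤n))
  where
  N : ℕ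
  N = proj₁ (≤fromℕ (inv ε))
  1≤ : ∀ n → N ℕ.≤ n → 1ℚ ≤ ε * fromℕ (suc n)
  1≤ n N≤n = subst (_≤ ε * fromℕ (suc n)) (*-inv 0<ε)
    (*-monoˡ-≤-nonNeg ε {{ℚ.nonNegative (<⇒≤ 0<ε)}}
      (≤-trans (proj₂ (≤fromℕ (inv ε))) (fromℕ-mono (ℕₚ.m≤n⇒m≤1+n N≤n))))
  eq : ∀ n → ε * fromℕ (suc n) * mesh n ≡ ε
  eq n = trans (*-assoc ε (fromℕ (suc n)) (mesh n)) (trans (cong (ε *_) (*-mesh n)) (*-identityʳ ε))

∑< : ℕ → (ℕ → ℚ) → ℚ
∑< zero    f = 0ℚ
∑< (suc n) f = ∑< n f + f n

-- Reals are Cauchy sequences of rationals.  They are not quotiented: the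
-- order is defined directly on representatives and respects the usual
-- equivalence of Cauchy sequences.

Eventually : (ℕ → Set) → Set
Eventually P = ∃ λ N → ∀ n → N ℕ.≤ n → P n

IsCauchy : (ℕ → ℚ) → Set
IsCauchy x = ∀ ε → 0ℚ < ε → ∃ λ N → ∀ m n → N ℕ.≤ m → N ℕ.≤ n → ∣ x m - x n ∣ ≤ ε

record ℝ : Set where
  field
    seq      : ℕ → ℚ
    isCauchy : IsCauchy seq
open ℝ public

infix 4 _≤ᴿ_ _≥ᴿ_ _<ᴿ_
_≤ᴿ_ _≥ᴿ_ _<ᴿ_ : ℝ → ℝ → Set
x ≤ᴿ y = ∀ ε → 0ℚ < ε → Eventually λ n → seq x n ≤ seq y n + ε
x ≥ᴿ y = y ≤ᴿ x
x <ᴿ y = ∃ λ ε → 0ℚ < ε × Eventually λ n → seq x n + ε ≤ seq y n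

fromℚ : ℚ → ℝ
fromℚ p .seq _ = p
fromℚ p .isCauchy ε 0<ε = 0 , λ _ _ _ _ → subst (λ t → ∣ t ∣ ≤ ε) (sym (+-inverseʳ p)) (<⇒≤ 0<ε)

0ᴿ 1ᴿ : ℝ
0ᴿ = fromℚ 0ℚ
1ᴿ = fromℚ 1ℚ

cauchyUpTo : ∀ x C → 0ℚ < C →
  (∀ ε → 0ℚ < ε → ∃ λ N → ∀ m n → N ℕ.≤ m → N ℕ.≤ n → ∣ x m - x n ∣ ≤ C * ε) → IsCauchy x
cauchyUpTo x C 0<C h ε 0<ε with h (inv C * ε) (0<* (0<inv 0<C) 0<ε)
... | N , g = N , λ m n N≤m N≤n → subst (_ ≤_) eq (g m n N≤m N≤n)
  where
  eq : C * (inv C * ε) ≡ ε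
  eq = trans (sym (*-assoc C (inv C) ε)) (trans (cong (_* ε) (*-inv 0<C)) (*-identityˡ ε))

Bounded : ℝ → Set
Bounded x = ∃ λ B → 0ℚ < B × Eventually λ n → ∣ seq x n ∣ ≤ B

bounded : ∀ x → Bounded x
bounded x with isCauchy x 1ℚ 0<1
... | N , h = 1ℚ + ∣ seq x N ∣ , <-≤-trans 0<1 (subst (_≤ 1ℚ + ∣ seq x N ∣) (+-identityʳ 1ℚ) (+-monoʳ-≤ 1ℚ (0≤∣p∣ (seq x N)))) , N ,
  λ n N≤n → subst (λ t → ∣ t ∣ ≤ 1ℚ + ∣ seq x N ∣)
    (solve 2 (λ a b → (a :- b) :+ b := a) refl (seq x n) (seq x N))
    (∣+∣≤ (seq x n - seq x N) (seq x N) (h n N N≤n ℕₚ.≤-refl) ≤-refl)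

infixl 6 _+ᴿ_
infixl 7 _*ᴿ_

_+ᴿ_ : ℝ → ℝ → ℝ
(x +ᴿ y) .seq n = seq x n + seq y n
(x +ᴿ y) .isCauchy = cauchyUpTo (λ n → seq x n + seq y n) (1ℚ + 1ℚ) (positive⁻¹ (1ℚ + 1ℚ)) λ ε 0<ε →
  let N₁ , h₁ = isCauchy x ε 0<ε
      N₂ , h₂ = isCauchy y ε 0<ε
  in N₁ ℕ.⊔ N₂ , λ m n N≤m N≤n → subst₂ _≤_
    (cong ∣_∣ (solve 4 (λ a b c d → (a :- c) :+ (b :- d) := (a :+ b) :- (c :+ d)) refl
      (seq x m) (seq y m) (seq x n) (seq y n)))
    (solve 1 (λ e → e :+ e := (con 1ℚ :+ con 1ℚ) :* e) refl ε)
    (∣+∣≤ (seq x m - seq x n) (seq y m - seq y n)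
      (h₁ m n (ℕₚ.m⊔n≤o⇒m≤o N₁ N₂ N≤m) (ℕₚ.m⊔n≤o⇒m≤o N₁ N₂ N≤n))
      (h₂ m n (ℕₚ.m⊔n≤o⇒n≤o N₁ N₂ N≤m) (ℕₚ.m⊔n≤o⇒n≤o N₁ N₂ N≤n)))

*-diff : ∀ a b c d {A B ε} → ∣ a ∣ ≤ A → ∣ b - d ∣ ≤ ε → ∣ d ∣ ≤ B → ∣ a - c ∣ ≤ ε →
  ∣ a * b - c * d ∣ ≤ (A + B) * ε
*-diff a b c d {A} {B} {ε} ha hbd hd hac = subst₂ (λ u v → ∣ u ∣ ≤ v)
  (solve 4 (λ a b c d → a :* (b :- d) :+ d :* (a :- c) := a :* b :- c :* d) refl a b c d)
  (sym (*-distribʳ-+ ε A B))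
  (∣+∣≤ (a * (b - d)) (d * (a - c)) {A * ε} {B * ε}
    (∣*∣≤ a (b - d) ha hbd) (∣*∣≤ d (a - c) hd hac))

*-isCauchy : ∀ x y → Bounded x → Bounded y → IsCauchy (λ n → seq x n * seq y n)
*-isCauchy x y (A , 0<A , M₁ , bx) (B , 0<B , M₂ , by) = cauchyUpTo (λ n → seq x n * seq y n) (A + B) (0<+ 0<A 0<B) λ ε 0<ε →
  let N₁ , h₁ = isCauchy x ε 0<ε
      N₂ , h₂ = isCauchy y ε 0<ε
      M = M₁ ℕ.⊔ M₂
      N = N₁ ℕ.⊔ N₂
      toM : ∀ {n} → M ℕ.⊔ N ℕ.≤ n → M ℕ.≤ n
      toM = ℕₚ.m⊔n≤o⇒m≤o M N
      toN : ∀ {n} → M ℕ.⊔ N ℕ.≤ n → N ℕ.≤ n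
      toN = ℕₚ.m⊔n≤o⇒n≤o M N
  in M ℕ.⊔ N , λ m n m≥ n≥ → *-diff (seq x m) (seq y m) (seq x n) (seq y n)
      (bx m (ℕₚ.m⊔n≤o⇒m≤o M₁ M₂ (toM m≥)))
      (h₂ m n (ℕₚ.m⊔n≤o⇒n≤o N₁ N₂ (toN m≥)) (ℕₚ.m⊔n≤o⇒n≤o N₁ N₂ (toN n≥)))
      (by n (ℕₚ.m⊔n≤o⇒n≤o M₁ M₂ (toM n≥)))
      (h₁ m n (ℕₚ.m⊔n≤o⇒m≤o N₁ N₂ (toN m≥)) (ℕₚ.m⊔n≤o⇒m≤o N₁ N₂ (toN n≥)))

_*ᴿ_ : ℝ → ℝ → ℝ
(x *ᴿ y) .seq n = seq x n * seq y n
(x *ᴿ y) .isCauchy = *-isCauchy x y (bounded x) (bounded y)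

recip : (x : ℝ) → 0ᴿ <ᴿ x → ℝ
recip x _ .seq n = inv (seq x n)
recip x (μ , 0<μ , M , μ≤) .isCauchy = cauchyUpTo (λ n → inv (seq x n)) (K * K) (0<* (0<inv 0<μ) (0<inv 0<μ)) λ ε 0<ε →
  let N , h = isCauchy x ε 0<ε
  in M ℕ.⊔ N , λ m n m≥ n≥ →
    let p = seq x m ; q = seq x n
        μ≤p = subst (_≤ p) (+-identityˡ μ) (μ≤ m (ℕₚ.m⊔n≤o⇒m≤o M N m≥))
        μ≤q = subst (_≤ q) (+-identityˡ μ) (μ≤ n (ℕₚ.m⊔n≤o⇒m≤o M N n≥))
    in subst₂ (λ u v → ∣ u ∣ ≤ v)
      (sym (inv-diff (<-≤-trans 0<μ μ≤p) (<-≤-trans 0<μ μ≤q)))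
      (*-comm ε (K * K))
      (∣*∣≤ (q - p) (inv p * inv q)
        (h n m (ℕₚ.m⊔n≤o⇒n≤o M N n≥) (ℕₚ.m⊔n≤o⇒n≤o M N m≥))
        (∣*∣≤ (inv p) (inv q) (∣inv∣≤ 0<μ μ≤p) (∣inv∣≤ 0<μ μ≤q)))
  where K = inv μ

sumᴿ : List ℝ → ℝ
sumᴿ = foldr _+ᴿ_ 0ᴿ

-- Left Riemann sum of f from a to b (b < a is allowed) over n + 1
-- subintervals of equal length.
riemann : (ℚ → ℚ) → ℚ → ℚ → ℕ → ℚ
riemann f a b n = ∑< (suc n) λ i → h * f (a + fromℕ i * h)
  where h = (b - a) ÷ fromℕ (suc n)

lnSum : ℚ → ℕ → ℚ
lnSum q = riemann inv 1ℚ q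

∑-cong : ∀ n {f g} → (∀ i → i ℕ.< n → f i ≡ g i) → ∑< n f ≡ ∑< n g
∑-cong zero    _ = refl
∑-cong (suc n) h = cong₂ _+_ (∑-cong n λ i i<n → h i (ℕₚ.m<n⇒m<1+n i<n)) (h n ℕₚ.≤-refl)

∑-diff : ∀ n {f g c} → (∀ i → i ℕ.< n → ∣ f i - g i ∣ ≤ c) → ∣ ∑< n f - ∑< n g ∣ ≤ fromℕ n * c
∑-diff zero    {c = c} _ = ≤-reflexive (sym (*-zeroˡ c))
∑-diff (suc n) {f} {g} {c} h = subst₂ _≤_
  (cong ∣_∣ (solve 4 (λ a b c d → (a :- c) :+ (b :- d) := (a :+ b) :- (c :+ d)) refl
    (∑< n f) (f n) (∑< n g) (g n)))
  (trans (solve 2 (λ k c → k :* c :+ c := (con 1ℚ :+ k) :* c) refl (fromℕ n) c)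
    (cong (_* c) (sym (fromℕ-+ 1 n))))
  (∣+∣≤ (∑< n f - ∑< n g) (f n - g n) (∑-diff n λ i i<n → h i (ℕₚ.m<n⇒m<1+n i<n)) (h n ℕₚ.≤-refl))

∑-const : ∀ n c → ∑< n (λ _ → c) ≡ fromℕ n * c
∑-const zero    c = sym (*-zeroˡ c)
∑-const (suc n) c = trans (cong (_+ c) (∑-const n c))
  (trans (solve 2 (λ k c → k :* c :+ c := (con 1ℚ :+ k) :* c) refl (fromℕ n) c)
    (cong (_* c) (sym (fromℕ-+ 1 n))))

∑-+ : ∀ m n f → ∑< (m ℕ.+ n) f ≡ ∑< m f + ∑< n (λ j → f (m ℕ.+ j))
∑-+ m zero    f = trans (cong (λ k → ∑< k f) (ℕₚ.+-identityʳ m)) (sym (+-identityʳ _))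
∑-+ m (suc n) f = trans (cong (λ k → ∑< k f) (ℕₚ.+-suc m n))
  (trans (cong (_+ f (m ℕ.+ n)) (∑-+ m n f)) (+-assoc (∑< m f) (∑< n (λ j → f (m ℕ.+ j))) (f (m ℕ.+ n))))

∑-blocks : ∀ n m f → ∑< (n ℕ.* m) f ≡ ∑< n (λ i → ∑< m (λ j → f (i ℕ.* m ℕ.+ j)))
∑-blocks zero    m f = refl
∑-blocks (suc n) m f = trans (cong (λ k → ∑< k f) (ℕₚ.+-comm m (n ℕ.* m)))
  (trans (∑-+ (n ℕ.* m) m f) (cong (_+ ∑< m (λ j → f (n ℕ.* m ℕ.+ j))) (∑-blocks n m f)))

module LnSum {μ : ℚ} (0<μ : 0ℚ < μ) (μ≤1 : μ ≤ 1ℚ) where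

  K = inv μ

  step : ℚ → ℕ → ℚ
  step q n = (q - 1ℚ) ÷ fromℕ (suc n)

  point : ℚ → ℕ → ℕ → ℚ
  point q n i = 1ℚ + fromℕ i * step q n

  -- 1 + i (q - 1)/N is the convex combination (N - i)/N + (i/N) q.
  μ≤point : ∀ {q} n i → μ ≤ q → i ℕ.≤ suc n → μ ≤ point q n i
  μ≤point {q} n i μ≤q i≤N = subst₂ _≤_ eq₁ eq₂
    (+-mono-≤ (*-monoˡ-≤-nonNeg (c * w) {{ℚ.nonNegative (0≤* (0≤fromℕ (suc n ∸ i)) (0≤mesh n))}} μ≤1)
              (*-monoˡ-≤-nonNeg (d * w) {{ℚ.nonNegative (0≤* (0≤fromℕ i) (0≤mesh n))}} μ≤q))
    where
    w = mesh n
    c = fromℕ (suc n ∸ i)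
    d = fromℕ i
    c+d : c * w + d * w ≡ 1ℚ
    c+d = trans (sym (*-distribʳ-+ w c d)) (trans (cong (_* w)
      (trans (sym (fromℕ-+ (suc n ∸ i) i)) (cong fromℕ (ℕₚ.m∸n+n≡m i≤N)))) (*-mesh n))
    eq₁ : c * w * μ + d * w * μ ≡ μ
    eq₁ = trans (sym (*-distribʳ-+ μ (c * w) (d * w))) (trans (cong (_* μ) c+d) (*-identityˡ μ))
    eq₂ : c * w * 1ℚ + d * w * q ≡ point q n i
    eq₂ = trans (solve 4 (λ c d w q → c :* w :* con 1ℚ :+ d :* w :* q
                  := (c :* w :+ d :* w) :+ d :* ((q :- con 1ℚ) :* w)) refl c d w q)
      (cong (_+ d * step q n) c+d)

  lipschitz : ∀ {p q} n → μ ≤ p → μ ≤ q → ∣ lnSum p n - lnSum q n ∣ ≤ ∣ p - q ∣ * (K * K)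
  lipschitz {p} {q} n μ≤p μ≤q = subst (∣ lnSum p n - lnSum q n ∣ ≤_) eq
    (∑-diff (suc n) term)
    where
    D = ∣ p - q ∣
    eq : fromℕ (suc n) * (D * mesh n * (K * K)) ≡ D * (K * K)
    eq = trans (solve 4 (λ a d w k → a :* (d :* w :* (k :* k)) := (a :* w) :* (d :* (k :* k))) refl
           (fromℕ (suc n)) D (mesh n) K)
         (trans (cong (_* (D * (K * K))) (*-mesh n)) (*-identityˡ (D * (K * K))))
    term : ∀ i → i ℕ.< suc n →
      ∣ step p n * inv (point p n i) - step q n * inv (point q n i) ∣ ≤ D * mesh n * (K * K)
    term i i<N = subst (λ t → ∣ t ∣ ≤ D * mesh n * (K * K)) (sym diff)
      (∣*∣≤ ((p - q) * mesh n) (inv a * inv b)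
        (∣*∣≤ (p - q) (mesh n) ≤-refl (≤-reflexive (0≤p⇒∣p∣≡p (0≤mesh n))))
        (∣*∣≤ (inv a) (inv b) (∣inv∣≤ 0<μ μ≤a) (∣inv∣≤ 0<μ μ≤b)))
      where
      a = point p n i
      b = point q n i
      μ≤a = μ≤point n i μ≤p (ℕₚ.<⇒≤ i<N)
      μ≤b = μ≤point n i μ≤q (ℕₚ.<⇒≤ i<N)
      open ≡-Reasoning
      diff : step p n * inv a - step q n * inv b ≡ (p - q) * mesh n * (inv a * inv b)
      diff = begin
        step p n * inv a - step q n * inv b
          ≡⟨ cong₂ _-_ (*-identityʳ (step p n * inv a)) (*-identityʳ (step q n * inv b)) ⟨
        step p n * inv a * 1ℚ - step q n * inv b * 1ℚ
          ≡⟨ cong₂ (λ u v → step p n * inv a * u - step q n * inv b * v)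
               (*-inv (<-≤-trans 0<μ μ≤b)) (*-inv (<-≤-trans 0<μ μ≤a)) ⟨
        step p n * inv a * (b * inv b) - step q n * inv b * (a * inv a)
          ≡⟨ solve 6 (λ p q w i u v →
               (p :- con 1ℚ) :* w :* u :* ((con 1ℚ :+ i :* ((q :- con 1ℚ) :* w)) :* v)
               :- (q :- con 1ℚ) :* w :* v :* ((con 1ℚ :+ i :* ((p :- con 1ℚ) :* w)) :* u)
               := (p :- q) :* w :* (u :* v)) refl p q (mesh n) (fromℕ i) (inv a) (inv b) ⟩
        (p - q) * mesh n * (inv a * inv b) ∎

  -- Passing from n + 1 to (n + 1)(m + 1) = n' + 1 subintervals.
  refine : ∀ {q B} n m → μ ≤ q → ∣ q - 1ℚ ∣ ≤ B →
    ∣ lnSum q n - lnSum q (m ℕ.+ n ℕ.* suc m) ∣ ≤ B * B * (K * K) * mesh n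
  refine {q} {B} n m μ≤q ∣t∣≤B = subst (λ t → ∣ lnSum q n - t ∣ ≤ B * B * (K * K) * mesh n)
    (sym (∑-blocks (suc n) (suc m) _))
    (subst (∣ lnSum q n - ∑< (suc n) block ∣ ≤_) eq (∑-diff (suc n) term))
    where
    h = step q n
    M = suc m
    n' = m ℕ.+ n ℕ.* M
    h' = step q n'
    0<M = 0<fromℕ {M} (s≤s z≤n)
    H = B * mesh n
    ∣h∣≤H : ∣ h ∣ ≤ H
    ∣h∣≤H = ∣*∣≤ (q - 1ℚ) (mesh n) ∣t∣≤B (≤-reflexive (0≤p⇒∣p∣≡p (0≤mesh n)))
    block : ℕ → ℚ
    block i = ∑< M λ j → h' * inv (point q n' (i ℕ.* M ℕ.+ j))
    Mh' : fromℕ M * h' ≡ h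
    Mh' = begin
      fromℕ M * ((q - 1ℚ) * mesh n')
        ≡⟨ *-identityʳ _ ⟨
      fromℕ M * ((q - 1ℚ) * mesh n') * 1ℚ
        ≡⟨ cong (fromℕ M * ((q - 1ℚ) * mesh n') *_) (*-mesh n) ⟨
      fromℕ M * ((q - 1ℚ) * mesh n') * (fromℕ (suc n) * mesh n)
        ≡⟨ solve 5 (λ M t w N v → M :* (t :* w) :* (N :* v) := (N :* M :* w) :* (t :* v)) refl
             (fromℕ M) (q - 1ℚ) (mesh n') (fromℕ (suc n)) (mesh n) ⟩
      fromℕ (suc n) * fromℕ M * mesh n' * h
        ≡⟨ cong (λ u → u * mesh n' * h) (fromℕ-* (suc n) M) ⟨
      fromℕ (suc n') * mesh n' * h
        ≡⟨ cong (_* h) (*-mesh n') ⟩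
      1ℚ * h
        ≡⟨ *-identityˡ h ⟩
      h ∎
      where open ≡-Reasoning
    eq : fromℕ (suc n) * (H * H * (K * K)) ≡ B * B * (K * K) * mesh n
    eq = trans (solve 4 (λ N b w k → N :* (b :* w :* (b :* w) :* (k :* k))
                 := (N :* w) :* (b :* b :* (k :* k) :* w)) refl (fromℕ (suc n)) B (mesh n) K)
         (trans (cong (_* (B * B * (K * K) * mesh n)) (*-mesh n)) (*-identityˡ _))
    module _ (i : ℕ) (i<N : i ℕ.< suc n) where
      a = point q n i
      μ≤a = μ≤point n i μ≤q (ℕₚ.<⇒≤ i<N)
      whole : ∑< M (λ _ → h' * inv a) ≡ h * inv a
      whole = trans (∑-const M (h' * inv a))
        (trans (sym (*-assoc (fromℕ M) h' (inv a))) (cong (_* inv a) Mh'))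
      sub : ∀ j → j ℕ.< M →
        ∣ h' * inv a - h' * inv (point q n' (i ℕ.* M ℕ.+ j)) ∣ ≤ mesh m * (H * H * (K * K))
      sub j j<M = subst₂ (λ u v → ∣ u ∣ ≤ v) (sym diff) eq′
        (∣*∣≤ (h' * (fromℕ j * h')) (inv a * inv b)
          (∣*∣≤ h' (fromℕ j * h') ∣h'∣≤ ∣jh'∣≤)
          (∣*∣≤ (inv a) (inv b) (∣inv∣≤ 0<μ μ≤a) (∣inv∣≤ 0<μ μ≤b)))
        where
        b = point q n' (i ℕ.* M ℕ.+ j)
        idx : i ℕ.* M ℕ.+ j ℕ.≤ suc n'
        idx = ℕₚ.≤-trans (ℕₚ.+-monoʳ-≤ (i ℕ.* M) (ℕₚ.<⇒≤ j<M))
          (subst (ℕ._≤ suc n ℕ.* M) (ℕₚ.+-comm M (i ℕ.* M)) (ℕₚ.*-monoˡ-≤ M i<N))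
        μ≤b = μ≤point n' (i ℕ.* M ℕ.+ j) μ≤q idx
        b≡ : b ≡ a + fromℕ j * h'
        b≡ = trans (cong (λ u → 1ℚ + u * h') (trans (fromℕ-+ (i ℕ.* M) j)
               (cong (_+ fromℕ j) (fromℕ-* i M))))
          (trans (solve 4 (λ i M j h → con 1ℚ :+ (i :* M :+ j) :* h
                   := (con 1ℚ :+ i :* (M :* h)) :+ j :* h) refl (fromℕ i) (fromℕ M) (fromℕ j) h')
            (cong (λ u → (1ℚ + fromℕ i * u) + fromℕ j * h') Mh'))
        diff : h' * inv a - h' * inv b ≡ h' * (fromℕ j * h') * (inv a * inv b)
        diff = begin
          h' * inv a - h' * inv b
            ≡⟨ solve 3 (λ h u v → h :* u :- h :* v := h :* (u :- v)) refl h' (inv a) (inv b) ⟩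
          h' * (inv a - inv b)
            ≡⟨ cong (h' *_) (inv-diff (<-≤-trans 0<μ μ≤a) (<-≤-trans 0<μ μ≤b)) ⟩
          h' * ((b - a) * (inv a * inv b))
            ≡⟨ cong (λ u → h' * ((u - a) * (inv a * inv b))) b≡ ⟩
          h' * (((a + fromℕ j * h') - a) * (inv a * inv b))
            ≡⟨ solve 4 (λ h a j w → h :* (((a :+ j :* h) :- a) :* w) := h :* (j :* h) :* w) refl
                 h' a (fromℕ j) (inv a * inv b) ⟩
          h' * (fromℕ j * h') * (inv a * inv b) ∎
          where open ≡-Reasoning
        h'≡ : h' ≡ mesh m * h
        h'≡ = begin
          h'                          ≡⟨ *-identityˡ h' ⟨
          1ℚ * h'                     ≡⟨ cong (_* h') (*-mesh m) ⟨
          fromℕ M * mesh m * h'       ≡⟨ solve 3 (λ M w h → M :* w :* h := w :* (M :* h)) refl (fromℕ M) (mesh m) h' ⟩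
          mesh m * (fromℕ M * h')     ≡⟨ cong (mesh m *_) Mh' ⟩
          mesh m * h                  ∎
          where open ≡-Reasoning
        ∣h'∣≤ : ∣ h' ∣ ≤ mesh m * H
        ∣h'∣≤ = subst (λ u → ∣ u ∣ ≤ mesh m * H) (sym h'≡)
          (∣*∣≤ (mesh m) h (≤-reflexive (0≤p⇒∣p∣≡p (0≤mesh m))) ∣h∣≤H)
        ∣jh'∣≤ : ∣ fromℕ j * h' ∣ ≤ H
        ∣jh'∣≤ = subst (∣ fromℕ j * h' ∣ ≤_)
          (trans (sym (*-assoc (fromℕ M) (mesh m) H)) (trans (cong (_* H) (*-mesh m)) (*-identityˡ H)))
          (∣*∣≤ (fromℕ j) h' (subst (_≤ fromℕ M) (sym (0≤p⇒∣p∣≡p (0≤fromℕ j)))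
            (fromℕ-mono (ℕₚ.<⇒≤ j<M))) ∣h'∣≤)
        eq′ : mesh m * H * H * (K * K) ≡ mesh m * (H * H * (K * K))
        eq′ = solve 3 (λ w h k → w :* h :* h :* (k :* k) := w :* (h :* h :* (k :* k))) refl (mesh m) H K
      term : ∣ h * inv a - block i ∣ ≤ H * H * (K * K)
      term = subst₂ (λ u v → ∣ u - block i ∣ ≤ v) whole
        (trans (sym (*-assoc (fromℕ M) (mesh m) _))
          (trans (cong (_* (H * H * (K * K))) (*-mesh m)) (*-identityˡ _)))
        (∑-diff M sub)

  compare : ∀ {q B} n m → μ ≤ q → ∣ q - 1ℚ ∣ ≤ B →
    ∣ lnSum q n - lnSum q m ∣ ≤ B * B * (K * K) * mesh n + B * B * (K * K) * mesh m
  compare {q} {B} n m μ≤q b = triangle (lnSum q n) (lnSum q (m ℕ.+ n ℕ.* suc m)) (lnSum q m)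
    (refine n m μ≤q b)
    (subst (λ k → ∣ lnSum q k - lnSum q m ∣ ≤ B * B * (K * K) * mesh m)
      (ℕₚ.suc-injective (ℕₚ.*-comm (suc m) (suc n)))
      (subst (_≤ B * B * (K * K) * mesh m) (∣-∣-sym (lnSum q m) (lnSum q (n ℕ.+ m ℕ.* suc n)))
        (refine m n μ≤q b)))

0<min : ∀ {p q} → 0ℚ < p → 0ℚ < q → 0ℚ < p ℚ.⊓ q
0<min {p} {q} 0<p 0<q with ≤-total p q
... | inj₁ p≤q = subst (0ℚ <_) (sym (p≤q⇒p⊓q≡p p≤q)) 0<p
... | inj₂ q≤p = subst (0ℚ <_) (sym (p≥q⇒p⊓q≡q q≤p)) 0<q

ln-isCauchy : ∀ x → 0ᴿ <ᴿ x → Bounded (x +ᴿ fromℚ (- 1ℚ)) → IsCauchy (λ n → lnSum (seq x n) n)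
ln-isCauchy x (μ₀ , 0<μ₀ , M₁ , μ₀≤) (B , 0<B , M₂ , bx) = cauchyUpTo (λ n → lnSum (seq x n) n) C 0<C λ ε 0<ε →
  let N₁ , hx = isCauchy x ε 0<ε
      N₂ , hm = mesh-small ε 0<ε
      M = M₁ ℕ.⊔ M₂
      N = N₁ ℕ.⊔ N₂
      toM : ∀ {n} → M ℕ.⊔ N ℕ.≤ n → M ℕ.≤ n
      toM = ℕₚ.m⊔n≤o⇒m≤o M N
      toN : ∀ {n} → M ℕ.⊔ N ℕ.≤ n → N ℕ.≤ n
      toN = ℕₚ.m⊔n≤o⇒n≤o M N
      small : ∀ n → M ℕ.⊔ N ℕ.≤ n → L * mesh n ≤ L * ε
      small n n≥ = *-monoˡ-≤-nonNeg L {{ℚ.nonNegative (<⇒≤ 0<L)}} (hm n (ℕₚ.m⊔n≤o⇒n≤o N₁ N₂ (toN n≥)))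
      low : ∀ n → M ℕ.⊔ N ℕ.≤ n → μ ≤ seq x n
      low n n≥ = ≤-trans (p⊓q≤p μ₀ 1ℚ) (subst (_≤ seq x n) (+-identityˡ μ₀) (μ₀≤ n (ℕₚ.m⊔n≤o⇒m≤o M₁ M₂ (toM n≥))))
  in M ℕ.⊔ N , λ m n m≥ n≥ → subst (∣ lnSum (seq x m) m - lnSum (seq x n) n ∣ ≤_) (collect ε)
    (triangle (lnSum (seq x m) m) (lnSum (seq x n) m) (lnSum (seq x n) n)
      {ε * (K * K)} {L * ε + L * ε}
      (≤-trans (LS.lipschitz {seq x m} {seq x n} m (low m m≥) (low n n≥))
        (*-monoʳ-≤-nonNeg (K * K) {{ℚ.nonNegative (<⇒≤ 0<KK)}}
          (hx m n (ℕₚ.m⊔n≤o⇒m≤o N₁ N₂ (toN m≥)) (ℕₚ.m⊔n≤o⇒m≤o N₁ N₂ (toN n≥)))))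
      (≤-trans (LS.compare {seq x n} {B} m n (low n n≥) (bx n (ℕₚ.m⊔n≤o⇒n≤o M₁ M₂ (toM n≥))))
        (+-mono-≤ (small m m≥) (small n n≥))))
  where
  μ : ℚ
  μ = μ₀ ℚ.⊓ 1ℚ
  0<μ : 0ℚ < μ
  0<μ = 0<min 0<μ₀ 0<1
  module LS = LnSum 0<μ (p⊓q≤q μ₀ 1ℚ)
  K L C : ℚ
  K = inv μ
  L = B * B * (K * K)
  C = K * K + (L + L)
  0<KK : 0ℚ < K * K
  0<KK = 0<* (0<inv 0<μ) (0<inv 0<μ)
  0<L : 0ℚ < L
  0<L = 0<* (0<* 0<B 0<B) 0<KK
  0<C : 0ℚ < C
  0<C = 0<+ 0<KK (0<+ 0<L 0<L)
  collect : ∀ ε → ε * (K * K) + (L * ε + L * ε) ≡ C * ε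
  collect = solve 3 (λ k l e → e :* (k :* k) :+ (l :* e :+ l :* e) := (k :* k :+ (l :+ l)) :* e) refl K L

-- ln x = ∫₁ˣ dt/t: the n-th term is the Riemann sum over n + 1 intervals
-- for the n-th rational approximation of x.  This converges since the
-- sums are Lipschitz in q uniformly in n (away from 0).  The positivity
-- proof is used only for convergence, not in the value.
ln : (x : ℝ) → 0ᴿ <ᴿ x → ℝ
ln x _   .seq n    = lnSum (seq x n) n
ln x 0<x .isCauchy = ln-isCauchy x 0<x (bounded (x +ᴿ fromℚ (- 1ℚ)))

greatest : {P : ℕ → Set} → (∀ k → Dec (P k)) → ℕ → ℕ
greatest P? zero    = 0
greatest P? (suc b) with P? (suc b)
... | yes _ = suc b
... | no  _ = greatest P? b

-- The largest k with (k/(n+1))^q ≤ m; any such k is at most m(n+1).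
rootNumerator : ℕ → ℕ → ℕ → ℕ
rootNumerator q m n =
  greatest (λ k → k ℕ.^ q ℕ.≤? m ℕ.* suc n ℕ.^ q) (m ℕ.* suc n)

greatest-satisfies : {P : ℕ → Set} (P? : ∀ k → Dec (P k)) → P 0 → ∀ b → P (greatest P? b)
greatest-satisfies P? p0 zero    = p0
greatest-satisfies P? p0 (suc b) with P? (suc b)
... | yes p = p
... | no  _ = greatest-satisfies P? p0 b

greatest-maximal : {P : ℕ → Set} (P? : ∀ k → Dec (P k)) → ∀ b → ¬ P (suc b) → ¬ P (suc (greatest P? b))
greatest-maximal P? zero    ¬p = ¬p
greatest-maximal P? (suc b) ¬p with P? (suc b)
... | yes _  = ¬p
... | no  ¬q = greatest-maximal P? b ¬q

module Root (q m : ℕ) where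

  rn : ℕ → ℕ
  rn = rootNumerator (suc q) m

  lower : ∀ n → rn n ℕ.^ suc q ℕ.≤ m ℕ.* suc n ℕ.^ suc q
  lower n = greatest-satisfies (λ k → k ℕ.^ suc q ℕ.≤? m ℕ.* suc n ℕ.^ suc q) z≤n (m ℕ.* suc n)

  ^-distrib-* : ∀ a b k → (a ℕ.* b) ℕ.^ k ≡ a ℕ.^ k ℕ.* b ℕ.^ k
  ^-distrib-* a b zero    = refl
  ^-distrib-* a b (suc k) = trans (cong (a ℕ.* b ℕ.*_) (^-distrib-* a b k))
    (ℕₚ.[m*n]*[o*p]≡[m*o]*[n*p] a b (a ℕ.^ k) (b ℕ.^ k))

  m≤m^ : ∀ l → l ℕ.≤ l ℕ.^ suc q
  m≤m^ zero    = z≤n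
  m≤m^ (suc l) = ℕₚ.m≤m*n (suc l) (suc l ℕ.^ q) {{ℕₚ.m^n≢0 (suc l) q}}

  upper : ∀ n → m ℕ.* suc n ℕ.^ suc q ℕ.< suc (rn n) ℕ.^ suc q
  upper n = ℕₚ.≰⇒> (greatest-maximal (λ k → k ℕ.^ suc q ℕ.≤? m ℕ.* suc n ℕ.^ suc q) (m ℕ.* suc n)
    (ℕₚ.<⇒≱ (ℕₚ.≤-<-trans
      (subst (m ℕ.* suc n ℕ.^ suc q ℕ.≤_) (sym (^-distrib-* m (suc n) (suc q)))
        (ℕₚ.*-monoˡ-≤ (suc n ℕ.^ suc q) (m≤m^ m)))
      (ℕₚ.^-monoˡ-< (suc q) (ℕₚ.n<1+n (m ℕ.* suc n))))))

  close : ∀ n k → rn n ℕ.* suc k ℕ.≤ suc (rn k) ℕ.* suc n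
  close n k = ℕₚ.≮⇒≥ λ lt → ℕₚ.<-irrefl refl (begin-strict
    (rn n ℕ.* suc k) ℕ.^ Q             ≡⟨ ^-distrib-* (rn n) (suc k) Q ⟩
    rn n ℕ.^ Q ℕ.* suc k ℕ.^ Q         ≤⟨ ℕₚ.*-monoˡ-≤ (suc k ℕ.^ Q) (lower n) ⟩
    m ℕ.* suc n ℕ.^ Q ℕ.* suc k ℕ.^ Q  ≡⟨ ℕₚ.*-assoc m (suc n ℕ.^ Q) (suc k ℕ.^ Q) ⟩
    m ℕ.* (suc n ℕ.^ Q ℕ.* suc k ℕ.^ Q) ≡⟨ cong (m ℕ.*_) (ℕₚ.*-comm (suc n ℕ.^ Q) (suc k ℕ.^ Q)) ⟩
    m ℕ.* (suc k ℕ.^ Q ℕ.* suc n ℕ.^ Q) ≡⟨ ℕₚ.*-assoc m (suc k ℕ.^ Q) (suc n ℕ.^ Q) ⟨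
    m ℕ.* suc k ℕ.^ Q ℕ.* suc n ℕ.^ Q  ≤⟨ ℕₚ.*-monoˡ-≤ (suc n ℕ.^ Q) (ℕₚ.<⇒≤ (upper k)) ⟩
    suc (rn k) ℕ.^ Q ℕ.* suc n ℕ.^ Q   ≡⟨ ^-distrib-* (suc (rn k)) (suc n) Q ⟨
    (suc (rn k) ℕ.* suc n) ℕ.^ Q       <⟨ ℕₚ.^-monoˡ-< Q lt ⟩
    (rn n ℕ.* suc k) ℕ.^ Q             ∎)
    where
    Q = suc q
    open ℕₚ.≤-Reasoning

  approx : ∀ n k → fromℕ (rn n) ÷ fromℕ (suc n) ≤ fromℕ (rn k) ÷ fromℕ (suc k) + mesh k
  approx n k = subst₂ _≤_ eq₁ eq₂
    (*-monoʳ-≤-nonNeg (mesh k * mesh n) {{ℚ.nonNegative (0≤* (0≤mesh k) (0≤mesh n))}}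
      (subst₂ _≤_ (fromℕ-* (rn n) (suc k))
        (trans (fromℕ-* (suc (rn k)) (suc n)) (cong (_* fromℕ (suc n)) (fromℕ-+ 1 (rn k))))
        (fromℕ-mono (close n k))))
    where
    eq₁ : fromℕ (rn n) * fromℕ (suc k) * (mesh k * mesh n) ≡ fromℕ (rn n) * mesh n
    eq₁ = trans (solve 4 (λ a b c d → a :* b :* (c :* d) := (b :* c) :* (a :* d)) refl
            (fromℕ (rn n)) (fromℕ (suc k)) (mesh k) (mesh n))
      (trans (cong (_* (fromℕ (rn n) * mesh n)) (*-mesh k)) (*-identityˡ _))
    eq₂ : (1ℚ + fromℕ (rn k)) * fromℕ (suc n) * (mesh k * mesh n) ≡ fromℕ (rn k) * mesh k + mesh k
    eq₂ = trans (solve 4 (λ a b c d → (con 1ℚ :+ a) :* b :* (c :* d) := (b :* d) :* (a :* c :+ c)) refl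
            (fromℕ (rn k)) (fromℕ (suc n)) (mesh k) (mesh n))
      (trans (cong (_* (fromℕ (rn k) * mesh k + mesh k)) (*-mesh n)) (*-identityˡ _))

rootSeq : ℕ → ℕ → ℕ → ℚ
rootSeq q m n = fromℕ (rootNumerator q m n) ÷ fromℕ (suc n)

root-isCauchy : ∀ q .{{_ : ℕ.NonZero q}} m → IsCauchy (rootSeq q m)
root-isCauchy (suc q) m ε 0<ε = N , λ i j N≤i N≤j →
  ∣-∣≤ (rootSeq (suc q) m i) (rootSeq (suc q) m j)
    (≤-trans (approx i j) (+-monoʳ-≤ (rootSeq (suc q) m j) (proj₂ small j N≤j)))
    (≤-trans (approx j i) (+-monoʳ-≤ (rootSeq (suc q) m i) (proj₂ small i N≤i)))
  where
  open Root q m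
  small = mesh-small ε 0<ε
  N = proj₁ small

-- The q-th root of m: the n-th term is the largest multiple of 1/(n + 1)
-- whose q-th power is at most m.
root : (q : ℕ) .{{_ : ℕ.NonZero q}} → ℕ → ℝ
root q m .seq      = rootSeq q m
root q m .isCauchy = root-isCauchy q m

-- The real power a^(p/q), as the q-th root of a^p.
infixr 8 _^[_/_]
_^[_/_] : ℕ → ℕ → (q : ℕ) .{{_ : ℕ.NonZero q}} → ℝ
a ^[ p / q ] = root q (a ℕ.^ p)

record Matroid (n : ℕ) : Set₁ where
  field
    Independent  : Pred (Subset n) 0ℓ
    independent? : Decidable Independent
    empty        : Independent ⊥
    hereditary   : ∀ {A B} → A ⊆ B → Independent B → Independent A
    augmentation : ∀ {A B} → Independent A → Independent B → ∥ A ∥ ℕ.< ∥ B ∥ →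
                   ∃ λ e → e ∈ B × e ∉ A × Independent (A ∪ ⁅ e ⁆)

subsets : ∀ n → List (Subset n)
subsets zero    = [] ∷ []
subsets (suc n) = map (outside ∷_) (subsets n) ++ map (inside ∷_) (subsets n)

module _ {n : ℕ} (M : Matroid n) where
  open Matroid M

  IsBasis : Pred (Subset n) 0ℓ
  IsBasis B = Independent B × (∀ T → Independent T → ¬ (B ⊂ T))

  -- All bases of a matroid have the same size; this says that it is r.
  -- (Bases exist: see basis-exists.)
  HasRank : ℕ → Set
  HasRank r = ∀ B → IsBasis B → ∥ B ∥ ≡ r

  isBasis? : Decidable IsBasis
  isBasis? B = independent? B ×-dec
    map′ (λ ¬∃ T iT B⊂T → ¬∃ (T , iT , B⊂T)) (λ h (T , iT , B⊂T) → h T iT B⊂T)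
      (¬? (anySubset? λ T → independent? T ×-dec (B ⊂? T)))

  𝓘 : List (Subset n)
  𝓘 = filter independent? (subsets n)

  𝓘ₖ : ℕ → List (Subset n)
  𝓘ₖ k = filter (λ S → ∥ S ∥ ℕ.≟ k) 𝓘

  I : ℕ
  I = length 𝓘

  Iₖ : ℕ → ℕ
  Iₖ k = length (𝓘ₖ k)

  δ : Subset n → ℕ
  δ F = length (filter (F ⊆?_) (filter isBasis? (subsets n)))

∈-subsets : ∀ {n} (S : Subset n) → S ∈ˡ subsets n
∈-subsets []            = here refl
∈-subsets (outside ∷ S) = ∈-++⁺ˡ (∈-map⁺ (outside ∷_) (∈-subsets S))
∈-subsets {suc n} (inside ∷ S) =
  ∈-++⁺ʳ (map (outside ∷_) (subsets n)) (∈-map⁺ (inside ∷_) (∈-subsets S))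

∈⇒0<length : ∀ {A : Set} {x : A} {xs} → x ∈ˡ xs → 0 ℕ.< length xs
∈⇒0<length (here _)  = s≤s z≤n
∈⇒0<length (there _) = s≤s z≤n

0<1+inv : ∀ k → 0ᴿ <ᴿ fromℚ (1ℚ + 1ℚ ÷ fromℕ k)
0<1+inv k = 1ℚ , 0<1 , 0 , λ _ _ → ≤-trans (≤-reflexive (+-identityˡ 1ℚ))
  (subst (_≤ 1ℚ + 1ℚ ÷ fromℕ k) (+-identityʳ 1ℚ)
    (+-monoʳ-≤ 1ℚ (0≤* 0≤1 (0≤inv (fromℕ k) (0≤fromℕ k)))))

0<1+recip : ∀ x (0<x : 0ᴿ <ᴿ x) → 0ᴿ <ᴿ 1ᴿ +ᴿ recip x 0<x
0<1+recip x (μ , 0<μ , N , μ≤) = 1ℚ , 0<1 , N , λ n N≤n →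
  ≤-trans (≤-reflexive (trans (+-identityˡ 1ℚ) (sym (+-identityʳ 1ℚ))))
    (+-monoʳ-≤ 1ℚ (<⇒≤ (0<inv (<-≤-trans 0<μ (subst (_≤ seq x n) (+-identityˡ μ) (μ≤ n N≤n))))))

module _ {n : ℕ} (M : Matroid n) where
  open Matroid M

  basis-exists : ∃ (IsBasis M)
  basis-exists = extend n ⊥ empty (ℕₚ.m≤m+n n _)
    where
    extend : ∀ fuel S → Independent S → n ℕ.≤ fuel ℕ.+ ∥ S ∥ → ∃ (IsBasis M)
    extend fuel S iS n≤ with anySubset? (λ T → independent? T ×-dec (S ⊂? T))
    ... | no  none = S , iS , λ T iT S⊂T → none (T , iT , S⊂T)
    extend zero S iS n≤ | yes (T , iT , S⊂T) =
      ⊥-elim (ℕₚ.<-irrefl refl (ℕₚ.<-≤-trans (p⊂q⇒∣p∣<∣q∣ S⊂T) (ℕₚ.≤-trans (∣p∣≤n T) n≤)))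
    extend (suc fuel) S iS n≤ | yes (T , iT , S⊂T) = extend fuel T iT
      (ℕₚ.≤-trans n≤ (subst (ℕ._≤ fuel ℕ.+ ∥ T ∥) (ℕₚ.+-suc fuel ∥ S ∥)
        (ℕₚ.+-monoʳ-≤ fuel (p⊂q⇒∣p∣<∣q∣ S⊂T))))

  module _ {r : ℕ} (rank : HasRank M r) where

    0<Iᵣ : 0 ℕ.< Iₖ M r
    0<Iᵣ with basis-exists
    ... | B , isB = ∈⇒0<length (∈-filter⁺ (λ S → ∥ S ∥ ℕ.≟ r)
      (∈-filter⁺ independent? (∈-subsets B) (proj₁ isB)) (rank B isB))

    Iᵣ≢0 : ℕ.NonZero (Iₖ M r)
    Iᵣ≢0 = ℕ.>-nonZero 0<Iᵣ

    0<I : 0 ℕ.< I M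
    0<I = ∈⇒0<length (∈-filter⁺ independent? (∈-subsets ⊥) empty)

    0<I÷Iᵣ : 0ᴿ <ᴿ fromℚ (fromℕ (I M) ÷ fromℕ (Iₖ M r))
    0<I÷Iᵣ = p , 0<* (0<fromℕ 0<I) (0<inv (0<fromℕ 0<Iᵣ)) , 0 ,
      λ _ _ → ≤-reflexive (+-identityˡ p)
      where p = fromℕ (I M) ÷ fromℕ (Iₖ M r)

{-# OPTIONS --safe #-}

-- For a basis B and e ∈ B put x_B(e) = 1/δ(B - e).  For independent A,
-- S(A) = Σ_{B ⊇ A} Π_{e ∈ B ∖ A} x_B(e) ≤ 1, summing over the bases B: if m
-- elements extend A to a larger independent set, then by basis exchange
-- Σ_{e ∈ B ∖ A} δ(B - e) ≥ m for every B ⊇ A, hence m S(A) ≤ Σ_e S(A + e) ≤ m.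
-- Summing over A gives Σ_B Π_{e ∈ B} (1 + x_B(e)) ≤ I.  By concavity of ln the
-- average over the bases of Σ_{e ∈ B} ln (1 + x_B(e)) is at most ln (I / I_r),
-- and counting the pairs F ⊂ B turns the double sum into one over 𝓘_{r-1}.  The
-- power bound uses AM-GM and (1 + 1/δ)^δ ≥ 2 in the same places.
module Submission where

open import Defs
open import Algebra.Bundles using (CommutativeMonoid)
open import Algebra.Core using (Op₂)
open import Algebra.Structures using (IsCommutativeMonoid)
open import Data.Bool using (true; false; if_then_else_)
open import Data.Bool.Properties using () renaming (_≟_ to _≟ᵇ_)
open import Data.Empty using (⊥-elim)
open import Data.Fin using (Fin; zero; suc)
import Data.Fin.Properties as Finₚ
open import Data.Fin.Subset using (Subset; inside; outside; _∉_; _⊆_; ∁; _∪_; ⁅_⁆)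
  renaming (_∈_ to _∈ˢ_; ∣_∣ to ∥_∥)
open import Data.Fin.Subset.Properties
open import Data.List using (List; []; _∷_; _++_; map; filter; length; allFin; tabulate)
open import Data.List.Membership.Propositional using (_∈_)
open import Data.List.Membership.Propositional.Properties using (∈-filter⁺; ∈-filter⁻; ∈-allFin)
open import Data.List.Properties
  using (filter-++; filter-≐; filter-none; filter-accept; filter-reject; map-tabulate; length-filter; length-tabulate)
import Data.List.Relation.Unary.All as All
open import Data.List.Relation.Unary.Any using (here; there)
open import Data.Nat as ℕ using (ℕ; zero; suc; _∸_; z≤n; s≤s) renaming (_≤_ to _≤ℕ_)
import Data.Nat.Properties as ℕₚ
open import Data.Product using (∃; _×_; _,_; proj₁; proj₂)
open import Data.Rational as ℚ using (ℚ; 0ℚ; 1ℚ; _+_; _*_; _-_; -_; _≤_; _<_)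
open import Data.Rational.Properties
open import Data.Rational.Solver using (module +-*-Solver)
open import Data.Sum using (_⊎_; inj₁; inj₂; [_,_]′)
open import Data.Vec using ([]; _∷_; _[_]≔_; here; there)
open import Data.Vec.Properties
  using (≡-dec; []≔-updates; []≔-minimal; []≔-idempotent; []≔-lookup; []=⇒lookup; lookup⇒[]=; lookup∘update; lookup∘update′)
open import Function using (_∘_; _⇔_; mk⇔; Equivalence)
open import Level using (0ℓ)
open import Relation.Binary using () renaming (Decidable to Decidable₂)
open import Relation.Binary.PropositionalEquality
open import Relation.Nullary using (Dec; yes; no; does; ¬_; contradiction; _×-dec_; ¬?)
open import Relation.Nullary.Decidable using (dec-true)
open import Relation.Unary using (Pred; Decidable)
open import Algebra.Properties.CommutativeMonoid.Mult *-1-commutativeMonoid using (×-distrib-+)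
open +-*-Solver using (solve; _:=_; _:+_; _:*_; _:-_; :-_; con)

-- The obstacle is analytic: `ln` exists only as a limit of left Riemann sums, and at a fixed stage
-- these do not turn products into sums. Two facts at stage n replace the calculus. The sum is
-- itself concave for arguments at least 1, being a sum of functions h/(1 + ih) with h proportional
-- to q - 1, so Jensen costs no error. The functional equation survives as F x + F y ≤ F (xy) + (y -
-- 1)/(n + 1), and since every factor 1 + x_B(e) lies between 1 and 2, a basis costs at most one
-- mesh width per element. This error vanishes in the limit, which is taken only in the last
-- inequalities. The power bound is not deduced from the logarithmic one. It is proved in rational
-- arithmetic as 2^(I_{r-1}) ≤ (I/I_r)^(I_r), and becomes real only when the root is taken.

private variable
  X Y : Set
  n   : ℕ

-- Sums over lists and over families of subsets

-- The generality serves the count of pairs F ⊂ B, which is needed additively for the logarithmic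
-- bounds and multiplicatively for the power bound.
module BigOperator {A : Set} {_∙_ : Op₂ A} {ε : A}
  (isCommutativeMonoid : IsCommutativeMonoid _≡_ _∙_ ε) where

  open IsCommutativeMonoid isCommutativeMonoid using (identityˡ; identityʳ; assoc; comm)

  commutativeMonoid : CommutativeMonoid 0ℓ 0ℓ
  commutativeMonoid = record { isCommutativeMonoid = isCommutativeMonoid }

  open CommutativeMonoid commutativeMonoid using (monoid; commutativeSemigroup)
  open import Algebra.Properties.Monoid.Mult monoid public using () renaming (_×_ to _×′_)
  open import Algebra.Properties.CommutativeSemigroup commutativeSemigroup using (interchange)

  ⨁ : List X → (X → A) → A
  ⨁ []       f = ε
  ⨁ (x ∷ xs) f = f x ∙ ⨁ xs f

  ⨁-cong : ∀ (xs : List X) {f g} → (∀ {x} → x ∈ xs → f x ≡ g x) → ⨁ xs f ≡ ⨁ xs g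
  ⨁-cong []       h = refl
  ⨁-cong (x ∷ xs) h = cong₂ _∙_ (h (here refl)) (⨁-cong xs (h ∘ there))

  ⨁-ε : ∀ (xs : List X) → ⨁ xs (λ _ → ε) ≡ ε
  ⨁-ε []       = refl
  ⨁-ε (x ∷ xs) = trans (identityˡ _) (⨁-ε xs)

  ⨁-∙ : ∀ (xs : List X) f g → ⨁ xs (λ x → f x ∙ g x) ≡ ⨁ xs f ∙ ⨁ xs g
  ⨁-∙ []       f g = sym (identityˡ ε)
  ⨁-∙ (x ∷ xs) f g = trans (cong ((f x ∙ g x) ∙_) (⨁-∙ xs f g)) (interchange (f x) (g x) (⨁ xs f) (⨁ xs g))

  ⨁-const : ∀ (xs : List X) a → ⨁ xs (λ _ → a) ≡ length xs ×′ a
  ⨁-const []       a = refl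
  ⨁-const (x ∷ xs) a = cong (a ∙_) (⨁-const xs a)

  ⨁-swap : ∀ (xs : List X) (ys : List Y) (f : X → Y → A) →
    ⨁ xs (λ x → ⨁ ys (f x)) ≡ ⨁ ys (λ y → ⨁ xs (λ x → f x y))
  ⨁-swap []       ys f = sym (⨁-ε ys)
  ⨁-swap (x ∷ xs) ys f = trans (cong (⨁ ys (f x) ∙_) (⨁-swap xs ys f)) (sym (⨁-∙ ys (f x) _))

  ⨁-++ : ∀ (xs ys : List X) f → ⨁ (xs ++ ys) f ≡ ⨁ xs f ∙ ⨁ ys f
  ⨁-++ []       ys f = sym (identityˡ _)
  ⨁-++ (x ∷ xs) ys f = trans (cong (f x ∙_) (⨁-++ xs ys f)) (sym (assoc _ _ _))

  ⨁-map : ∀ (g : X → Y) xs f → ⨁ (map g xs) f ≡ ⨁ xs (f ∘ g)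
  ⨁-map g []       f = refl
  ⨁-map g (x ∷ xs) f = cong (f (g x) ∙_) (⨁-map g xs f)

  module _ {P : Pred X 0ℓ} (P? : Decidable P) where

    ⨁-filter : ∀ xs f → ⨁ (filter P? xs) f ≡ ⨁ xs (λ x → if does (P? x) then f x else ε)
    ⨁-filter []       f = refl
    ⨁-filter (x ∷ xs) f with does (P? x)
    ... | true  = cong (f x ∙_) (⨁-filter xs f)
    ... | false = trans (⨁-filter xs f) (sym (identityˡ _))

    ⨁-restrict : ∀ xs f → (∀ {x} → x ∈ xs → ¬ P x → f x ≡ ε) → ⨁ xs f ≡ ⨁ (filter P? xs) f
    ⨁-restrict xs f h = trans (⨁-cong xs outside-ε) (sym (⨁-filter xs f))
      where
      outside-ε : ∀ {x} → x ∈ xs → f x ≡ (if does (P? x) then f x else ε)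
      outside-ε {x} x∈ with P? x
      ... | yes _  = refl
      ... | no ¬Px = h x∈ ¬Px

  ⨁-swap-filter : ∀ {R : X → Y → Set} (R? : ∀ x y → Dec (R x y)) xs ys (f : X → Y → A) →
    ⨁ xs (λ x → ⨁ (filter (R? x) ys) (f x)) ≡ ⨁ ys (λ y → ⨁ (filter (λ x → R? x y) xs) (λ x → f x y))
  ⨁-swap-filter R? xs ys f = begin
    ⨁ xs (λ x → ⨁ (filter (R? x) ys) (f x))
      ≡⟨ ⨁-cong xs (λ {x} _ → ⨁-filter (R? x) ys (f x)) ⟩
    ⨁ xs (λ x → ⨁ ys (λ y → if does (R? x y) then f x y else ε))
      ≡⟨ ⨁-swap xs ys _ ⟩
    ⨁ ys (λ y → ⨁ xs (λ x → if does (R? x y) then f x y else ε))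
      ≡⟨ ⨁-cong ys (λ {y} _ → ⨁-filter (λ x → R? x y) xs (λ x → f x y)) ⟨
    ⨁ ys (λ y → ⨁ (filter (λ x → R? x y) xs) (λ x → f x y)) ∎
    where open ≡-Reasoning

filter-⇔ : ∀ {P Q : Pred X 0ℓ} {P? : Decidable P} (Q? : Decidable Q) → (∀ {x} → P x ⇔ Q x) →
  ∀ xs → filter P? xs ≡ filter Q? xs
filter-⇔ {P? = P?} Q? P⇔Q = filter-≐ P? Q? ((λ {x} → Equivalence.to (P⇔Q {x})) , (λ {x} → Equivalence.from (P⇔Q {x})))

module _ {P Q : Pred X 0ℓ} (P? : Decidable P) (Q? : Decidable Q) where

  filter-cong : ∀ xs → (∀ {x} → x ∈ xs → P x → Q x) → (∀ {x} → x ∈ xs → Q x → P x) →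
    filter P? xs ≡ filter Q? xs
  filter-cong []       to from = refl
  filter-cong (x ∷ xs) to from with P? x
  ... | yes px = trans (cong (x ∷_) (filter-cong xs (to ∘ there) (from ∘ there)))
                   (sym (filter-accept Q? (to (here refl) px)))
  ... | no ¬px = trans (filter-cong xs (to ∘ there) (from ∘ there))
                   (sym (filter-reject Q? (¬px ∘ from (here refl))))

  filter-filter : ∀ {R : Pred X 0ℓ} (R? : Decidable R) → (∀ {x} → P x → Q x → R x) →
    (∀ {x} → R x → P x × Q x) → ∀ xs → filter Q? (filter P? xs) ≡ filter R? xs
  filter-filter R? to from []       = refl
  filter-filter R? to from (x ∷ xs) with P? x
  ... | no ¬px = trans (filter-filter R? to from xs) (sym (filter-reject R? (¬px ∘ proj₁ ∘ from)))
  ... | yes px with Q? x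
  ...   | yes qx = trans (cong (x ∷_) (filter-filter R? to from xs)) (sym (filter-accept R? (to px qx)))
  ...   | no ¬qx = trans (filter-filter R? to from xs) (sym (filter-reject R? (¬qx ∘ proj₂ ∘ from)))

filter-map : ∀ {P : Pred Y 0ℓ} (P? : Decidable P) (f : X → Y) xs →
  filter P? (map f xs) ≡ map f (filter (P? ∘ f) xs)
filter-map P? f []       = refl
filter-map P? f (x ∷ xs) with does (P? (f x))
... | true  = cong (f x ∷_) (filter-map P? f xs)
... | false = filter-map P? f xs

-- Elements of a subset and the enumeration of all subsets

elements : Subset n → List (Fin n)
elements S = filter (_∈? S) (allFin _)

∈-elements⁺ : ∀ {S : Subset n} {e} → e ∈ˢ S → e ∈ elements S
∈-elements⁺ {S = S} {e} = ∈-filter⁺ (_∈? S) (∈-allFin e)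

∈-elements⁻ : ∀ {S : Subset n} {e} → e ∈ elements S → e ∈ˢ S
∈-elements⁻ {S = S} e∈ = proj₂ (∈-filter⁻ (_∈? S) {xs = allFin _} e∈)

elements-suc : ∀ s (S : Subset n) → filter (_∈? (s ∷ S)) (tabulate suc) ≡ map suc (elements S)
elements-suc {n} s S = begin
  filter (_∈? (s ∷ S)) (tabulate suc)            ≡⟨ cong (filter (_∈? (s ∷ S))) (map-tabulate (λ i → i) suc) ⟨
  filter (_∈? (s ∷ S)) (map suc (allFin n))      ≡⟨ filter-map (_∈? (s ∷ S)) suc (allFin n) ⟩
  map suc (filter ((_∈? (s ∷ S)) ∘ suc) (allFin n))
    ≡⟨ cong (map suc) (filter-≐ _ (_∈? S) (drop-there , there) (allFin n)) ⟩
  map suc (elements S)                           ∎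
  where open ≡-Reasoning

elements-inside : ∀ (S : Subset n) → elements (inside ∷ S) ≡ zero ∷ map suc (elements S)
elements-inside S = cong (zero ∷_) (elements-suc inside S)

elements-outside : ∀ (S : Subset n) → elements (outside ∷ S) ≡ map suc (elements S)
elements-outside = elements-suc outside

elements-⊆ : ∀ {S T : Subset n} → S ⊆ T → filter (_∈? S) (elements T) ≡ elements S
elements-⊆ {S = S} {T} S⊆T =
  filter-filter (_∈? T) (_∈? S) (_∈? S) (λ _ e∈S → e∈S) (λ e∈S → S⊆T e∈S , e∈S) (allFin _)

_≟ˢ_ : (S T : Subset n) → Dec (S ≡ T)
_≟ˢ_ = ≡-dec _≟ᵇ_

∷-injʳ : ∀ {s} {S T : Subset n} → s ∷ S ≡ s ∷ T → S ≡ T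
∷-injʳ refl = refl

filter-subsets : ∀ {P : Pred (Subset (suc n)) 0ℓ} (P? : Decidable P) →
  filter P? (subsets (suc n)) ≡
    map (outside ∷_) (filter (P? ∘ (outside ∷_)) (subsets n)) ++
    map (inside ∷_) (filter (P? ∘ (inside ∷_)) (subsets n))
filter-subsets {n} P? = trans (filter-++ P? (map (outside ∷_) (subsets n)) _)
  (cong₂ _++_ (filter-map P? (outside ∷_) (subsets n)) (filter-map P? (inside ∷_) (subsets n)))

filter-absurd : ∀ {P : Pred X 0ℓ} (P? : Decidable P) xs → (∀ {x} → x ∈ xs → ¬ P x) → filter P? xs ≡ []
filter-absurd P? xs h = filter-none P? (All.tabulate h)

-- This is how the absence of repetitions in `subsets n` is used: a sum supported on one subset
-- collapses to a single term.
filter-≡ : ∀ (S : Subset n) → filter (S ≟ˢ_) (subsets n) ≡ S ∷ []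
filter-≡ []            = refl
filter-≡ {suc n} (outside ∷ S) = trans (filter-subsets ((outside ∷ S) ≟ˢ_))
  (cong₂ (λ u v → map (outside ∷_) u ++ map (inside ∷_) v)
    (trans (filter-≐ _ (S ≟ˢ_) (∷-injʳ , cong (outside ∷_)) (subsets n)) (filter-≡ S))
    (filter-absurd _ (subsets n) λ _ ()))
filter-≡ {suc n} (inside ∷ S) = trans (filter-subsets ((inside ∷ S) ≟ˢ_))
  (cong₂ (λ u v → map (outside ∷_) u ++ map (inside ∷_) v)
    (filter-absurd _ (subsets n) λ _ ())
    (trans (filter-≐ _ (S ≟ˢ_) (∷-injʳ , cong (inside ∷_)) (subsets n)) (filter-≡ S)))

⊆-equal-size : ∀ {S T : Subset n} → S ⊆ T → ∥ T ∥ ℕ.≤ ∥ S ∥ → S ≡ T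
⊆-equal-size {S = S} {T} S⊆T ∣T∣≤∣S∣ = ⊆-antisym S⊆T T⊆S
  where
  T⊆S : T ⊆ S
  T⊆S {x} x∈T with x ∈? S
  ... | yes x∈S = x∈S
  ... | no  x∉S = contradiction ∣T∣≤∣S∣ (ℕₚ.<⇒≱ (p⊂q⇒∣p∣<∣q∣ (S⊆T , x , x∈T , x∉S)))

-- The covering relation of the Boolean lattice

infix 4 _⋖_ _⋖?_
-- A condition on sizes instead of a witness for the added element keeps the relation decidable at
-- once and lets it split on the first coordinate into the four cases below.
_⋖_ : Subset n → Subset n → Set
F ⋖ B = F ⊆ B × ∥ B ∥ ≡ suc ∥ F ∥

_⋖?_ : Decidable₂ (_⋖_ {n})
F ⋖? B = (F ⊆? B) ×-dec (∥ B ∥ ℕ.≟ suc ∥ F ∥)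

out⋖out : ∀ {F B : Subset n} → outside ∷ F ⋖ outside ∷ B ⇔ F ⋖ B
out⋖out = mk⇔ (λ (F⊆B , eq) → drop-∷-⊆ F⊆B , eq) (λ (F⊆B , eq) → out⊆ F⊆B , eq)

in⋖in : ∀ {F B : Subset n} → inside ∷ F ⋖ inside ∷ B ⇔ F ⋖ B
in⋖in = mk⇔ (λ (F⊆B , eq) → drop-∷-⊆ F⊆B , ℕₚ.suc-injective eq) (λ (F⊆B , eq) → in⊆in F⊆B , cong suc eq)

out⋖in : ∀ {F B : Subset n} → outside ∷ F ⋖ inside ∷ B ⇔ F ≡ B
out⋖in = mk⇔ (λ (F⊆B , eq) → ⊆-equal-size (drop-∷-⊆ F⊆B) (ℕₚ.≤-reflexive (ℕₚ.suc-injective eq)))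
  (λ { refl → out⊆ ⊆-refl , refl })

in⋖̸out : ∀ {F B : Subset n} → ¬ (inside ∷ F ⋖ outside ∷ B)
in⋖̸out (F⊆B , _) with F⊆B here
... | ()

module Covers {A : Set} {_∙_ : Op₂ A} {ε : A}
  (isCommutativeMonoid : IsCommutativeMonoid _≡_ _∙_ ε) where

  open IsCommutativeMonoid isCommutativeMonoid using (identityˡ; identityʳ; comm)
  open BigOperator isCommutativeMonoid

  ⨁-elements-inside : ∀ (S : Subset n) f → ⨁ (elements (inside ∷ S)) f ≡ f zero ∙ ⨁ (elements S) (f ∘ suc)
  ⨁-elements-inside S f = trans (cong (λ xs → ⨁ xs f) (elements-inside S)) (cong (f zero ∙_) (⨁-map suc (elements S) f))

  ⨁-elements-outside : ∀ (S : Subset n) f → ⨁ (elements (outside ∷ S)) f ≡ ⨁ (elements S) (f ∘ suc)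
  ⨁-elements-outside S f = trans (cong (λ xs → ⨁ xs f) (elements-outside S)) (⨁-map suc (elements S) f)

  ⨁-subsets : ∀ {P : Pred (Subset (suc n)) 0ℓ} (P? : Decidable P) f →
    ⨁ (filter P? (subsets (suc n))) f ≡
      ⨁ (filter (P? ∘ (outside ∷_)) (subsets n)) (f ∘ (outside ∷_)) ∙
      ⨁ (filter (P? ∘ (inside ∷_)) (subsets n)) (f ∘ (inside ∷_))
  ⨁-subsets {n} P? f = trans (cong (λ xs → ⨁ xs f) (filter-subsets P?))
    (trans (⨁-++ (map (outside ∷_) (filter (P? ∘ (outside ∷_)) (subsets n))) _ f)
      (cong₂ _∙_ (⨁-map (outside ∷_) (filter (P? ∘ (outside ∷_)) (subsets n)) f)
                 (⨁-map (inside ∷_) (filter (P? ∘ (inside ∷_)) (subsets n)) f)))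

  -- Adding an element is a bijection from the complement of `F` to the covers of `F`. Induction on
  -- the coordinates avoids constructing it: if 0 is not in `F`, exactly one cover contains 0.
  ⨁-covers : ∀ (F : Subset n) f →
    ⨁ (filter (F ⋖?_) (subsets n)) f ≡ ⨁ (elements (∁ F)) (λ e → f (F [ e ]≔ inside))
  ⨁-covers []            f = refl
  ⨁-covers {suc n} (outside ∷ F) f = begin
    ⨁ (filter ((outside ∷ F) ⋖?_) (subsets (suc n))) f
      ≡⟨ ⨁-subsets ((outside ∷ F) ⋖?_) f ⟩
    ⨁ (filter (λ B → (outside ∷ F) ⋖? (outside ∷ B)) (subsets n)) (f ∘ (outside ∷_)) ∙
    ⨁ (filter (λ B → (outside ∷ F) ⋖? (inside ∷ B)) (subsets n)) (f ∘ (inside ∷_))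
      ≡⟨ cong₂ (λ xs ys → ⨁ xs (f ∘ (outside ∷_)) ∙ ⨁ ys (f ∘ (inside ∷_)))
           (filter-⇔ (F ⋖?_) out⋖out (subsets n))
           (trans (filter-⇔ (F ≟ˢ_) out⋖in (subsets n)) (filter-≡ F)) ⟩
    ⨁ (filter (F ⋖?_) (subsets n)) (f ∘ (outside ∷_)) ∙ (f (inside ∷ F) ∙ ε)
      ≡⟨ cong₂ _∙_ (⨁-covers F (f ∘ (outside ∷_))) (identityʳ (f (inside ∷ F))) ⟩
    ⨁ (elements (∁ F)) (λ e → f (outside ∷ F [ e ]≔ inside)) ∙ f (inside ∷ F)
      -- `subsets` lists the sets without 0 first, whereas `elements` lists 0 first.
      ≡⟨ comm _ _ ⟩
    f (inside ∷ F) ∙ ⨁ (elements (∁ F)) (λ e → f (outside ∷ F [ e ]≔ inside))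
      ≡⟨ ⨁-elements-inside (∁ F) (λ e → f ((outside ∷ F) [ e ]≔ inside)) ⟨
    ⨁ (elements (inside ∷ ∁ F)) (λ e → f ((outside ∷ F) [ e ]≔ inside)) ∎
    where open ≡-Reasoning
  ⨁-covers {suc n} (inside ∷ F) f = begin
    ⨁ (filter ((inside ∷ F) ⋖?_) (subsets (suc n))) f
      ≡⟨ ⨁-subsets ((inside ∷ F) ⋖?_) f ⟩
    ⨁ (filter (λ B → (inside ∷ F) ⋖? (outside ∷ B)) (subsets n)) (f ∘ (outside ∷_)) ∙
    ⨁ (filter (λ B → (inside ∷ F) ⋖? (inside ∷ B)) (subsets n)) (f ∘ (inside ∷_))
      ≡⟨ cong₂ (λ xs ys → ⨁ xs (f ∘ (outside ∷_)) ∙ ⨁ ys (f ∘ (inside ∷_)))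
           (filter-absurd _ (subsets n) (λ _ → in⋖̸out))
           (filter-⇔ (F ⋖?_) in⋖in (subsets n)) ⟩
    ε ∙ ⨁ (filter (F ⋖?_) (subsets n)) (f ∘ (inside ∷_))
      ≡⟨ trans (identityˡ _) (⨁-covers F (f ∘ (inside ∷_))) ⟩
    ⨁ (elements (∁ F)) (λ e → f (inside ∷ F [ e ]≔ inside))
      ≡⟨ ⨁-elements-outside (∁ F) (λ e → f ((inside ∷ F) [ e ]≔ inside)) ⟨
    ⨁ (elements (outside ∷ ∁ F)) (λ e → f ((inside ∷ F) [ e ]≔ inside)) ∎
    where open ≡-Reasoning

  ⨁-cocovers : ∀ (B : Subset n) f →
    ⨁ (filter (_⋖? B) (subsets n)) f ≡ ⨁ (elements B) (λ e → f (B [ e ]≔ outside))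
  ⨁-cocovers []            f = refl
  ⨁-cocovers {suc n} (outside ∷ B) f = begin
    ⨁ (filter (_⋖? (outside ∷ B)) (subsets (suc n))) f
      ≡⟨ ⨁-subsets (_⋖? (outside ∷ B)) f ⟩
    ⨁ (filter (λ F → (outside ∷ F) ⋖? (outside ∷ B)) (subsets n)) (f ∘ (outside ∷_)) ∙
    ⨁ (filter (λ F → (inside ∷ F) ⋖? (outside ∷ B)) (subsets n)) (f ∘ (inside ∷_))
      ≡⟨ cong₂ (λ xs ys → ⨁ xs (f ∘ (outside ∷_)) ∙ ⨁ ys (f ∘ (inside ∷_)))
           (filter-⇔ (_⋖? B) out⋖out (subsets n))
           (filter-absurd _ (subsets n) (λ _ → in⋖̸out)) ⟩
    ⨁ (filter (_⋖? B) (subsets n)) (f ∘ (outside ∷_)) ∙ ε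
      ≡⟨ trans (identityʳ _) (⨁-cocovers B (f ∘ (outside ∷_))) ⟩
    ⨁ (elements B) (λ e → f (outside ∷ B [ e ]≔ outside))
      ≡⟨ ⨁-elements-outside B (λ e → f ((outside ∷ B) [ e ]≔ outside)) ⟨
    ⨁ (elements (outside ∷ B)) (λ e → f ((outside ∷ B) [ e ]≔ outside)) ∎
    where open ≡-Reasoning
  ⨁-cocovers {suc n} (inside ∷ B) f = begin
    ⨁ (filter (_⋖? (inside ∷ B)) (subsets (suc n))) f
      ≡⟨ ⨁-subsets (_⋖? (inside ∷ B)) f ⟩
    ⨁ (filter (λ F → (outside ∷ F) ⋖? (inside ∷ B)) (subsets n)) (f ∘ (outside ∷_)) ∙
    ⨁ (filter (λ F → (inside ∷ F) ⋖? (inside ∷ B)) (subsets n)) (f ∘ (inside ∷_))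
      ≡⟨ cong₂ (λ xs ys → ⨁ xs (f ∘ (outside ∷_)) ∙ ⨁ ys (f ∘ (inside ∷_)))
           (trans (filter-⇔ (B ≟ˢ_) (mk⇔ (sym ∘ Equivalence.to out⋖in) (Equivalence.from out⋖in ∘ sym)) (subsets n)) (filter-≡ B))
           (filter-⇔ (_⋖? B) in⋖in (subsets n)) ⟩
    (f (outside ∷ B) ∙ ε) ∙ ⨁ (filter (_⋖? B) (subsets n)) (f ∘ (inside ∷_))
      ≡⟨ cong₂ _∙_ (identityʳ (f (outside ∷ B))) (⨁-cocovers B (f ∘ (inside ∷_))) ⟩
    f (outside ∷ B) ∙ ⨁ (elements B) (λ e → f (inside ∷ B [ e ]≔ outside))
      ≡⟨ ⨁-elements-inside B (λ e → f ((inside ∷ B) [ e ]≔ outside)) ⟨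
    ⨁ (elements (inside ∷ B)) (λ e → f ((inside ∷ B) [ e ]≔ outside)) ∎
    where open ≡-Reasoning

-- Rational sums, products and the weights of pairs of subsets

module Sum  = BigOperator +-0-isCommutativeMonoid
module Prod = BigOperator *-1-isCommutativeMonoid
open Sum  using () renaming (⨁ to ∑; _×′_ to _·_)
open Prod using () renaming (⨁ to ∏)

∑-mono : ∀ (xs : List X) {f g} → (∀ {x} → x ∈ xs → f x ≤ g x) → ∑ xs f ≤ ∑ xs g
∑-mono []       h = ≤-refl
∑-mono (x ∷ xs) h = +-mono-≤ (h (here refl)) (∑-mono xs (h ∘ there))

∑-nonneg : ∀ (xs : List X) {f} → (∀ {x} → x ∈ xs → 0ℚ ≤ f x) → 0ℚ ≤ ∑ xs f
∑-nonneg xs h = subst (_≤ ∑ xs _) (Sum.⨁-ε xs) (∑-mono xs h)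

∈⇒≤∑ : ∀ {x} {xs : List X} {f} → x ∈ xs → (∀ {y} → y ∈ xs → 0ℚ ≤ f y) → f x ≤ ∑ xs f
∈⇒≤∑ {x = x} {_ ∷ xs} {f} (here refl) 0≤f = subst (_≤ f x + ∑ xs f) (+-identityʳ (f x)) (+-monoʳ-≤ (f x) (∑-nonneg xs (0≤f ∘ there)))
∈⇒≤∑ {x = x} {y ∷ xs} {f} (there x∈)  0≤f = ≤-trans (∈⇒≤∑ x∈ (0≤f ∘ there))
  (subst (_≤ f y + ∑ xs f) (+-identityˡ (∑ xs f)) (+-monoˡ-≤ (∑ xs f) (0≤f (here refl))))

∑-distribʳ-* : ∀ (xs : List X) f c → ∑ xs (λ x → f x * c) ≡ ∑ xs f * c
∑-distribʳ-* []       f c = sym (*-zeroˡ c)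
∑-distribʳ-* (x ∷ xs) f c = trans (cong (f x * c +_) (∑-distribʳ-* xs f c)) (sym (*-distribʳ-+ c (f x) (∑ xs f)))

·≡* : ∀ k c → k · c ≡ fromℕ k * c
·≡* zero    c = sym (*-zeroˡ c)
·≡* (suc k) c = trans (cong (c +_) (·≡* k c))
  (trans (solve 2 (λ k c → c :+ k :* c := (con 1ℚ :+ k) :* c) refl (fromℕ k) c) (cong (_* c) (sym (fromℕ-+ 1 k))))

∑-1 : ∀ (xs : List X) → ∑ xs (λ _ → 1ℚ) ≡ fromℕ (length xs)
∑-1 xs = trans (Sum.⨁-const xs 1ℚ) (trans (·≡* (length xs) 1ℚ) (*-identityʳ _))

𝟙 : {P : Set} → Dec P → ℚ
𝟙 P? = if does P? then 1ℚ else 0ℚ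

0≤𝟙 : {P : Set} (P? : Dec P) → 0ℚ ≤ 𝟙 P?
0≤𝟙 (yes _) = 0≤1
0≤𝟙 (no _)  = ≤-refl

𝟙≤ : {P : Set} (P? : Dec P) {q : ℚ} → (P → 1ℚ ≤ q) → 0ℚ ≤ q → 𝟙 P? ≤ q
𝟙≤ (yes p) 1≤q 0≤q = 1≤q p
𝟙≤ (no _)  1≤q 0≤q = 0≤q

≤𝟙 : {P : Set} (P? : Dec P) {q : ℚ} → (P → q ≤ 1ℚ) → (¬ P → q ≤ 0ℚ) → q ≤ 𝟙 P?
≤𝟙 (yes p) q≤1 q≤0 = q≤1 p
≤𝟙 (no ¬p) q≤1 q≤0 = q≤0 ¬p

if-0 : {P : Set} (P? : Dec P) {q : ℚ} → (P → q ≡ 0ℚ) → (if does P? then q else 0ℚ) ≡ 0ℚ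
if-0 (yes p) q≡0 = q≡0 p
if-0 (no _)  q≡0 = refl

𝟙-yes : {P : Set} (P? : Dec P) → P → 𝟙 P? ≡ 1ℚ
𝟙-yes P? p = cong (if_then 1ℚ else 0ℚ) (dec-true P? p)

-- W A B x is the product of x e over B ∖ A if A ⊆ B, and 0 otherwise.
W : Subset n → Subset n → (Fin n → ℚ) → ℚ
W []            []            x = 1ℚ
W (outside ∷ A) (outside ∷ B) x = W A B (x ∘ suc)
W (outside ∷ A) (inside  ∷ B) x = x zero * W A B (x ∘ suc)
W (inside  ∷ A) (outside ∷ B) x = 0ℚ
W (inside  ∷ A) (inside  ∷ B) x = W A B (x ∘ suc)

0≤W : ∀ (A B : Subset n) {x} → (∀ e → 0ℚ ≤ x e) → 0ℚ ≤ W A B x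
0≤W []            []            0≤x = 0≤1
0≤W (outside ∷ A) (outside ∷ B) 0≤x = 0≤W A B (0≤x ∘ suc)
0≤W (outside ∷ A) (inside  ∷ B) 0≤x = 0≤* (0≤x zero) (0≤W A B (0≤x ∘ suc))
0≤W (inside  ∷ A) (outside ∷ B) 0≤x = ≤-refl
0≤W (inside  ∷ A) (inside  ∷ B) 0≤x = 0≤W A B (0≤x ∘ suc)

W-⊈ : ∀ (A B : Subset n) x → ¬ A ⊆ B → W A B x ≡ 0ℚ
W-⊈ []            []            x A⊈B = ⊥-elim (A⊈B ⊆-refl)
W-⊈ (outside ∷ A) (outside ∷ B) x A⊈B = W-⊈ A B (x ∘ suc) (λ A⊆B → A⊈B (out⊆ A⊆B))
W-⊈ (outside ∷ A) (inside  ∷ B) x A⊈B =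
  trans (cong (x zero *_) (W-⊈ A B (x ∘ suc) (λ A⊆B → A⊈B (out⊆ A⊆B)))) (*-zeroʳ (x zero))
W-⊈ (inside  ∷ A) (outside ∷ B) x A⊈B = refl
W-⊈ (inside  ∷ A) (inside  ∷ B) x A⊈B = W-⊈ A B (x ∘ suc) (λ A⊆B → A⊈B (in⊆in A⊆B))

W-self : ∀ (A : Subset n) x → W A A x ≡ 1ℚ
W-self []            x = refl
W-self (outside ∷ A) x = W-self A (x ∘ suc)
W-self (inside  ∷ A) x = W-self A (x ∘ suc)

-- Both sides vanish unless `A ⊆ B`, so the factor can be split off without assuming the inclusion.
W-insert : ∀ (A B : Subset n) x {e} → e ∈ˢ B → e ∉ A → W A B x ≡ x e * W (A [ e ]≔ inside) B x
W-insert (outside ∷ A) (inside  ∷ B) x {zero}  e∈B e∉A = refl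
W-insert (inside  ∷ A) (inside  ∷ B) x {zero}  e∈B e∉A = contradiction here e∉A
W-insert (outside ∷ A) (outside ∷ B) x {suc e} e∈B e∉A = W-insert A B (x ∘ suc) (drop-there e∈B) (e∉A ∘ there)
W-insert (outside ∷ A) (inside  ∷ B) x {suc e} e∈B e∉A = trans
  (cong (x zero *_) (W-insert A B (x ∘ suc) (drop-there e∈B) (e∉A ∘ there)))
  (solve 3 (λ a b c → a :* (b :* c) := b :* (a :* c)) refl (x zero) (x (suc e)) _)
W-insert (inside  ∷ A) (outside ∷ B) x {suc e} e∈B e∉A = sym (*-zeroʳ (x (suc e)))
W-insert (inside  ∷ A) (inside  ∷ B) x {suc e} e∈B e∉A = W-insert A B (x ∘ suc) (drop-there e∈B) (e∉A ∘ there)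

-- In the expanded product, the subset `A` of `B` records the factors from which 1 is chosen; sets
-- that are not contained in `B` contribute 0.
∑-W : ∀ (B : Subset n) x → ∑ (subsets n) (λ A → W A B x) ≡ ∏ (elements B) (λ e → 1ℚ + x e)
∑-W [] x = refl
∑-W {suc n} (outside ∷ B) x = begin
  ∑ (subsets (suc n)) (λ A → W A (outside ∷ B) x)
    ≡⟨ Sum.⨁-++ (map (outside ∷_) (subsets n)) (map (inside ∷_) (subsets n)) _ ⟩
  ∑ (map (outside ∷_) (subsets n)) (λ A → W A (outside ∷ B) x) + ∑ (map (inside ∷_) (subsets n)) (λ A → W A (outside ∷ B) x)
    ≡⟨ cong₂ _+_ (Sum.⨁-map (outside ∷_) (subsets n) _) (trans (Sum.⨁-map (inside ∷_) (subsets n) _) (Sum.⨁-ε (subsets n))) ⟩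
  ∑ (subsets n) (λ A → W A B (x ∘ suc)) + 0ℚ
    ≡⟨ trans (+-identityʳ _) (∑-W B (x ∘ suc)) ⟩
  ∏ (elements B) (λ e → 1ℚ + x (suc e))
    ≡⟨ Covers.⨁-elements-outside *-1-isCommutativeMonoid B (λ e → 1ℚ + x e) ⟨
  ∏ (elements (outside ∷ B)) (λ e → 1ℚ + x e) ∎
  where open ≡-Reasoning
∑-W {suc n} (inside ∷ B) x = begin
  ∑ (subsets (suc n)) (λ A → W A (inside ∷ B) x)
    ≡⟨ Sum.⨁-++ (map (outside ∷_) (subsets n)) (map (inside ∷_) (subsets n)) _ ⟩
  ∑ (map (outside ∷_) (subsets n)) (λ A → W A (inside ∷ B) x) + ∑ (map (inside ∷_) (subsets n)) (λ A → W A (inside ∷ B) x)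
    ≡⟨ cong₂ _+_ (Sum.⨁-map (outside ∷_) (subsets n) _) (Sum.⨁-map (inside ∷_) (subsets n) _) ⟩
  ∑ (subsets n) (λ A → x zero * W A B (x ∘ suc)) + S
    ≡⟨ cong (_+ S) (trans (Sum.⨁-cong (subsets n) (λ {A} _ → *-comm (x zero) (W A B (x ∘ suc)))) (∑-distribʳ-* (subsets n) _ (x zero))) ⟩
  S * x zero + S
    ≡⟨ solve 2 (λ s x → s :* x :+ s := (con 1ℚ :+ x) :* s) refl S (x zero) ⟩
  (1ℚ + x zero) * S
    ≡⟨ cong ((1ℚ + x zero) *_) (∑-W B (x ∘ suc)) ⟩
  (1ℚ + x zero) * ∏ (elements B) (λ e → 1ℚ + x (suc e))
    ≡⟨ Covers.⨁-elements-inside *-1-isCommutativeMonoid B (λ e → 1ℚ + x e) ⟨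
  ∏ (elements (inside ∷ B)) (λ e → 1ℚ + x e) ∎
  where
  open ≡-Reasoning
  S = ∑ (subsets n) (λ A → W A B (x ∘ suc))

-- Inserting and removing one element

∈-insert⁺ : ∀ {A : Subset n} {e x} → x ≡ e ⊎ x ∈ˢ A → x ∈ˢ A [ e ]≔ inside
∈-insert⁺ {A = A} {e} (inj₁ refl) = []≔-updates A e
∈-insert⁺ {A = A} {e} {x} (inj₂ x∈A) with x Finₚ.≟ e
... | yes refl = []≔-updates A e
... | no  x≢e  = []≔-minimal A x e x≢e x∈A

∈-insert⁻ : ∀ {A : Subset n} {e x} → x ∈ˢ A [ e ]≔ inside → x ≡ e ⊎ x ∈ˢ A
∈-insert⁻ {A = A} {e} {x} x∈ with x Finₚ.≟ e
... | yes x≡e = inj₁ x≡e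
... | no  x≢e = inj₂ (lookup⇒[]= x A (trans (sym (lookup∘update′ x≢e A inside)) ([]=⇒lookup x∈)))

∈-remove⁺ : ∀ {A : Subset n} {e x} → x ≢ e → x ∈ˢ A → x ∈ˢ A [ e ]≔ outside
∈-remove⁺ {A = A} {e} {x} x≢e x∈A = []≔-minimal A x e x≢e x∈A

∈-remove⁻ : ∀ {A : Subset n} {e x} → x ∈ˢ A [ e ]≔ outside → x ≢ e × x ∈ˢ A
∈-remove⁻ {A = A} {e} {x} x∈ with x Finₚ.≟ e
... | yes refl = contradiction (trans (sym (lookup∘update e A outside)) ([]=⇒lookup x∈)) λ ()
... | no  x≢e  = x≢e , lookup⇒[]= x A (trans (sym (lookup∘update′ x≢e A outside)) ([]=⇒lookup x∈))

∪-⁅⁆ : ∀ (A : Subset n) e → A ∪ ⁅ e ⁆ ≡ A [ e ]≔ inside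
∪-⁅⁆ (outside ∷ A) zero    = cong (inside ∷_) (∪-identityʳ A)
∪-⁅⁆ (inside  ∷ A) zero    = cong (inside ∷_) (∪-identityʳ A)
∪-⁅⁆ (outside ∷ A) (suc e) = cong (outside ∷_) (∪-⁅⁆ A e)
∪-⁅⁆ (inside  ∷ A) (suc e) = cong (inside ∷_) (∪-⁅⁆ A e)

∣insert∣ : ∀ {A : Subset n} {e} → e ∉ A → ∥ A [ e ]≔ inside ∥ ≡ suc ∥ A ∥
∣insert∣ {A = outside ∷ A} {zero}  e∉A = refl
∣insert∣ {A = inside  ∷ A} {zero}  e∉A = contradiction here e∉A
∣insert∣ {A = outside ∷ A} {suc e} e∉A = ∣insert∣ (e∉A ∘ there)
∣insert∣ {A = inside  ∷ A} {suc e} e∉A = cong suc (∣insert∣ (e∉A ∘ there))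

insert-remove : ∀ {A : Subset n} {e} → e ∈ˢ A → (A [ e ]≔ outside) [ e ]≔ inside ≡ A
insert-remove {A = A} {e} e∈A = trans ([]≔-idempotent A e)
  (trans (cong (A [ e ]≔_) (sym ([]=⇒lookup e∈A))) ([]≔-lookup A e))

∣remove∣ : ∀ {A : Subset n} {e} → e ∈ˢ A → ∥ A ∥ ≡ suc ∥ A [ e ]≔ outside ∥
∣remove∣ {A = A} {e} e∈A = trans (cong ∥_∥ (sym (insert-remove e∈A)))
  (∣insert∣ {A = A [ e ]≔ outside} (λ e∈ → proj₁ (∈-remove⁻ {A = A} e∈) refl))

-- Matroids

module Bases {n} (M : Matroid n) {r} (rank : HasRank M r) where
  open Matroid M

  bases : List (Subset n)
  bases = filter (isBasis? M) (subsets n)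

  ∈-bases⁻ : ∀ {B} → B ∈ bases → IsBasis M B
  ∈-bases⁻ B∈ = proj₂ (∈-filter⁻ (isBasis? M) {xs = subsets n} B∈)

  ∈-bases⁺ : ∀ {B} → IsBasis M B → B ∈ bases
  ∈-bases⁺ {B} = ∈-filter⁺ (isBasis? M) (∈-subsets B)

  augment : ∀ {A B} → Independent A → Independent B → ∥ A ∥ ℕ.< ∥ B ∥ →
    ∃ λ e → e ∈ˢ B × e ∉ A × Independent (A [ e ]≔ inside)
  augment {A} indA indB A<B with augmentation indA indB A<B
  ... | e , e∈B , e∉A , ind = e , e∈B , e∉A , subst Independent (∪-⁅⁆ A e) ind

  independent-size : ∀ {A} → Independent A → ∥ A ∥ ℕ.≤ r
  independent-size {A} indA = ℕₚ.≮⇒≥ λ r<A →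
    let B , isB = basis-exists M
        e , _ , e∉B , ind = augment (proj₁ isB) indA (subst (ℕ._< ∥ A ∥) (sym (rank B isB)) r<A)
    in proj₂ isB _ ind ((λ x∈B → ∈-insert⁺ (inj₂ x∈B)) , e , ∈-insert⁺ (inj₁ refl) , e∉B)

  isBasis : ∀ {B} → Independent B → ∥ B ∥ ≡ r → IsBasis M B
  isBasis indB ∣B∣≡r = indB , λ T indT B⊂T →
    ℕₚ.<⇒≱ (p⊂q⇒∣p∣<∣q∣ B⊂T) (ℕₚ.≤-trans (independent-size indT) (ℕₚ.≤-reflexive (sym ∣B∣≡r)))

  -- Repeated augmentation of `A` from `B`. The last component, that every new element comes from
  -- `B`, is what `exchange` rests on.
  extend : ∀ k {A B} → Independent A → IsBasis M B → ∥ A ∥ ℕ.+ k ≡ r →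
    ∃ λ D → IsBasis M D × A ⊆ D × (∀ {x} → x ∈ˢ D → x ∈ˢ A ⊎ x ∈ˢ B)
  extend zero    {A} indA isB eq = A , isBasis indA (trans (sym (ℕₚ.+-identityʳ _)) eq) , ⊆-refl , inj₁
  extend (suc k) {A} {B} indA isB eq
    with augment indA (proj₁ isB) (subst (∥ A ∥ ℕ.<_) (trans eq (sym (rank B isB))) (ℕₚ.m<m+n ∥ A ∥ (s≤s z≤n)))
  ... | e , e∈B , e∉A , indA′
    with extend k indA′ isB (trans (cong (ℕ._+ k) (∣insert∣ e∉A)) (trans (sym (ℕₚ.+-suc ∥ A ∥ k)) eq))
  ...   | D , isD , A′⊆D , D⊆ = D , isD , (λ x∈A → A′⊆D (∈-insert⁺ (inj₂ x∈A))) , λ x∈D →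
    [ (λ x∈A′ → [ (λ { refl → inj₂ e∈B }) , inj₁ ]′ (∈-insert⁻ x∈A′)) , inj₂ ]′ (D⊆ x∈D)

  -- For `x ∈ B` the choice is e = x. Otherwise A + x extends from `B` to a basis D inside B + x. As
  -- D and `B` have the same size, D omits an element e of `B`, so D = B - e + x, and e is not in
  -- `A` because `A ⊆ D`. The component `x ∉ B [ e ]≔ outside` places `x` in the index set of
  -- `δ-extensions`.
  exchange : ∀ {A B x} → IsBasis M B → A ⊆ B → x ∉ A → Independent (A [ x ]≔ inside) →
    ∃ λ e → e ∈ˢ B × e ∉ A × x ∉ B [ e ]≔ outside × IsBasis M ((B [ e ]≔ outside) [ x ]≔ inside)
  exchange {A} {B} {x} isB A⊆B x∉A ind with x ∈? B
  ... | yes x∈B = x , x∈B , x∉A , (λ x∈ → proj₁ (∈-remove⁻ {A = B} x∈) refl) , subst (IsBasis M) (sym (insert-remove x∈B)) isB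
  ... | no  x∉B with extend (r ∸ ∥ A [ x ]≔ inside ∥) ind isB (ℕₚ.m+[n∸m]≡n (independent-size ind))
  ...   | D , isD , A′⊆D , D⊆ with Finₚ.any? (λ e → (e ∈? B) ×-dec ¬? (e ∈? D))
  ...     | no none = contradiction (p⊆q⇒∣p∣≤∣q∣ B+x⊆D) (ℕₚ.<⇒≱ (ℕₚ.≤-reflexive (begin
    suc ∥ D ∥              ≡⟨ cong suc (trans (rank D isD) (sym (rank B isB))) ⟩
    suc ∥ B ∥              ≡⟨ ∣insert∣ x∉B ⟨
    ∥ B [ x ]≔ inside ∥    ∎)))
    where
    open ≡-Reasoning
    B⊆D : B ⊆ D
    B⊆D {y} y∈B with y ∈? D
    ... | yes y∈D = y∈D
    ... | no  y∉D = contradiction (y , y∈B , y∉D) none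
    B+x⊆D : B [ x ]≔ inside ⊆ D
    B+x⊆D y∈ = [ (λ { refl → A′⊆D (∈-insert⁺ (inj₁ refl)) }) , B⊆D ]′ (∈-insert⁻ y∈)
  ...     | yes (e , e∈B , e∉D) = e , e∈B , (λ e∈A → e∉D (A′⊆D (∈-insert⁺ (inj₂ e∈A)))) , x∉B-e ,
    subst (IsBasis M) (⊆-equal-size D⊆B-e+x (ℕₚ.≤-reflexive (begin
      ∥ (B [ e ]≔ outside) [ x ]≔ inside ∥  ≡⟨ ∣insert∣ x∉B-e ⟩
      suc ∥ B [ e ]≔ outside ∥              ≡⟨ ∣remove∣ e∈B ⟨
      ∥ B ∥                                 ≡⟨ trans (rank B isB) (sym (rank D isD)) ⟩
      ∥ D ∥                                 ∎))) isD
    where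
    open ≡-Reasoning
    x∉B-e : x ∉ B [ e ]≔ outside
    x∉B-e x∈ = x∉B (proj₂ (∈-remove⁻ {A = B} x∈))
    from-B : ∀ {y} → y ∈ˢ D → y ∈ˢ B → y ∈ˢ (B [ e ]≔ outside) [ x ]≔ inside
    from-B y∈D y∈B = ∈-insert⁺ (inj₂ (∈-remove⁺ (λ { refl → e∉D y∈D }) y∈B))
    D⊆B-e+x : D ⊆ (B [ e ]≔ outside) [ x ]≔ inside
    D⊆B-e+x y∈D = [ (λ y∈A′ → [ (λ y≡x → ∈-insert⁺ (inj₁ y≡x)) , (λ y∈A → from-B y∈D (A⊆B y∈A)) ]′ (∈-insert⁻ y∈A′))
                  , from-B y∈D ]′ (D⊆ y∈D)

  remove-⊆ : ∀ (B : Subset n) e → B [ e ]≔ outside ⊆ B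
  remove-⊆ B e x∈ = proj₂ (∈-remove⁻ {A = B} x∈)

  0<δ : ∀ {F B} → IsBasis M B → F ⊆ B → 0 ℕ.< δ M F
  0<δ {F} isB F⊆B = ∈⇒0<length (∈-filter⁺ (F ⊆?_) (∈-bases⁺ isB) F⊆B)

  ⊆-bases≡⋖-bases : ∀ {F} → r ≡ suc ∥ F ∥ → filter (F ⊆?_) bases ≡ filter (F ⋖?_) bases
  ⊆-bases≡⋖-bases {F} eq = filter-cong (F ⊆?_) (F ⋖?_) bases
    (λ {B} B∈ F⊆B → F⊆B , trans (rank B (∈-bases⁻ B∈)) eq) (λ _ → proj₁)

  -- A basis above `F` adds exactly one element. As a sum over elements, δ can be interchanged with
  -- a sum over the removed elements in `exchange-count`.
  δ-extensions : ∀ F → r ≡ suc ∥ F ∥ →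
    fromℕ (δ M F) ≡ ∑ (elements (∁ F)) (λ x → 𝟙 (isBasis? M (F [ x ]≔ inside)))
  δ-extensions F eq = begin
    fromℕ (δ M F)
      ≡⟨ cong (fromℕ ∘ length) (⊆-bases≡⋖-bases eq) ⟩
    fromℕ (length (filter (F ⋖?_) bases))
      ≡⟨ cong (fromℕ ∘ length) (trans
           (filter-filter (isBasis? M) (F ⋖?_) both? _,_ (λ p → p) (subsets n))
           (sym (filter-filter (F ⋖?_) (isBasis? M) both? (λ c b → b , c) (λ (b , c) → c , b) (subsets n)))) ⟩
    fromℕ (length (filter (isBasis? M) (filter (F ⋖?_) (subsets n))))
      ≡⟨ ∑-1 (filter (isBasis? M) (filter (F ⋖?_) (subsets n))) ⟨
    ∑ (filter (isBasis? M) (filter (F ⋖?_) (subsets n))) (λ _ → 1ℚ)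
      ≡⟨ Sum.⨁-filter (isBasis? M) (filter (F ⋖?_) (subsets n)) (λ _ → 1ℚ) ⟩
    ∑ (filter (F ⋖?_) (subsets n)) (λ B → 𝟙 (isBasis? M B))
      ≡⟨ Covers.⨁-covers +-0-isCommutativeMonoid F (λ B → 𝟙 (isBasis? M B)) ⟩
    ∑ (elements (∁ F)) (λ x → 𝟙 (isBasis? M (F [ x ]≔ inside))) ∎
    where
    open ≡-Reasoning
    both? : Decidable (λ B → IsBasis M B × F ⋖ B)
    both? B = isBasis? M B ×-dec (F ⋖? B)

-- Weights of bases and the bound by the number of independent sets

module Weights {n} (M : Matroid n) {r} (rank : HasRank M r) where
  open Matroid M
  open Bases M rank

  -- Each independent set of size r - 1 divides weight 1 equally among the bases that contain it, so
  -- for sets of that size `∑-W≤1` holds with equality.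
  share : Subset n → Fin n → ℚ
  share B e = 1ℚ ÷ fromℕ (δ M (B [ e ]≔ outside))

  0≤share : ∀ B e → 0ℚ ≤ share B e
  0≤share B e = 0≤* 0≤1 (0≤inv _ (0≤fromℕ (δ M (B [ e ]≔ outside))))

  δ*share : ∀ {B} e → IsBasis M B → fromℕ (δ M (B [ e ]≔ outside)) * share B e ≡ 1ℚ
  δ*share {B} e isB = trans (cong (fromℕ d *_) (*-identityˡ _)) (*-inv (0<fromℕ (0<δ isB (remove-⊆ B e))))
    where d = δ M (B [ e ]≔ outside)

  -- Counts the pairs (e, x), with e in `B` but not in `A`, for which B - e + x is a basis. For
  -- fixed e there are δ(B - e) of them; for fixed x with A + x independent, `exchange` provides at
  -- least one.
  exchange-count : ∀ {A B} → IsBasis M B → A ⊆ B →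
    ∑ (elements (∁ A)) (λ x → 𝟙 (independent? (A [ x ]≔ inside))) ≤
    ∑ (filter (_∈? B) (elements (∁ A))) (λ e → fromℕ (δ M (B [ e ]≔ outside)))
  exchange-count {A} {B} isB A⊆B = ≤-trans (∑-mono (elements (∁ A)) term) (≤-reflexive (sym double))
    where
    swapped? : ∀ e x → Dec (x ∈ˢ ∁ (B [ e ]≔ outside))
    swapped? e x = x ∈? ∁ (B [ e ]≔ outside)
    E : List (Fin n)
    E = filter (_∈? B) (elements (∁ A))
    exchanged : Fin n → Fin n → ℚ
    exchanged e x = 𝟙 (isBasis? M ((B [ e ]≔ outside) [ x ]≔ inside))
    ∈E⁻ : ∀ {e} → e ∈ E → e ∉ A × e ∈ˢ B
    ∈E⁻ e∈ with ∈-filter⁻ (_∈? B) {xs = elements (∁ A)} e∈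
    ... | e∈∁A , e∈B = x∈∁p⇒x∉p (∈-elements⁻ e∈∁A) , e∈B
    inner : ∀ {e} → e ∈ E → fromℕ (δ M (B [ e ]≔ outside)) ≡ ∑ (filter (swapped? e) (elements (∁ A))) (exchanged e)
    inner {e} e∈ = let e∉A , e∈B = ∈E⁻ e∈ in trans (δ-extensions (B [ e ]≔ outside) (trans (sym (rank B isB)) (∣remove∣ e∈B)))
      -- Since e is not in `A`, the set B - e contains `A`, so its complement lies in `∁ A` and both
      -- orders of summation can use the list `elements (∁ A)`.
      (cong (λ xs → ∑ xs (exchanged e)) (sym (elements-⊆ (p⊆q⇒∁p⊇∁q
        λ {y} y∈A → ∈-remove⁺ (λ { refl → e∉A y∈A }) (A⊆B y∈A)))))
    double : ∑ E (λ e → fromℕ (δ M (B [ e ]≔ outside))) ≡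
      ∑ (elements (∁ A)) (λ x → ∑ (filter (λ e → swapped? e x) E) (λ e → exchanged e x))
    double = trans (Sum.⨁-cong E inner) (Sum.⨁-swap-filter swapped? E (elements (∁ A)) exchanged)
    term : ∀ {x} → x ∈ elements (∁ A) →
      𝟙 (independent? (A [ x ]≔ inside)) ≤ ∑ (filter (λ e → swapped? e x) E) (λ e → exchanged e x)
    term {x} x∈ = 𝟙≤ (independent? (A [ x ]≔ inside))
      (λ ind →
        let e , e∈B , e∉A , x∉ , isB′ = exchange isB A⊆B (x∈∁p⇒x∉p (∈-elements⁻ x∈)) ind
        in subst (_≤ ∑ (filter (λ e → swapped? e x) E) (λ e → exchanged e x))
          (𝟙-yes (isBasis? M ((B [ e ]≔ outside) [ x ]≔ inside)) isB′)
          (∈⇒≤∑ {f = λ e → exchanged e x}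
            (∈-filter⁺ (λ e → swapped? e x) (∈-filter⁺ (_∈? B) (∈-elements⁺ (x∉p⇒x∈∁p e∉A)) e∈B) (x∉p⇒x∈∁p x∉))
            (λ {e} _ → 0≤exchanged e)))
      (∑-nonneg (filter (λ e → swapped? e x) E) (λ {e} _ → 0≤exchanged e))
      where
      0≤exchanged : ∀ e → 0ℚ ≤ exchanged e x
      0≤exchanged e = 0≤𝟙 (isBasis? M ((B [ e ]≔ outside) [ x ]≔ inside))

  -- `W-insert` splits 1/δ(B - e) off the weight of `A`, so multiplying that weight by δ(B - e)
  -- gives exactly the weight of A + e. Summing over e turns `exchange-count` into this inequality;
  -- the elements outside `B` add nothing.
  W-expand : ∀ {A B} → IsBasis M B →
    ∑ (elements (∁ A)) (λ x → 𝟙 (independent? (A [ x ]≔ inside))) * W A B (share B) ≤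
    ∑ (elements (∁ A)) (λ e → W (A [ e ]≔ inside) B (share B))
  W-expand {A} {B} isB = by-cases (A ⊆? B)
    where
    open ≤-Reasoning
    m w : ℚ
    m = ∑ (elements (∁ A)) (λ x → 𝟙 (independent? (A [ x ]≔ inside)))
    w = W A B (share B)
    E : List (Fin n)
    E = filter (_∈? B) (elements (∁ A))
    term : ∀ {e} → e ∈ E → fromℕ (δ M (B [ e ]≔ outside)) * w ≡ W (A [ e ]≔ inside) B (share B)
    term {e} e∈ = let e∈∁A , e∈B = ∈-filter⁻ (_∈? B) {xs = elements (∁ A)} e∈ in
      trans (cong (fromℕ (δ M (B [ e ]≔ outside)) *_) (W-insert A B (share B) e∈B (x∈∁p⇒x∉p (∈-elements⁻ e∈∁A))))
        (trans (sym (*-assoc (fromℕ (δ M (B [ e ]≔ outside))) (share B e) (W (A [ e ]≔ inside) B (share B))))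
          (trans (cong (_* W (A [ e ]≔ inside) B (share B)) (δ*share e isB)) (*-identityˡ _)))
    by-cases : Dec (A ⊆ B) → m * w ≤ ∑ (elements (∁ A)) (λ e → W (A [ e ]≔ inside) B (share B))
    by-cases (no A⊈B) = subst (_≤ ∑ (elements (∁ A)) (λ e → W (A [ e ]≔ inside) B (share B)))
      (sym (trans (cong (m *_) (W-⊈ A B (share B) A⊈B)) (*-zeroʳ m)))
      (∑-nonneg (elements (∁ A)) (λ {e} _ → 0≤W (A [ e ]≔ inside) B (0≤share B)))
    by-cases (yes A⊆B) = begin
      m * w
        ≤⟨ *-monoʳ-≤-nonNeg w {{ℚ.nonNegative (0≤W A B (0≤share B))}} (exchange-count isB A⊆B) ⟩
      ∑ E (λ e → fromℕ (δ M (B [ e ]≔ outside))) * w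
        ≡⟨ ∑-distribʳ-* E (λ e → fromℕ (δ M (B [ e ]≔ outside))) w ⟨
      ∑ E (λ e → fromℕ (δ M (B [ e ]≔ outside)) * w)
        ≡⟨ Sum.⨁-cong E term ⟩
      ∑ E (λ e → W (A [ e ]≔ inside) B (share B))
        ≡⟨ Sum.⨁-restrict (_∈? B) (elements (∁ A)) (λ e → W (A [ e ]≔ inside) B (share B))
             (λ {e} _ e∉B → W-⊈ (A [ e ]≔ inside) B (share B) λ A′⊆B → e∉B (A′⊆B (∈-insert⁺ (inj₁ refl)))) ⟨
      ∑ (elements (∁ A)) (λ e → W (A [ e ]≔ inside) B (share B)) ∎

  -- Induction on r - |A|: averaging over the independent one-element extensions of A.
  ∑-W≤1 : ∀ k {A} → Independent A → ∥ A ∥ ℕ.+ k ≡ r → ∑ bases (λ B → W A B (share B)) ≤ 1ℚ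
  ∑-W≤1 zero {A} indA eq = ≤-reflexive (begin
    ∑ bases (λ B → W A B (share B))
      ≡⟨ Sum.⨁-filter (isBasis? M) (subsets n) (λ B → W A B (share B)) ⟩
    ∑ (subsets n) onBases
      ≡⟨ Sum.⨁-restrict (A ≟ˢ_) (subsets n) onBases (λ {B} _ → vanish B) ⟩
    ∑ (filter (A ≟ˢ_) (subsets n)) onBases
      ≡⟨ cong (λ xs → ∑ xs onBases) (filter-≡ A) ⟩
    onBases A + 0ℚ
      ≡⟨ +-identityʳ (onBases A) ⟩
    onBases A
      ≡⟨ cong (if_then W A A (share A) else 0ℚ) (dec-true (isBasis? M A) isA) ⟩
    W A A (share A)
      ≡⟨ W-self A (share A) ⟩
    1ℚ ∎)
    where
    open ≡-Reasoning
    onBases : Subset n → ℚ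
    onBases B = if does (isBasis? M B) then W A B (share B) else 0ℚ
    ∣A∣≡r = trans (sym (ℕₚ.+-identityʳ _)) eq
    isA = isBasis indA ∣A∣≡r
    vanish : ∀ B → A ≢ B → onBases B ≡ 0ℚ
    vanish B A≢B = if-0 (isBasis? M B) λ isB → W-⊈ A B (share B) λ A⊆B →
      A≢B (⊆-equal-size A⊆B (ℕₚ.≤-reflexive (trans (rank B isB) (sym ∣A∣≡r))))
  ∑-W≤1 (suc k) {A} indA eq = *-cancelˡ-≤-pos m {{ℚ.positive 0<m}} (begin
    m * ∑ bases (λ B → W A B (share B))
      ≡⟨ trans (*-comm m _) (trans (sym (∑-distribʳ-* bases (λ B → W A B (share B)) m)) (Sum.⨁-cong bases (λ {B} _ → *-comm (W A B (share B)) m))) ⟩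
    ∑ bases (λ B → m * W A B (share B))
      ≤⟨ ∑-mono bases (λ B∈ → W-expand (∈-bases⁻ B∈)) ⟩
    ∑ bases (λ B → ∑ (elements (∁ A)) (λ e → W (A [ e ]≔ inside) B (share B)))
      ≡⟨ Sum.⨁-swap bases (elements (∁ A)) (λ B e → W (A [ e ]≔ inside) B (share B)) ⟩
    ∑ (elements (∁ A)) (λ e → ∑ bases (λ B → W (A [ e ]≔ inside) B (share B)))
      ≤⟨ ∑-mono (elements (∁ A)) term ⟩
    m
      ≡⟨ *-identityʳ m ⟨
    m * 1ℚ ∎)
    where
    open ≤-Reasoning
    m : ℚ
    m = ∑ (elements (∁ A)) (λ x → 𝟙 (independent? (A [ x ]≔ inside)))
    0<m : 0ℚ < m
    0<m =
      let B , isB = basis-exists M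
          e , _ , e∉A , ind = augment indA (proj₁ isB) (subst (∥ A ∥ ℕ.<_) (trans eq (sym (rank B isB))) (ℕₚ.m<m+n ∥ A ∥ (s≤s z≤n)))
      in <-≤-trans 0<1 (subst (_≤ m) (𝟙-yes (independent? (A [ e ]≔ inside)) ind)
        (∈⇒≤∑ {f = λ x → 𝟙 (independent? (A [ x ]≔ inside))} (∈-elements⁺ (x∉p⇒x∈∁p e∉A)) (λ {x} _ → 0≤𝟙 (independent? (A [ x ]≔ inside)))))
    term : ∀ {e} → e ∈ elements (∁ A) → ∑ bases (λ B → W (A [ e ]≔ inside) B (share B)) ≤ 𝟙 (independent? (A [ e ]≔ inside))
    term {e} e∈ = ≤𝟙 (independent? (A [ e ]≔ inside))
      (λ ind → ∑-W≤1 k ind (trans (cong (ℕ._+ k) (∣insert∣ (x∈∁p⇒x∉p (∈-elements⁻ e∈)))) (trans (sym (ℕₚ.+-suc ∥ A ∥ k)) eq)))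
      -- No basis contains a dependent A + e, so such a term is 0 and only the `m` independent
      -- extensions count.
      (λ ¬ind → ≤-reflexive (trans (Sum.⨁-cong bases (λ {B} B∈ → W-⊈ (A [ e ]≔ inside) B (share B)
        λ A′⊆B → ¬ind (hereditary A′⊆B (proj₁ (∈-bases⁻ B∈))))) (Sum.⨁-ε bases)))

  gain : Subset n → ℚ
  gain B = ∏ (elements B) (λ e → 1ℚ + share B e)

  ∑-gain≤I : ∑ bases gain ≤ fromℕ (I M)
  ∑-gain≤I = begin
    ∑ bases gain
      ≡⟨ Sum.⨁-cong bases (λ {B} _ → ∑-W B (share B)) ⟨
    ∑ bases (λ B → ∑ (subsets n) (λ A → W A B (share B)))
      ≡⟨ Sum.⨁-swap bases (subsets n) (λ B A → W A B (share B)) ⟩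
    ∑ (subsets n) (λ A → ∑ bases (λ B → W A B (share B)))
      ≡⟨ Sum.⨁-restrict independent? (subsets n) (λ A → ∑ bases (λ B → W A B (share B))) (λ {A} _ ¬indA →
           trans (Sum.⨁-cong bases (λ {B} B∈ → W-⊈ A B (share B) λ A⊆B → ¬indA (hereditary A⊆B (proj₁ (∈-bases⁻ B∈))))) (Sum.⨁-ε bases)) ⟩
    ∑ (𝓘 M) (λ A → ∑ bases (λ B → W A B (share B)))
      ≤⟨ ∑-mono (𝓘 M) (λ {A} A∈ → let indA = proj₂ (∈-filter⁻ independent? {xs = subsets n} A∈) in
           ∑-W≤1 (r ∸ ∥ A ∥) indA (ℕₚ.m+[n∸m]≡n (independent-size indA))) ⟩
    ∑ (𝓘 M) (λ _ → 1ℚ)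
      ≡⟨ ∑-1 (𝓘 M) ⟩
    fromℕ (I M) ∎
    where open ≤-Reasoning

  𝓘ᵣ≡bases : 𝓘ₖ M r ≡ bases
  𝓘ᵣ≡bases = filter-filter independent? (λ S → ∥ S ∥ ℕ.≟ r) (isBasis? M) isBasis
    (λ {B} isB → proj₁ isB , rank B isB) (subsets n)

-- Counting the pairs of a basis and an independent set one smaller

module DoubleCounting {n} (M : Matroid n) {r s} (rank : HasRank M r) (r≡ : r ≡ suc s) where
  open Matroid M
  open Bases M rank

  𝓘ᵣ₋₁ : List (Subset n)
  𝓘ᵣ₋₁ = 𝓘ₖ M s

  coatom? : Decidable (λ F → Independent F × ∥ F ∥ ≡ s)
  coatom? F = independent? F ×-dec (∥ F ∥ ℕ.≟ s)

  𝓘ᵣ₋₁≡ : 𝓘ᵣ₋₁ ≡ filter coatom? (subsets n)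
  𝓘ᵣ₋₁≡ = filter-filter independent? (λ S → ∥ S ∥ ℕ.≟ s) coatom? _,_ (λ p → p) (subsets n)

  ∈-𝓘ᵣ₋₁⁻ : ∀ {F} → F ∈ 𝓘ᵣ₋₁ → Independent F × ∥ F ∥ ≡ s
  ∈-𝓘ᵣ₋₁⁻ F∈ = proj₂ (∈-filter⁻ coatom? {xs = subsets n} (subst (_ ∈_) 𝓘ᵣ₋₁≡ F∈))

  0<δ-coatom : ∀ {F} → F ∈ 𝓘ᵣ₋₁ → 0 ℕ.< δ M F
  0<δ-coatom {F} F∈ =
    let B , isB = basis-exists M
        indF , ∣F∣≡s = ∈-𝓘ᵣ₋₁⁻ F∈
        D , isD , F⊆D , _ = extend 1 indF isB (trans (ℕₚ.+-comm ∥ F ∥ 1) (trans (cong suc ∣F∣≡s) (sym r≡)))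
    in 0<δ isD F⊆D

  module _ {A : Set} {_∙_ : A → A → A} {ε : A} (isCM : IsCommutativeMonoid _≡_ _∙_ ε) where
    open BigOperator isCM

    -- `_×′_` is the iterated operation: a multiple by δ(F) when the monoid is additive, the power
    -- with exponent δ(F) when it is multiplicative.
    ⨁-double-count : ∀ f → ⨁ bases (λ B → ⨁ (elements B) (λ e → f (B [ e ]≔ outside))) ≡ ⨁ 𝓘ᵣ₋₁ (λ F → δ M F ×′ f F)
    ⨁-double-count f = begin
      ⨁ bases (λ B → ⨁ (elements B) (λ e → f (B [ e ]≔ outside)))
        ≡⟨ ⨁-cong bases (λ {B} _ → Covers.⨁-cocovers isCM B f) ⟨
      ⨁ bases (λ B → ⨁ (filter (_⋖? B) (subsets n)) f)
        ≡⟨ ⨁-swap-filter (λ B F → F ⋖? B) bases (subsets n) (λ _ F → f F) ⟩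
      ⨁ (subsets n) (λ F → ⨁ (filter (F ⋖?_) bases) (λ _ → f F))
        ≡⟨ ⨁-restrict coatom? (subsets n) (λ F → ⨁ (filter (F ⋖?_) bases) (λ _ → f F)) (λ {F} _ → vanish F) ⟩
      ⨁ (filter coatom? (subsets n)) (λ F → ⨁ (filter (F ⋖?_) bases) (λ _ → f F))
        ≡⟨ cong (λ xs → ⨁ xs (λ F → ⨁ (filter (F ⋖?_) bases) (λ _ → f F))) 𝓘ᵣ₋₁≡ ⟨
      ⨁ 𝓘ᵣ₋₁ (λ F → ⨁ (filter (F ⋖?_) bases) (λ _ → f F))
        ≡⟨ ⨁-cong 𝓘ᵣ₋₁ count ⟩
      ⨁ 𝓘ᵣ₋₁ (λ F → δ M F ×′ f F) ∎
      where
      open ≡-Reasoning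
      vanish : ∀ F → ¬ (Independent F × ∥ F ∥ ≡ s) → ⨁ (filter (F ⋖?_) bases) (λ _ → f F) ≡ ε
      vanish F ¬coatom = cong (λ xs → ⨁ xs (λ _ → f F)) (filter-absurd (F ⋖?_) bases λ {B} B∈ (F⊆B , eq) →
        let isB = ∈-bases⁻ B∈ in
        ¬coatom (hereditary F⊆B (proj₁ isB) , ℕₚ.suc-injective (trans (sym eq) (trans (rank B isB) r≡))))
      count : ∀ {F} → F ∈ 𝓘ᵣ₋₁ → ⨁ (filter (F ⋖?_) bases) (λ _ → f F) ≡ δ M F ×′ f F
      count {F} F∈ = trans (cong (λ xs → ⨁ xs (λ _ → f F)) (sym (⊆-bases≡⋖-bases (trans r≡ (cong suc (sym (proj₂ (∈-𝓘ᵣ₋₁⁻ F∈))))))))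
        (⨁-const (filter (F ⊆?_) bases) (f F))

-- Riemann sums of the logarithm

p≤p+q : ∀ {p q} → 0ℚ ≤ q → p ≤ p + q
p≤p+q {p} {q} 0≤q = subst (_≤ p + q) (+-identityʳ p) (+-monoʳ-≤ p 0≤q)

0≤q-p : ∀ {p q} → p ≤ q → 0ℚ ≤ q - p
0≤q-p {p} {q} p≤q = subst (_≤ q - p) (+-inverseʳ p) (+-monoˡ-≤ (- p) p≤q)

0≤square : ∀ x → 0ℚ ≤ x * x
0≤square x = [ (λ 0≤x → 0≤* 0≤x 0≤x) , (λ x≤0 → subst (0ℚ ≤_) (square-neg x) (0≤* (neg-antimono-≤ x≤0) (neg-antimono-≤ x≤0))) ]′ (≤-total 0ℚ x)
  where
  square-neg : ∀ x → (- x) * (- x) ≡ x * x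
  square-neg = solve 1 (λ x → (:- x) :* (:- x) := x :* x) refl

q+[p-q]≡p : ∀ p q → q + (p - q) ≡ p
q+[p-q]≡p = solve 2 (λ p q → q :+ (p :- q) := p) refl

*-monoˡ : ∀ {c p q} → 0ℚ ≤ c → p ≤ q → c * p ≤ c * q
*-monoˡ {c} 0≤c = *-monoˡ-≤-nonNeg c {{ℚ.nonNegative 0≤c}}

*-monoʳ : ∀ {c p q} → 0ℚ ≤ c → p ≤ q → p * c ≤ q * c
*-monoʳ {c} 0≤c = *-monoʳ-≤-nonNeg c {{ℚ.nonNegative 0≤c}}

1≤⇒0≤ : ∀ {p} → 1ℚ ≤ p → 0ℚ ≤ p
1≤⇒0≤ = ≤-trans 0≤1

1≤⇒0< : ∀ {p} → 1ℚ ≤ p → 0ℚ < p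
1≤⇒0< = <-≤-trans 0<1

1≤* : ∀ {p q} → 1ℚ ≤ p → 1ℚ ≤ q → 1ℚ ≤ p * q
1≤* 1≤p 1≤q = *-mono 0≤1 (1≤⇒0≤ 1≤p) 1≤p 1≤q

inv≤1 : ∀ {p} → 1ℚ ≤ p → inv p ≤ 1ℚ
inv≤1 {p} 1≤p = subst (inv p ≤_) (trans (sym (*-identityˡ (inv 1ℚ))) (*-inv 0<1)) (inv-anti 0<1 1≤p)

*-inv-* : ∀ {p q} → 0ℚ < p → 0ℚ < q → p * inv (p * q) ≡ inv q
*-inv-* {p} {q} 0<p 0<q = begin
  p * inv (p * q)                     ≡⟨ *-identityʳ _ ⟨
  p * inv (p * q) * 1ℚ                ≡⟨ cong (p * inv (p * q) *_) (*-inv 0<q) ⟨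
  p * inv (p * q) * (q * inv q)       ≡⟨ solve 4 (λ p u q v → p :* u :* (q :* v) := (p :* q :* u) :* v) refl p (inv (p * q)) q (inv q) ⟩
  p * q * inv (p * q) * inv q         ≡⟨ cong (_* inv q) (*-inv (0<* 0<p 0<q)) ⟩
  1ℚ * inv q                          ≡⟨ *-identityˡ (inv q) ⟩
  inv q                               ∎
  where open ≡-Reasoning

∑<-mono : ∀ k {f g} → (∀ i → f i ≤ g i) → ∑< k f ≤ ∑< k g
∑<-mono zero    h = ≤-refl
∑<-mono (suc k) h = +-mono-≤ (∑<-mono k h) (h k)

∑<-nonneg : ∀ k {f} → (∀ i → 0ℚ ≤ f i) → 0ℚ ≤ ∑< k f
∑<-nonneg k {f} h = subst (_≤ ∑< k f) (trans (∑-const k 0ℚ) (*-zeroʳ (fromℕ k))) (∑<-mono k h)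

∑<-distribˡ-* : ∀ k c f → c * ∑< k f ≡ ∑< k (λ i → c * f i)
∑<-distribˡ-* zero    c f = *-zeroʳ c
∑<-distribˡ-* (suc k) c f = trans (*-distribˡ-+ c (∑< k f) (f k)) (cong (_+ c * f k) (∑<-distribˡ-* k c f))

∑<-distrib-+ : ∀ k f g → ∑< k (λ i → f i + g i) ≡ ∑< k f + ∑< k g
∑<-distrib-+ zero    f g = refl
∑<-distrib-+ (suc k) f g = trans (cong (_+ (f k + g k)) (∑<-distrib-+ k f g))
  (solve 4 (λ a b c d → (a :+ b) :+ (c :+ d) := (a :+ c) :+ (b :+ d)) refl (∑< k f) (∑< k g) (f k) (g k))

1≤∏ : ∀ (xs : List X) {u} → (∀ x → 1ℚ ≤ u x) → 1ℚ ≤ ∏ xs u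
1≤∏ []       1≤u = ≤-refl
1≤∏ (x ∷ xs) 1≤u = 1≤* (1≤u x) (1≤∏ xs 1≤u)

module RiemannSum (n : ℕ) where

  w : ℚ
  w = mesh n

  F : ℚ → ℚ
  F q = lnSum q n

  step : ℚ → ℚ
  step q = (q - 1ℚ) ÷ fromℕ (suc n)

  point : ℚ → ℕ → ℚ
  point q i = 1ℚ + fromℕ i * step q

  0≤step : ∀ {q} → 1ℚ ≤ q → 0ℚ ≤ step q
  0≤step 1≤q = 0≤* (0≤q-p 1≤q) (0≤mesh n)

  1≤point : ∀ {q} i → 1ℚ ≤ q → 1ℚ ≤ point q i
  1≤point i 1≤q = p≤p+q (0≤* (0≤fromℕ i) (0≤step 1≤q))

  point-suc : ∀ q i → point q (suc i) ≡ point q i + step q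
  point-suc q i = trans (cong (λ k → 1ℚ + k * step q) (fromℕ-+ 1 i))
    (solve 2 (λ i h → con 1ℚ :+ (con 1ℚ :+ i) :* h := con 1ℚ :+ i :* h :+ h) refl (fromℕ i) (step q))

  N*step : ∀ q → fromℕ (suc n) * step q ≡ q - 1ℚ
  N*step q = trans (solve 3 (λ N t w → N :* (t :* w) := t :* (N :* w)) refl (fromℕ (suc n)) (q - 1ℚ) w)
    (trans (cong ((q - 1ℚ) *_) (*-mesh n)) (*-identityʳ (q - 1ℚ)))

  point-last : ∀ q → point q (suc n) ≡ q
  point-last q = trans (cong (1ℚ +_) (N*step q)) (q+[p-q]≡p q 1ℚ)

  0≤invpoint : ∀ {q} i → 1ℚ ≤ q → 0ℚ ≤ inv (point q i)
  0≤invpoint i 1≤q = <⇒≤ (0<inv (1≤⇒0< (1≤point i 1≤q)))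

  0≤F : ∀ {q} → 1ℚ ≤ q → 0ℚ ≤ F q
  0≤F 1≤q = ∑<-nonneg (suc n) λ i → 0≤* (0≤step 1≤q) (0≤invpoint i 1≤q)

  F≤q-1 : ∀ {q} → 1ℚ ≤ q → F q ≤ q - 1ℚ
  F≤q-1 {q} 1≤q = subst (F q ≤_) (trans (∑-const (suc n) (step q)) (N*step q))
    (∑<-mono (suc n) λ i → subst (step q * inv (point q i) ≤_) (*-identityʳ (step q))
      (*-monoˡ (0≤step 1≤q) (inv≤1 (1≤point i 1≤q))))

  -- The derivative of `F` at q: the summand h/(1 + ih) has derivative 1/(1 + ih)² in h, and h = (q
  -- - 1)w.
  slope : ℚ → ℚ
  slope q = ∑< (suc n) λ i → w * (inv (point q i) * inv (point q i))

  0≤slope : ∀ {q} → 1ℚ ≤ q → 0ℚ ≤ slope q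
  0≤slope 1≤q = ∑<-nonneg (suc n) λ i → 0≤* (0≤mesh n) (0≤* (0≤invpoint i 1≤q) (0≤invpoint i 1≤q))

  -- w / (bᵢ bᵢ₊₁) telescopes to k w / bₖ.
  inv≤slope : ∀ {q} → 1ℚ ≤ q → inv q ≤ slope q
  inv≤slope {q} 1≤q = subst (_≤ slope q)
    (trans (cong₂ _*_ (*-mesh n) (cong inv (point-last q))) (*-identityˡ (inv q))) (partial (suc n))
    where
    partial : ∀ k → fromℕ k * w * inv (point q k) ≤ ∑< k λ i → w * (inv (point q i) * inv (point q i))
    partial zero    = ≤-reflexive (trans (cong (_* inv (point q 0)) (*-zeroˡ w)) (*-zeroˡ (inv (point q 0))))
    partial (suc k) = begin
      fromℕ (suc k) * w * inv b′
        ≡⟨ *-identityʳ _ ⟨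
      fromℕ (suc k) * w * inv b′ * 1ℚ
        ≡⟨ cong₂ (λ u v → u * w * inv b′ * v) (fromℕ-+ 1 k) (sym (*-inv (1≤⇒0< (1≤point k 1≤q)))) ⟩
      (1ℚ + fromℕ k) * w * inv b′ * (b * inv b)
        ≡⟨ solve 5 (λ k w h u v →
             (con 1ℚ :+ k) :* w :* v :* ((con 1ℚ :+ k :* h) :* u)
             := k :* w :* u :* ((con 1ℚ :+ k :* h :+ h) :* v) :+ w :* (u :* v)) refl
             (fromℕ k) w (step q) (inv b) (inv b′) ⟩
      fromℕ k * w * inv b * ((b + step q) * inv b′) + w * (inv b * inv b′)
        ≡⟨ cong (λ u → fromℕ k * w * inv b * u + w * (inv b * inv b′))
             (trans (cong (_* inv b′) (sym (point-suc q k))) (*-inv (1≤⇒0< (1≤point (suc k) 1≤q)))) ⟩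
      fromℕ k * w * inv b * 1ℚ + w * (inv b * inv b′)
        ≡⟨ cong (_+ w * (inv b * inv b′)) (*-identityʳ (fromℕ k * w * inv b)) ⟩
      fromℕ k * w * inv b + w * (inv b * inv b′)
        ≤⟨ +-mono-≤ (partial k) (*-monoˡ (0≤mesh n) (*-monoˡ (0≤invpoint k 1≤q)
             (inv-anti (1≤⇒0< (1≤point k 1≤q))
               (subst (b ≤_) (sym (point-suc q k)) (p≤p+q (0≤step 1≤q)))))) ⟩
      (∑< k λ i → w * (inv (point q i) * inv (point q i))) + w * (inv b * inv b) ∎
      where
      open ≤-Reasoning
      b b′ : ℚ
      b = point q k
      b′ = point q (suc k)

  -- Riemann sums are themselves concave, with exact tangents.
  tangent : ∀ {p q} → 1ℚ ≤ p → 1ℚ ≤ q → F p ≤ F q + (p - q) * slope q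
  tangent {p} {q} 1≤p 1≤q = begin
    F p
      ≤⟨ ∑<-mono (suc n) term ⟩
    ∑< (suc n) (λ i → step q * inv (point q i) + (p - q) * (w * (inv (point q i) * inv (point q i))))
      ≡⟨ ∑<-distrib-+ (suc n) (λ i → step q * inv (point q i)) (λ i → (p - q) * (w * (inv (point q i) * inv (point q i)))) ⟩
    F q + ∑< (suc n) (λ i → (p - q) * (w * (inv (point q i) * inv (point q i))))
      ≡⟨ cong (F q +_) (∑<-distribˡ-* (suc n) (p - q) (λ i → w * (inv (point q i) * inv (point q i)))) ⟨
    F q + (p - q) * slope q ∎
    where
    open ≤-Reasoning
    term : ∀ i → step p * inv (point p i) ≤ step q * inv (point q i) + (p - q) * (w * (inv (point q i) * inv (point q i)))
    -- The gap between the tangent line and the summand is exactly i w² (p - q)² A B², which is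
    -- nonnegative.
    term i = subst (step p * A ≤_) identity (p≤p+q (0≤* (0≤* (0≤* (0≤fromℕ i) (0≤* (0≤mesh n) (0≤mesh n))) (0≤square (p - q)))
      (0≤* (0≤invpoint i 1≤p) (0≤* (0≤invpoint i 1≤q) (0≤invpoint i 1≤q)))))
      where
      A B : ℚ
      A = inv (point p i)
      B = inv (point q i)
      aA : point p i * A ≡ 1ℚ
      aA = *-inv (1≤⇒0< (1≤point i 1≤p))
      bB : point q i * B ≡ 1ℚ
      bB = *-inv (1≤⇒0< (1≤point i 1≤q))
      identity : step p * A + fromℕ i * (w * w) * ((p - q) * (p - q)) * (A * (B * B)) ≡
                 step q * B + (p - q) * (w * (B * B))
      identity = begin-equality
        step p * A + fromℕ i * (w * w) * ((p - q) * (p - q)) * (A * (B * B))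
          ≡⟨ cong (_+ fromℕ i * (w * w) * ((p - q) * (p - q)) * (A * (B * B)))
               (trans (*-identityʳ (step p * A * 1ℚ)) (*-identityʳ (step p * A))) ⟨
        step p * A * 1ℚ * 1ℚ + fromℕ i * (w * w) * ((p - q) * (p - q)) * (A * (B * B))
          ≡⟨ cong (λ u → step p * A * u * u + fromℕ i * (w * w) * ((p - q) * (p - q)) * (A * (B * B))) bB ⟨
        step p * A * (point q i * B) * (point q i * B) + fromℕ i * (w * w) * ((p - q) * (p - q)) * (A * (B * B))
          ≡⟨ solve 6 (λ p q w i A B →
               (p :- con 1ℚ) :* w :* A :* ((con 1ℚ :+ i :* ((q :- con 1ℚ) :* w)) :* B) :* ((con 1ℚ :+ i :* ((q :- con 1ℚ) :* w)) :* B)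
                 :+ i :* (w :* w) :* ((p :- q) :* (p :- q)) :* (A :* (B :* B))
               := (q :- con 1ℚ) :* w :* B :* ((con 1ℚ :+ i :* ((p :- con 1ℚ) :* w)) :* A) :* ((con 1ℚ :+ i :* ((q :- con 1ℚ) :* w)) :* B)
                 :+ (p :- q) :* (w :* (B :* B)) :* ((con 1ℚ :+ i :* ((p :- con 1ℚ) :* w)) :* A)) refl
               p q w (fromℕ i) A B ⟩
        step q * B * (point p i * A) * (point q i * B) + (p - q) * (w * (B * B)) * (point p i * A)
          ≡⟨ cong₂ (λ u v → step q * B * u * v + (p - q) * (w * (B * B)) * u) aA bB ⟩
        step q * B * 1ℚ * 1ℚ + (p - q) * (w * (B * B)) * 1ℚ
          ≡⟨ cong₂ _+_ (trans (*-identityʳ (step q * B * 1ℚ)) (*-identityʳ (step q * B))) (*-identityʳ ((p - q) * (w * (B * B)))) ⟩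
        step q * B + (p - q) * (w * (B * B)) ∎

  F-mono : ∀ {p q} → 1ℚ ≤ p → p ≤ q → F p ≤ F q
  F-mono {p} {q} 1≤p p≤q = ≤-trans (p≤p+q (0≤* (0≤q-p p≤q) (0≤slope 1≤q)))
    (subst (F p + (q - p) * slope q ≤_)
      (solve 4 (λ f p q s → f :+ (p :- q) :* s :+ (q :- p) :* s := f) refl (F q) p q (slope q))
      (+-monoˡ-≤ ((q - p) * slope q) (tangent 1≤p 1≤q)))
    where 1≤q = ≤-trans 1≤p p≤q

  -- Go from x to xy through the points x b, where b runs over the nodes of the partition of [1, y].
  -- By `tangent` and `inv≤slope`, the step that ends at x b′ raises `F` by at least h x/(x b′) =
  -- h/b′. These increments form the right Riemann sum for y, which is below the left one by at most
  -- its first term h = (y - 1)w.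
  superadditive : ∀ {x y} → 1ℚ ≤ x → 1ℚ ≤ y → F x + F y ≤ F (x * y) + (y - 1ℚ) * w
  superadditive {x} {y} 1≤x 1≤y = begin
    F x + F y
      -- `partial` carries the left sum together with the next term, since its increments are taken
      -- at right endpoints. At the last node this extra term is added for free.
      ≤⟨ p≤p+q (0≤* (0≤step 1≤y) (0≤invpoint (suc n) 1≤y)) ⟩
    F x + F y + h * inv (point y (suc n))
      ≤⟨ partial (suc n) ⟩
    F (x * point y (suc n)) + h
      ≡⟨ cong (λ u → F (x * u) + h) (point-last y) ⟩
    F (x * y) + h ∎
    where
    open ≤-Reasoning
    h : ℚ
    h = step y
    increment : ∀ k → F (x * point y k) + h * inv (point y (suc k)) ≤ F (x * point y (suc k))
    increment k = begin
      F (x * b) + h * inv b′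
        ≤⟨ +-monoˡ-≤ (h * inv b′) (tangent (1≤* 1≤x (1≤point k 1≤y)) 1≤xb′) ⟩
      F (x * b′) + (x * b - x * b′) * slope (x * b′) + h * inv b′
        ≡⟨ cong (λ u → F (x * b′) + (x * b - x * u) * slope (x * b′) + h * inv b′) (point-suc y k) ⟩
      F (x * b′) + (x * b - x * (b + h)) * slope (x * b′) + h * inv b′
        ≤⟨ +-monoʳ-≤ (F (x * b′) + (x * b - x * (b + h)) * slope (x * b′)) h/b′≤ ⟩
      F (x * b′) + (x * b - x * (b + h)) * slope (x * b′) + h * x * slope (x * b′)
        ≡⟨ solve 5 (λ f x b h s → f :+ (x :* b :- x :* (b :+ h)) :* s :+ h :* x :* s := f) refl
             (F (x * b′)) x b h (slope (x * b′)) ⟩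
      F (x * b′) ∎
      where
      b b′ : ℚ
      b = point y k
      b′ = point y (suc k)
      1≤xb′ : 1ℚ ≤ x * b′
      1≤xb′ = 1≤* 1≤x (1≤point (suc k) 1≤y)
      h/b′≤ : h * inv b′ ≤ h * x * slope (x * b′)
      h/b′≤ = subst (_≤ h * x * slope (x * b′))
        (trans (*-assoc h x (inv (x * b′))) (cong (h *_) (*-inv-* (1≤⇒0< 1≤x) (1≤⇒0< (1≤point (suc k) 1≤y)))))
        (*-monoˡ (0≤* (0≤step 1≤y) (1≤⇒0≤ 1≤x)) (inv≤slope 1≤xb′))
    partial : ∀ k → F x + ∑< k (λ i → h * inv (point y i)) + h * inv (point y k) ≤ F (x * point y k) + h
    partial zero    = ≤-reflexive (cong₂ _+_
      (trans (+-identityʳ (F x)) (cong F (sym (trans (cong (x *_) point₀) (*-identityʳ x)))))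
      (trans (cong (λ u → h * inv u) point₀) (trans (cong (h *_) (trans (sym (*-identityˡ (inv 1ℚ))) (*-inv 0<1))) (*-identityʳ h))))
      where
      point₀ : point y 0 ≡ 1ℚ
      point₀ = trans (cong (1ℚ +_) (*-zeroˡ h)) (+-identityʳ 1ℚ)
    partial (suc k) = begin
      F x + (S + h * inv (point y k)) + h * inv (point y (suc k))
        ≡⟨ cong (_+ h * inv (point y (suc k))) (+-assoc (F x) S (h * inv (point y k))) ⟨
      F x + S + h * inv (point y k) + h * inv (point y (suc k))
        ≤⟨ +-monoˡ-≤ (h * inv (point y (suc k))) (partial k) ⟩
      F (x * point y k) + h + h * inv (point y (suc k))
        ≡⟨ solve 3 (λ a b c → a :+ b :+ c := a :+ c :+ b) refl (F (x * point y k)) h (h * inv (point y (suc k))) ⟩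
      F (x * point y k) + h * inv (point y (suc k)) + h
        ≤⟨ +-monoˡ-≤ h (increment k) ⟩
      F (x * point y (suc k)) + h ∎
      where
      S : ℚ
      S = ∑< k (λ i → h * inv (point y i))

  -- The error in `superadditive` depends only on its second argument. That place is given to the
  -- single factor, never to the product, so each factor at most 2 costs at most `w`.
  ∑F≤F∏ : ∀ (xs : List X) {u} → (∀ x → 1ℚ ≤ u x) → (∀ x → u x ≤ 1ℚ + 1ℚ) →
    ∑ xs (F ∘ u) ≤ F (∏ xs u) + fromℕ (length xs) * w
  ∑F≤F∏ []       1≤u u≤2 = +-mono-≤ (0≤F ≤-refl) (≤-reflexive (sym (*-zeroˡ w)))
  ∑F≤F∏ (x ∷ xs) {u} 1≤u u≤2 = begin
    F (u x) + ∑ xs (F ∘ u)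
      ≤⟨ +-monoʳ-≤ (F (u x)) (∑F≤F∏ xs 1≤u u≤2) ⟩
    F (u x) + (F (∏ xs u) + L * w)
      ≡⟨ solve 3 (λ a b c → a :+ (b :+ c) := b :+ a :+ c) refl (F (u x)) (F (∏ xs u)) (L * w) ⟩
    F (∏ xs u) + F (u x) + L * w
      ≤⟨ +-monoˡ-≤ (L * w) (superadditive (1≤∏ xs 1≤u) (1≤u x)) ⟩
    F (∏ xs u * u x) + (u x - 1ℚ) * w + L * w
      ≤⟨ +-monoˡ-≤ (L * w) (+-monoʳ-≤ (F (∏ xs u * u x)) (*-monoʳ (0≤mesh n) (+-monoˡ-≤ (- 1ℚ) (u≤2 x)))) ⟩
    F (∏ xs u * u x) + (1ℚ + 1ℚ - 1ℚ) * w + L * w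
      ≡⟨ solve 3 (λ f w L → f :+ (con 1ℚ :+ con 1ℚ :- con 1ℚ) :* w :+ L :* w := f :+ (con 1ℚ :+ L) :* w) refl (F (∏ xs u * u x)) w L ⟩
    F (∏ xs u * u x) + (1ℚ + L) * w
      ≡⟨ cong₂ (λ p k → F p + k * w) (*-comm (∏ xs u) (u x)) (sym (fromℕ-+ 1 (length xs))) ⟩
    F (u x * ∏ xs u) + fromℕ (suc (length xs)) * w ∎
    where
    open ≤-Reasoning
    L : ℚ
    L = fromℕ (length xs)

  -- The sum of the tangent inequalities at `a`. Because the slope is nonnegative, an upper bound on
  -- the mean of `g` suffices.
  jensen : ∀ (xs : List X) {g a} → (∀ x → 1ℚ ≤ g x) → 1ℚ ≤ a →
    ∑ xs g ≤ fromℕ (length xs) * a → ∑ xs (F ∘ g) ≤ fromℕ (length xs) * F a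
  jensen xs {g} {a} 1≤g 1≤a ∑g≤ = begin
    ∑ xs (F ∘ g)
      ≤⟨ ∑-mono xs (λ {x} _ → tangent (1≤g x) 1≤a) ⟩
    ∑ xs (λ x → F a + (g x - a) * slope a)
      ≡⟨ Sum.⨁-cong xs (λ {x} _ → solve 4 (λ f g a s → f :+ (g :- a) :* s := g :* s :+ (f :- a :* s)) refl (F a) (g x) a (slope a)) ⟩
    ∑ xs (λ x → g x * slope a + (F a - a * slope a))
      ≡⟨ Sum.⨁-∙ xs (λ x → g x * slope a) (λ _ → F a - a * slope a) ⟩
    ∑ xs (λ x → g x * slope a) + ∑ xs (λ _ → F a - a * slope a)
      ≡⟨ cong₂ _+_ (∑-distribʳ-* xs g (slope a)) (trans (Sum.⨁-const xs _) (·≡* (length xs) _)) ⟩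
    ∑ xs g * slope a + L * (F a - a * slope a)
      ≤⟨ +-monoˡ-≤ (L * (F a - a * slope a)) (*-monoʳ (0≤slope 1≤a) ∑g≤) ⟩
    L * a * slope a + L * (F a - a * slope a)
      ≡⟨ solve 4 (λ L a s f → L :* a :* s :+ L :* (f :- a :* s) := L :* f) refl L a (slope a) (F a) ⟩
    L * F a ∎
    where
    open ≤-Reasoning
    L : ℚ
    L = fromℕ (length xs)

  φ : ℚ → ℚ
  φ x = x * F (1ℚ + inv x)

  1≤1+inv : ∀ {x} → 0ℚ < x → 1ℚ ≤ 1ℚ + inv x
  1≤1+inv 0<x = p≤p+q (<⇒≤ (0<inv 0<x))

  -- Multiplication by x cancels the step length 1/x and leaves the Riemann sum of dt/(1 + t/x) over
  -- [0, 1], in which every term increases with x. Hence `φ-mono`, the discrete form of the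
  -- monotonicity of x ln (1 + 1/x).
  φ-expand : ∀ {x} → 0ℚ < x → φ x ≡ ∑< (suc n) λ i → w * inv (1ℚ + fromℕ i * (inv x * w))
  φ-expand {x} 0<x = trans (∑<-distribˡ-* (suc n) x _) (∑-cong (suc n) λ i _ → begin
    x * (step (1ℚ + inv x) * inv (1ℚ + fromℕ i * step (1ℚ + inv x)))
      ≡⟨ cong (λ h → x * (h * inv (1ℚ + fromℕ i * h))) step≡ ⟩
    x * (inv x * w * inv (1ℚ + fromℕ i * (inv x * w)))
      ≡⟨ solve 4 (λ x y w z → x :* (y :* w :* z) := x :* y :* (w :* z)) refl x (inv x) w _ ⟩
    x * inv x * (w * inv (1ℚ + fromℕ i * (inv x * w)))
      ≡⟨ trans (cong (_* (w * inv (1ℚ + fromℕ i * (inv x * w)))) (*-inv 0<x)) (*-identityˡ _) ⟩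
    w * inv (1ℚ + fromℕ i * (inv x * w)) ∎)
    where
    open ≡-Reasoning
    step≡ : step (1ℚ + inv x) ≡ inv x * w
    step≡ = cong (_* w) (solve 1 (λ y → con 1ℚ :+ y :- con 1ℚ := y) refl (inv x))

  φ-mono : ∀ {x y} → 0ℚ < x → x ≤ y → φ x ≤ φ y
  φ-mono {x} {y} 0<x x≤y = subst₂ _≤_ (sym (φ-expand 0<x)) (sym (φ-expand 0<y))
    (∑<-mono (suc n) λ i → *-monoˡ (0≤mesh n)
      (inv-anti (1≤⇒0< (p≤p+q (0≤* (0≤fromℕ i) (0≤* (<⇒≤ (0<inv 0<y)) (0≤mesh n)))))
        (+-monoʳ-≤ 1ℚ (*-monoˡ (0≤fromℕ i) (*-monoʳ (0≤mesh n) (inv-anti 0<x x≤y))))))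
    where 0<y = <-≤-trans 0<x x≤y

  -- The factor F (1 + 1/x) decreases in x and is at most 1/x ≤ 1. This absorbs the `ε` by which an
  -- approximation of a real lower bound may exceed δ(F).
  φ-shift : ∀ {x ε} → 1ℚ ≤ x → 0ℚ ≤ ε → φ (x + ε) ≤ φ x + ε
  φ-shift {x} {ε} 1≤x 0≤ε = begin
    (x + ε) * F (1ℚ + inv (x + ε))
      ≤⟨ *-monoˡ (≤-trans (1≤⇒0≤ 1≤x) x≤x+ε) (F-mono (1≤1+inv (<-≤-trans 0<x x≤x+ε)) (+-monoʳ-≤ 1ℚ (inv-anti 0<x x≤x+ε))) ⟩
    (x + ε) * F (1ℚ + inv x)
      ≡⟨ *-distribʳ-+ (F (1ℚ + inv x)) x ε ⟩
    φ x + ε * F (1ℚ + inv x)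
      ≤⟨ +-monoʳ-≤ (φ x) (*-monoˡ 0≤ε (≤-trans (F≤q-1 (1≤1+inv 0<x))
           (subst (_≤ 1ℚ) (solve 1 (λ y → y := con 1ℚ :+ y :- con 1ℚ) refl (inv x)) (inv≤1 1≤x)))) ⟩
    φ x + ε * 1ℚ
      ≡⟨ cong (φ x +_) (*-identityʳ ε) ⟩
    φ x + ε ∎
    where
    open ≤-Reasoning
    0<x = 1≤⇒0< 1≤x
    x≤x+ε : x ≤ x + ε
    x≤x+ε = p≤p+q 0≤ε

-- Powers, AM-GM and limits

infixr 8 _^_
-- Defined as iteration in the multiplicative monoid, so that `⨁-double-count` and `⨁-const` yield
-- powers directly.
_^_ : ℚ → ℕ → ℚ
x ^ k = k Prod.×′ x

0≤^ : ∀ {x} k → 0ℚ ≤ x → 0ℚ ≤ x ^ k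
0≤^ zero    0≤x = 0≤1
0≤^ (suc k) 0≤x = 0≤* 0≤x (0≤^ k 0≤x)

0<^ : ∀ {x} k → 0ℚ < x → 0ℚ < x ^ k
0<^ zero    0<x = 0<1
0<^ (suc k) 0<x = 0<* 0<x (0<^ k 0<x)

^-mono : ∀ {x y} k → 0ℚ ≤ x → x ≤ y → x ^ k ≤ y ^ k
^-mono zero    0≤x x≤y = ≤-refl
^-mono (suc k) 0≤x x≤y = *-mono (0≤^ k 0≤x) (≤-trans 0≤x x≤y) x≤y (^-mono k 0≤x x≤y)

^-mono-< : ∀ {x y} k → 0ℚ ≤ x → x < y → x ^ suc k < y ^ suc k
^-mono-< {x} {y} k 0≤x x<y = ≤-<-trans (*-monoˡ 0≤x (^-mono k 0≤x (<⇒≤ x<y)))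
  (*-monoˡ-<-pos (y ^ k) {{ℚ.positive (0<^ k (≤-<-trans 0≤x x<y))}} x<y)

^-cancel-≤ : ∀ {x y} k → 0ℚ ≤ y → x ^ suc k ≤ y ^ suc k → x ≤ y
^-cancel-≤ k 0≤y x^≤y^ = ≮⇒≥ λ y<x → <-irrefl refl (<-≤-trans (^-mono-< k 0≤y y<x) x^≤y^)

fromℕ-^ : ∀ m k → fromℕ (m ℕ.^ k) ≡ fromℕ m ^ k
fromℕ-^ m zero    = refl
fromℕ-^ m (suc k) = trans (fromℕ-* m (m ℕ.^ k)) (cong (fromℕ m *_) (fromℕ-^ m k))

bernoulli : ∀ {t} k → 0ℚ ≤ t → 1ℚ + fromℕ k * t ≤ (1ℚ + t) ^ k
bernoulli {t} zero    0≤t = ≤-reflexive (trans (cong (1ℚ +_) (*-zeroˡ t)) (+-identityʳ 1ℚ))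
bernoulli {t} (suc k) 0≤t = begin
  1ℚ + fromℕ (suc k) * t
    ≡⟨ cong (λ u → 1ℚ + u * t) (fromℕ-+ 1 k) ⟩
  1ℚ + (1ℚ + fromℕ k) * t
    ≤⟨ p≤p+q (0≤* (0≤fromℕ k) (0≤* 0≤t 0≤t)) ⟩
  1ℚ + (1ℚ + fromℕ k) * t + fromℕ k * (t * t)
    ≡⟨ solve 2 (λ k t → con 1ℚ :+ (con 1ℚ :+ k) :* t :+ k :* (t :* t) := (con 1ℚ :+ t) :* (con 1ℚ :+ k :* t)) refl (fromℕ k) t ⟩
  (1ℚ + t) * (1ℚ + fromℕ k * t)
    ≤⟨ *-monoˡ (≤-trans 0≤1 (p≤p+q 0≤t)) (bernoulli k 0≤t) ⟩
  (1ℚ + t) * (1ℚ + t) ^ k ∎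
  where open ≤-Reasoning

-- Bernoulli's inequality for a / b, cleared of denominators.
bernoulli-homogeneous : ∀ k {a b} → 0ℚ ≤ a → 0ℚ ≤ b →
  fromℕ (suc k) * (a * b ^ k) ≤ a ^ suc k + fromℕ k * b ^ suc k
bernoulli-homogeneous zero    {a} {b} 0≤a 0≤b = ≤-reflexive
  (solve 2 (λ a b → con 1ℚ :* (a :* con 1ℚ) := a :* con 1ℚ :+ con 0ℚ :* (b :* con 1ℚ)) refl a b)
bernoulli-homogeneous (suc k) {a} {b} 0≤a 0≤b = begin
  fromℕ (suc (suc k)) * (a * (b * c))
    ≡⟨ cong (λ u → u * (a * (b * c))) (trans (fromℕ-+ 1 (suc k)) (cong (1ℚ +_) (fromℕ-+ 1 k))) ⟩
  (1ℚ + (1ℚ + K)) * (a * (b * c))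
    -- Adding (k + 1) b^k (a - b)² makes `a` times the induction hypothesis appear.
    ≤⟨ p≤p+q (0≤* (0≤* (≤-trans 0≤1 (p≤p+q (0≤fromℕ k))) (0≤^ k 0≤b)) (0≤square (a - b))) ⟩
  (1ℚ + (1ℚ + K)) * (a * (b * c)) + (1ℚ + K) * c * ((a - b) * (a - b))
    ≡⟨ solve 4 (λ K a b c →
         (con 1ℚ :+ (con 1ℚ :+ K)) :* (a :* (b :* c)) :+ (con 1ℚ :+ K) :* c :* ((a :- b) :* (a :- b))
         := a :* ((con 1ℚ :+ K) :* (a :* c)) :+ ((con 1ℚ :+ K) :* (b :* (b :* c)) :- a :* (K :* (b :* c)))) refl K a b c ⟩
  a * ((1ℚ + K) * (a * c)) + ((1ℚ + K) * (b * (b * c)) - a * (K * (b * c)))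
    ≡⟨ cong (λ u → a * (u * (a * c)) + ((1ℚ + K) * (b * (b * c)) - a * (K * (b * c)))) (fromℕ-+ 1 k) ⟨
  a * (fromℕ (suc k) * (a * c)) + ((1ℚ + K) * (b * (b * c)) - a * (K * (b * c)))
    ≤⟨ +-monoˡ-≤ ((1ℚ + K) * (b * (b * c)) - a * (K * (b * c))) (*-monoˡ 0≤a (bernoulli-homogeneous k 0≤a 0≤b)) ⟩
  a * (a ^ suc k + K * (b * c)) + ((1ℚ + K) * (b * (b * c)) - a * (K * (b * c)))
    ≡⟨ solve 5 (λ a d K b c →
         a :* (d :+ K :* (b :* c)) :+ ((con 1ℚ :+ K) :* (b :* (b :* c)) :- a :* (K :* (b :* c)))
         := a :* d :+ (con 1ℚ :+ K) :* (b :* (b :* c))) refl a (a ^ suc k) K b c ⟩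
  a * a ^ suc k + (1ℚ + K) * (b * (b * c))
    ≡⟨ cong (λ u → a * a ^ suc k + u * (b * (b * c))) (fromℕ-+ 1 k) ⟨
  a * a ^ suc k + fromℕ (suc k) * (b * (b * c)) ∎
  where
  open ≤-Reasoning
  c K : ℚ
  c = b ^ k
  K = fromℕ k

∏-nonneg : ∀ (xs : List X) {f} → (∀ x → 0ℚ ≤ f x) → 0ℚ ≤ ∏ xs f
∏-nonneg []       0≤f = 0≤1
∏-nonneg (x ∷ xs) 0≤f = 0≤* (0≤f x) (∏-nonneg xs 0≤f)

∏-mono : ∀ (xs : List X) {f g} → (∀ x → 0ℚ ≤ f x) → (∀ {x} → x ∈ xs → f x ≤ g x) → ∏ xs f ≤ ∏ xs g
∏-mono []       0≤f f≤g = ≤-refl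
∏-mono (x ∷ xs) 0≤f f≤g = *-mono (∏-nonneg xs 0≤f) (≤-trans (0≤f x) (f≤g (here refl))) (f≤g (here refl)) (∏-mono xs 0≤f (f≤g ∘ there))

-- `mesh k` is 1/(k + 1), hence the `∸ 1`; for the empty list both sides are 0.
mean : ∀ (xs : List X) f → fromℕ (length xs) * (∑ xs f * mesh (length xs ∸ 1)) ≡ ∑ xs f
mean []       f = refl
mean (x ∷ xs) f = trans
  (solve 3 (λ N S w → N :* (S :* w) := S :* (N :* w)) refl (fromℕ (suc (length xs))) (∑ (x ∷ xs) f) (mesh (length xs)))
  (trans (cong (∑ (x ∷ xs) f *_) (*-mesh (length xs))) (*-identityʳ (∑ (x ∷ xs) f)))

+-cancelʳ-≤ : ∀ r p q → p + r ≤ q + r → p ≤ q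
+-cancelʳ-≤ r p q p+r≤q+r = subst₂ _≤_ (cancel p) (cancel q) (+-monoˡ-≤ (- r) p+r≤q+r)
  where
  cancel : ∀ p → p + r - r ≡ p
  cancel p = solve 2 (λ p r → p :+ r :- r := p) refl p r

-- Root-free induction. With A the mean of the L tail values, the tail product is at most A^L, and f
-- x + L A ≤ (L + 1) a. After adding L A^(L+1) to both sides, the claim follows from
-- `bernoulli-homogeneous` for `a` and A.
am-gm : ∀ (xs : List X) {f a} → (∀ x → 0ℚ ≤ f x) → 0ℚ ≤ a →
  ∑ xs f ≤ fromℕ (length xs) * a → ∏ xs f ≤ a ^ length xs
am-gm []       0≤f 0≤a ∑≤ = ≤-refl
am-gm (x ∷ xs) {f} {a} 0≤f 0≤a ∑≤ = +-cancelʳ-≤ (m * (A * A ^ L)) (f x * ∏ xs f) (a * a ^ L) (begin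
  f x * ∏ xs f + m * (A * A ^ L)
    ≤⟨ +-monoˡ-≤ (m * (A * A ^ L)) (*-monoˡ (0≤f x) (am-gm xs 0≤f 0≤A (≤-reflexive (sym (mean xs f))))) ⟩
  f x * A ^ L + m * (A * A ^ L)
    ≡⟨ solve 4 (λ y c m A → y :* c :+ m :* (A :* c) := (y :+ m :* A) :* c) refl (f x) (A ^ L) m A ⟩
  (f x + m * A) * A ^ L
    ≡⟨ cong (λ u → (f x + u) * A ^ L) (mean xs f) ⟩
  (f x + ∑ xs f) * A ^ L
    ≤⟨ *-monoʳ (0≤^ L 0≤A) ∑≤ ⟩
  fromℕ (suc L) * a * A ^ L
    ≡⟨ *-assoc (fromℕ (suc L)) a (A ^ L) ⟩
  fromℕ (suc L) * (a * A ^ L)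
    ≤⟨ bernoulli-homogeneous L 0≤a 0≤A ⟩
  a * a ^ L + m * (A * A ^ L) ∎)
  where
  open ≤-Reasoning
  L : ℕ
  L = length xs
  m A : ℚ
  m = fromℕ L
  A = ∑ xs f * mesh (L ∸ 1)
  0≤A : 0ℚ ≤ A
  0≤A = 0≤* (∑-nonneg xs (λ {y} _ → 0≤f y)) (0≤mesh (L ∸ 1))

≤ᴿ-upTo : ∀ x y C → 0ℚ < C → (∀ ε → 0ℚ < ε → Eventually λ n → seq x n ≤ seq y n + C * ε) → x ≤ᴿ y
≤ᴿ-upTo x y C 0<C h ε 0<ε =
  let N , h′ = h (inv C * ε) (0<* (0<inv 0<C) 0<ε)
  in N , λ n N≤n → subst (λ t → seq x n ≤ seq y n + t)
    (trans (sym (*-assoc C (inv C) ε)) (trans (cong (_* ε) (*-inv 0<C)) (*-identityˡ ε))) (h′ n N≤n)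

eventually-all : ∀ (xs : List X) {P : X → ℕ → Set} → (∀ x → x ∈ xs → Eventually (P x)) →
  Eventually λ n → ∀ {x} → x ∈ xs → P x n
eventually-all []       h = 0 , λ _ _ ()
eventually-all (x ∷ xs) h =
  let N₁ , h₁ = h x (here refl)
      N₂ , h₂ = eventually-all xs (λ y y∈ → h y (there y∈))
  in N₁ ℕ.⊔ N₂ , λ { n N≤n (here refl) → h₁ n (ℕₚ.m⊔n≤o⇒m≤o N₁ N₂ N≤n)
                   ; n N≤n (there y∈)  → h₂ n (ℕₚ.m⊔n≤o⇒n≤o N₁ N₂ N≤n) y∈ }

seq-sumᴿ : ∀ (xs : List X) f n → seq (sumᴿ (map f xs)) n ≡ ∑ xs (λ x → seq (f x) n)
seq-sumᴿ []       f n = refl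
seq-sumᴿ (x ∷ xs) f n = cong (seq (f x) n +_) (seq-sumᴿ xs f n)

*-cancel-inv : ∀ {q x y} → 0ℚ < q → x ≤ q * y → inv q * x ≤ y
*-cancel-inv {q} {x} {y} 0<q x≤qy = subst (inv q * x ≤_)
  (trans (solve 3 (λ u q y → u :* (q :* y) := q :* u :* y) refl (inv q) q y) (trans (cong (_* y) (*-inv 0<q)) (*-identityˡ y)))
  (*-monoˡ (<⇒≤ (0<inv 0<q)) x≤qy)

inv-fromℕ≤1 : ∀ k → inv (fromℕ k) ≤ 1ℚ
inv-fromℕ≤1 zero    = 0≤1
inv-fromℕ≤1 (suc k) = inv≤1 (fromℕ-mono (s≤s (z≤n {k})))

fromℕ*inv≤1 : ∀ k → fromℕ k * inv (fromℕ k) ≤ 1ℚ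
fromℕ*inv≤1 zero    = 0≤1
fromℕ*inv≤1 (suc k) = ≤-reflexive (*-mesh k)

-- The approximants of the root lie below it: each has k-th power at most m, hence at most a^k. So
-- the bound holds at every stage without error.
root≤ : ∀ k .{{_ : ℕ.NonZero k}} m {a} → 0ℚ ≤ a → fromℕ m ≤ a ^ k → root k m ≤ᴿ fromℚ a
root≤ (suc k) m {a} 0≤a m≤a^ ε 0<ε = 0 , λ n _ → ≤-trans (approximant≤ n) (p≤p+q (<⇒≤ 0<ε))
  where
  approximant≤ : ∀ n → rootSeq (suc k) m n ≤ a
  approximant≤ n = ^-cancel-≤ k 0≤a (begin
    (fromℕ x * mesh n) ^ suc k
      -- In the multiplicative monoid `×-distrib-+` reads (xy)^k = x^k y^k.
      ≡⟨ ×-distrib-+ (fromℕ x) (mesh n) (suc k) ⟩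
    fromℕ x ^ suc k * mesh n ^ suc k
      ≡⟨ cong (_* mesh n ^ suc k) (fromℕ-^ x (suc k)) ⟨
    fromℕ (x ℕ.^ suc k) * mesh n ^ suc k
      ≤⟨ *-monoʳ (0≤^ (suc k) (0≤mesh n)) (fromℕ-mono (Root.lower k m n)) ⟩
    fromℕ (m ℕ.* suc n ℕ.^ suc k) * mesh n ^ suc k
      ≡⟨ cong (_* mesh n ^ suc k) (trans (fromℕ-* m (suc n ℕ.^ suc k)) (cong (fromℕ m *_) (fromℕ-^ (suc n) (suc k)))) ⟩
    fromℕ m * fromℕ (suc n) ^ suc k * mesh n ^ suc k
      ≡⟨ *-assoc (fromℕ m) (fromℕ (suc n) ^ suc k) (mesh n ^ suc k) ⟩
    fromℕ m * (fromℕ (suc n) ^ suc k * mesh n ^ suc k)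
      ≡⟨ cong (fromℕ m *_) (trans (sym (×-distrib-+ (fromℕ (suc n)) (mesh n) (suc k))) (trans (cong (_^ suc k) (*-mesh n)) (1^ (suc k)))) ⟩
    fromℕ m * 1ℚ
      ≡⟨ *-identityʳ (fromℕ m) ⟩
    fromℕ m
      ≤⟨ m≤a^ ⟩
    a ^ suc k ∎)
    where
    open ≤-Reasoning
    x : ℕ
    x = rootNumerator (suc k) m n
    1^ : ∀ j → 1ℚ ^ j ≡ 1ℚ
    1^ zero    = refl
    1^ (suc j) = trans (*-identityˡ (1ℚ ^ j)) (1^ j)

-- The inequalities

-- Superadditivity within each product, then concavity across the products; only the former
-- contributes an error.
∑F∏-bound : ∀ (xs : List X) (ys : X → List Y) {u : X → Y → ℚ} {a N} →
  (∀ x y → 1ℚ ≤ u x y) → (∀ x y → u x y ≤ 1ℚ + 1ℚ) → (∀ x → length (ys x) ℕ.≤ N) →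
  1ℚ ≤ a → ∑ xs (λ x → ∏ (ys x) (u x)) ≤ fromℕ (length xs) * a → ∀ m →
  ∑ xs (λ x → ∑ (ys x) (λ y → lnSum (u x y) m)) ≤ fromℕ (length xs) * (lnSum a m + fromℕ N * mesh m)
∑F∏-bound xs ys {u} {a} {N} 1≤u u≤2 ∣ys∣≤N 1≤a ∑∏≤ m = begin
  ∑ xs (λ x → ∑ (ys x) (λ y → F (u x y)))
    ≤⟨ ∑-mono xs (λ {x} _ → ≤-trans (∑F≤F∏ (ys x) (1≤u x) (u≤2 x))
         (+-monoʳ-≤ (F (∏ (ys x) (u x))) (*-monoʳ (0≤mesh m) (fromℕ-mono (∣ys∣≤N x))))) ⟩
  ∑ xs (λ x → F (∏ (ys x) (u x)) + E)
    ≡⟨ trans (Sum.⨁-∙ xs (λ x → F (∏ (ys x) (u x))) (λ _ → E))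
         (cong (∑ xs (λ x → F (∏ (ys x) (u x))) +_) (trans (Sum.⨁-const xs E) (·≡* (length xs) E))) ⟩
  ∑ xs (λ x → F (∏ (ys x) (u x))) + fromℕ (length xs) * E
    ≤⟨ +-monoˡ-≤ (fromℕ (length xs) * E) (jensen xs (λ x → 1≤∏ (ys x) (1≤u x)) 1≤a ∑∏≤) ⟩
  fromℕ (length xs) * F a + fromℕ (length xs) * E
    ≡⟨ *-distribˡ-+ (fromℕ (length xs)) (F a) E ⟨
  fromℕ (length xs) * (F a + E) ∎
  where
  open ≤-Reasoning
  open RiemannSum m
  E : ℚ
  E = fromℕ N * w

-- `∑δln≤` is the first inequality at each stage of the Riemann sums, with `xs` standing for
-- 𝓘_{r-1}, `q` for I_r and `a` for I/I_r. Both logarithmic bounds are limits of it.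
module _ (xs : List X) (δ : X → ℕ) {q N : ℕ} {a : ℚ} (0<q : 0ℚ < fromℕ q)
  (∑δln≤ : ∀ m → ∑ xs (λ x → fromℕ (δ x) * lnSum (1ℚ + 1ℚ ÷ fromℕ (δ x)) m) ≤
                 fromℕ q * (lnSum a m + fromℕ N * mesh m))
  (0<a : 0ᴿ <ᴿ fromℚ a) where

  private
    Q p : ℚ
    Q = fromℕ q
    p = fromℕ (length xs)

    -- The constant is `suc N` because `≤ᴿ-upTo` needs a positive one, also for N = 0.
    N*mesh≤ : ∀ m {ε} → mesh m ≤ ε → fromℕ N * mesh m ≤ fromℕ (suc N) * ε
    N*mesh≤ m mesh≤ε = *-mono (0≤mesh m) (0≤fromℕ (suc N)) (fromℕ-mono (ℕₚ.n≤1+n N)) mesh≤ε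

  average-bound :
    ln (fromℚ a) 0<a ≥ᴿ fromℚ (fromℕ (length xs) ÷ fromℕ q) *ᴿ (fromℚ (1ℚ ÷ fromℕ (length xs)) *ᴿ
      sumᴿ (map (λ x → fromℚ (fromℕ (δ x)) *ᴿ ln (fromℚ (1ℚ + 1ℚ ÷ fromℕ (δ x))) (0<1+inv (δ x))) xs))
  average-bound = ≤ᴿ-upTo (fromℚ (p ÷ Q) *ᴿ (fromℚ (1ℚ ÷ p) *ᴿ sumᴿ (map δln xs))) (ln (fromℚ a) 0<a)
    (fromℕ (suc N)) (0<fromℕ (s≤s (z≤n {N})))
    λ ε 0<ε → proj₁ (mesh-small ε 0<ε) , λ m N≤m → bound ε m (proj₂ (mesh-small ε 0<ε) m N≤m)
    where
    δln : _ → ℝ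
    δln x = fromℚ (fromℕ (δ x)) *ᴿ ln (fromℚ (1ℚ + 1ℚ ÷ fromℕ (δ x))) (0<1+inv (δ x))
    S : ℕ → ℚ
    S m = ∑ xs (λ x → fromℕ (δ x) * lnSum (1ℚ + 1ℚ ÷ fromℕ (δ x)) m)
    0≤S : ∀ m → 0ℚ ≤ S m
    0≤S m = ∑-nonneg xs (λ {x} _ → 0≤* (0≤fromℕ (δ x))
      (RiemannSum.0≤F m (p≤p+q (0≤* 0≤1 (0≤inv (fromℕ (δ x)) (0≤fromℕ (δ x)))))))
    bound : ∀ ε m → mesh m ≤ ε → p ÷ Q * (1ℚ ÷ p * seq (sumᴿ (map δln xs)) m) ≤ lnSum a m + fromℕ (suc N) * ε
    bound ε m mesh≤ε = begin
      p ÷ Q * (1ℚ ÷ p * seq (sumᴿ (map δln xs)) m)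
        ≡⟨ cong (λ s → p ÷ Q * (1ℚ ÷ p * s)) (seq-sumᴿ xs δln m) ⟩
      p * inv Q * (1ℚ * inv p * S m)
        ≡⟨ solve 4 (λ p v u s → p :* v :* (con 1ℚ :* u :* s) := (p :* u) :* (v :* s)) refl p (inv Q) (inv p) (S m) ⟩
      p * inv p * (inv Q * S m)
        -- Only p · (1/p) ≤ 1 is used, which also covers p = 0, where the quotient is 0 by
        -- convention.
        ≤⟨ *-monoʳ (0≤* (<⇒≤ (0<inv 0<q)) (0≤S m)) (fromℕ*inv≤1 (length xs)) ⟩
      1ℚ * (inv Q * S m)
        ≡⟨ *-identityˡ (inv Q * S m) ⟩
      inv Q * S m
        ≤⟨ *-cancel-inv 0<q (∑δln≤ m) ⟩
      lnSum a m + fromℕ N * mesh m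
        ≤⟨ +-monoʳ-≤ (lnSum a m) (N*mesh≤ m mesh≤ε) ⟩
      lnSum a m + fromℕ (suc N) * ε ∎
      where open ≤-Reasoning

  -- For the m-th approximation y of `d`, the hypothesis gives only y ≤ δ + ε. Then φ y ≤ φ (δ + ε)
  -- ≤ φ δ + ε by `φ-mono` and `φ-shift`, and averaging over `xs` adds ε p/q to the mesh error; this
  -- is the second summand of `C`.
  uniform-bound : (∀ {x} → x ∈ xs → 0 ℕ.< δ x) →
    ∀ (d : ℝ) (0<d : 0ᴿ <ᴿ d) → (∀ x → x ∈ xs → fromℚ (fromℕ (δ x)) ≥ᴿ d) →
    ln (fromℚ a) 0<a ≥ᴿ fromℚ (fromℕ (length xs) ÷ fromℕ q) *ᴿ (d *ᴿ ln (1ᴿ +ᴿ recip d 0<d) (0<1+recip d 0<d))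
  uniform-bound 0<δ d 0<d@(μ , 0<μ , N₀ , μ≤) d≤δ =
    ≤ᴿ-upTo (fromℚ (p ÷ Q) *ᴿ (d *ᴿ ln (1ᴿ +ᴿ recip d 0<d) (0<1+recip d 0<d))) (ln (fromℚ a) 0<a) C 0<C λ ε 0<ε →
      let N₁ , mesh≤ε = mesh-small ε 0<ε
          N₂ , d≤δ+ε  = eventually-all xs (λ x x∈ → d≤δ x x∈ ε 0<ε)
      in N₀ ℕ.⊔ (N₁ ℕ.⊔ N₂) , λ m N≤m →
        let N₁₂≤m = ℕₚ.m⊔n≤o⇒n≤o N₀ (N₁ ℕ.⊔ N₂) N≤m in
        bound ε m (<⇒≤ 0<ε) (mesh≤ε m (ℕₚ.m⊔n≤o⇒m≤o N₁ N₂ N₁₂≤m))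
          (<-≤-trans 0<μ (subst (_≤ seq d m) (+-identityˡ μ) (μ≤ m (ℕₚ.m⊔n≤o⇒m≤o N₀ (N₁ ℕ.⊔ N₂) N≤m))))
          (d≤δ+ε m (ℕₚ.m⊔n≤o⇒n≤o N₁ N₂ N₁₂≤m))
    where
    C : ℚ
    C = fromℕ (suc N) + p * inv Q
    0<C : 0ℚ < C
    0<C = <-≤-trans (0<fromℕ (s≤s (z≤n {N}))) (p≤p+q (0≤* (0≤fromℕ (length xs)) (<⇒≤ (0<inv 0<q))))
    bound : ∀ ε m → 0ℚ ≤ ε → mesh m ≤ ε → 0ℚ < seq d m → (∀ {x} → x ∈ xs → seq d m ≤ fromℕ (δ x) + ε) →
      p ÷ Q * (seq d m * lnSum (1ℚ + inv (seq d m)) m) ≤ lnSum a m + C * ε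
    bound ε m 0≤ε mesh≤ε 0<y y≤δ+ε = begin
      p * inv Q * φ y
        ≡⟨ solve 3 (λ p v f → p :* v :* f := v :* (p :* f)) refl p (inv Q) (φ y) ⟩
      inv Q * (p * φ y)
        ≤⟨ *-cancel-inv 0<q average ⟩
      lnSum a m + fromℕ N * mesh m + inv Q * (p * ε)
        ≤⟨ +-monoˡ-≤ (inv Q * (p * ε)) (+-monoʳ-≤ (lnSum a m) (N*mesh≤ m mesh≤ε)) ⟩
      lnSum a m + fromℕ (suc N) * ε + inv Q * (p * ε)
        ≡⟨ solve 5 (λ l k e v p → l :+ k :* e :+ v :* (p :* e) := l :+ (k :+ p :* v) :* e) refl (lnSum a m) (fromℕ (suc N)) ε (inv Q) p ⟩
      lnSum a m + C * ε ∎
      where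
      open ≤-Reasoning
      open RiemannSum m
      y : ℚ
      y = seq d m
      φ≤ : ∀ x → x ∈ xs → φ y ≤ fromℕ (δ x) * lnSum (1ℚ + 1ℚ ÷ fromℕ (δ x)) m + ε
      φ≤ x x∈ = subst (λ v → φ y ≤ fromℕ (δ x) * lnSum (1ℚ + v) m + ε) (sym (*-identityˡ (inv (fromℕ (δ x)))))
        (≤-trans (φ-mono 0<y (y≤δ+ε x∈)) (φ-shift (fromℕ-mono (0<δ x∈)) 0≤ε))
      average : p * φ y ≤ Q * (lnSum a m + fromℕ N * mesh m + inv Q * (p * ε))
      average = begin
        p * φ y
          ≡⟨ trans (Sum.⨁-const xs (φ y)) (·≡* (length xs) (φ y)) ⟨
        ∑ xs (λ _ → φ y)
          ≤⟨ ∑-mono xs (λ {x} → φ≤ x) ⟩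
        ∑ xs (λ x → fromℕ (δ x) * lnSum (1ℚ + 1ℚ ÷ fromℕ (δ x)) m + ε)
          ≡⟨ trans (Sum.⨁-∙ xs (λ x → fromℕ (δ x) * lnSum (1ℚ + 1ℚ ÷ fromℕ (δ x)) m) (λ _ → ε))
               (cong (∑ xs (λ x → fromℕ (δ x) * lnSum (1ℚ + 1ℚ ÷ fromℕ (δ x)) m) +_) (trans (Sum.⨁-const xs ε) (·≡* (length xs) ε))) ⟩
        ∑ xs (λ x → fromℕ (δ x) * lnSum (1ℚ + 1ℚ ÷ fromℕ (δ x)) m) + p * ε
          ≤⟨ +-monoˡ-≤ (p * ε) (∑δln≤ m) ⟩
        Q * (lnSum a m + fromℕ N * mesh m) + p * ε
          ≡⟨ cong (Q * (lnSum a m + fromℕ N * mesh m) +_) (trans (cong (_* (p * ε)) (*-inv 0<q)) (*-identityˡ (p * ε))) ⟨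
        Q * (lnSum a m + fromℕ N * mesh m) + Q * inv Q * (p * ε)
          ≡⟨ solve 4 (λ q t v e → q :* t :+ q :* v :* e := q :* (t :+ v :* e)) refl Q (lnSum a m + fromℕ N * mesh m) (inv Q) (p * ε) ⟩
        Q * (lnSum a m + fromℕ N * mesh m + inv Q * (p * ε)) ∎

module Inequalities {n} (M : Matroid n) {r s} (rank : HasRank M r) (r≡ : r ≡ suc s) where
  open Bases M rank
  open Weights M rank
  open DoubleCounting M rank r≡

  u : Subset n → ℚ
  u F = 1ℚ + 1ℚ ÷ fromℕ (δ M F)

  0<∣𝓘ᵣ∣ : 0ℚ < fromℕ (Iₖ M r)
  0<∣𝓘ᵣ∣ = 0<fromℕ (0<Iᵣ M rank)

  ∣bases∣≡ : fromℕ (length bases) ≡ fromℕ (Iₖ M r)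
  ∣bases∣≡ = cong (λ xs → fromℕ (length xs)) (sym 𝓘ᵣ≡bases)

  1≤u : ∀ F → 1ℚ ≤ u F
  1≤u F = p≤p+q (0≤* 0≤1 (0≤inv (fromℕ (δ M F)) (0≤fromℕ (δ M F))))

  u≤2 : ∀ F → u F ≤ 1ℚ + 1ℚ
  u≤2 F = +-monoʳ-≤ 1ℚ (subst (_≤ 1ℚ) (sym (*-identityˡ (inv (fromℕ (δ M F))))) (inv-fromℕ≤1 (δ M F)))

  1≤gain : ∀ B → 1ℚ ≤ gain B
  1≤gain B = 1≤∏ (elements B) (λ e → 1≤u (B [ e ]≔ outside))

  ∑-gain≤ : ∑ bases gain ≤ fromℕ (length bases) * (fromℕ (I M) ÷ fromℕ (Iₖ M r))
  ∑-gain≤ = ≤-trans ∑-gain≤I (≤-reflexive (sym (trans (cong (_* (fromℕ (I M) ÷ fromℕ (Iₖ M r))) ∣bases∣≡)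
    (trans (solve 3 (λ q i v → q :* (i :* v) := i :* (q :* v)) refl (fromℕ (Iₖ M r)) (fromℕ (I M)) (inv (fromℕ (Iₖ M r))))
      (trans (cong (fromℕ (I M) *_) (*-inv 0<∣𝓘ᵣ∣)) (*-identityʳ (fromℕ (I M))))))))

  -- Places the argument of the logarithm in the range where `jensen` applies. Each basis has gain
  -- at least 1, and the gains sum to at most I.
  1≤I÷Iᵣ : 1ℚ ≤ fromℕ (I M) ÷ fromℕ (Iₖ M r)
  1≤I÷Iᵣ = subst (_≤ fromℕ (I M) ÷ fromℕ (Iₖ M r)) (*-inv 0<∣𝓘ᵣ∣) (*-monoʳ (<⇒≤ (0<inv 0<∣𝓘ᵣ∣)) (begin
    fromℕ (Iₖ M r)          ≡⟨ trans (sym ∣bases∣≡) (sym (∑-1 bases)) ⟩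
    ∑ bases (λ _ → 1ℚ)      ≤⟨ ∑-mono bases (λ {B} _ → 1≤gain B) ⟩
    ∑ bases gain            ≤⟨ ∑-gain≤I ⟩
    fromℕ (I M)             ∎))
    where open ≤-Reasoning

  ∣elements∣≤n : ∀ (S : Subset n) → length (elements S) ℕ.≤ n
  ∣elements∣≤n S = subst (length (elements S) ℕ.≤_) (length-tabulate {n = n} (λ i → i)) (length-filter (_∈? S) (allFin n))

  ∑-δ-ln : ∀ m → ∑ (𝓘ₖ M s) (λ F → fromℕ (δ M F) * lnSum (1ℚ + 1ℚ ÷ fromℕ (δ M F)) m) ≤
    fromℕ (Iₖ M r) * (lnSum (fromℕ (I M) ÷ fromℕ (Iₖ M r)) m + fromℕ n * mesh m)
  ∑-δ-ln m = subst₂ _≤_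
    (trans (⨁-double-count +-0-isCommutativeMonoid (λ F → lnSum (u F) m))
      (Sum.⨁-cong (𝓘ₖ M s) (λ {F} _ → ·≡* (δ M F) (lnSum (u F) m))))
    (cong (_* (lnSum (fromℕ (I M) ÷ fromℕ (Iₖ M r)) m + fromℕ n * mesh m)) ∣bases∣≡)
    (∑F∏-bound bases elements (λ B e → 1≤u (B [ e ]≔ outside)) (λ B e → u≤2 (B [ e ]≔ outside))
      ∣elements∣≤n 1≤I÷Iᵣ ∑-gain≤ m)

  -- The power bound raised to the exponent I_r. Each F of size r - 1 supplies a factor 2 ≤ (1 +
  -- 1/δ(F))^δ(F), and the product of these powers over F regroups into the product of the gains of
  -- the bases.
  2^≤ : fromℕ (2 ℕ.^ Iₖ M s) ≤ (fromℕ (I M) ÷ fromℕ (Iₖ M r)) ^ Iₖ M r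
  2^≤ = begin
    fromℕ (2 ℕ.^ Iₖ M s)
      ≡⟨ fromℕ-^ 2 (Iₖ M s) ⟩
    (1ℚ + 1ℚ) ^ Iₖ M s
      ≡⟨ Prod.⨁-const (𝓘ₖ M s) (1ℚ + 1ℚ) ⟨
    ∏ (𝓘ₖ M s) (λ _ → 1ℚ + 1ℚ)
      ≤⟨ ∏-mono (𝓘ₖ M s) (λ _ → ≤-trans 0≤1 (p≤p+q 0≤1)) (λ {F} → 2≤u^δ F) ⟩
    ∏ (𝓘ₖ M s) (λ F → u F ^ δ M F)
      ≡⟨ ⨁-double-count *-1-isCommutativeMonoid u ⟨
    ∏ bases gain
      ≤⟨ am-gm bases (λ B → 1≤⇒0≤ (1≤gain B)) (1≤⇒0≤ 1≤I÷Iᵣ) ∑-gain≤ ⟩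
    (fromℕ (I M) ÷ fromℕ (Iₖ M r)) ^ length bases
      ≡⟨ cong (λ xs → (fromℕ (I M) ÷ fromℕ (Iₖ M r)) ^ length xs) 𝓘ᵣ≡bases ⟨
    (fromℕ (I M) ÷ fromℕ (Iₖ M r)) ^ Iₖ M r ∎
    where
    open ≤-Reasoning
    2≤u^δ : ∀ F → F ∈ 𝓘ₖ M s → 1ℚ + 1ℚ ≤ u F ^ δ M F
    -- Bernoulli with t = 1/δ: the lower bound 1 + δ · (1/δ) equals 2 because δ is positive on
    -- 𝓘_{r-1}.
    2≤u^δ F F∈ = subst (_≤ u F ^ δ M F)
      (cong (1ℚ +_) (trans (cong (fromℕ (δ M F) *_) (*-identityˡ (inv (fromℕ (δ M F))))) (*-inv (0<fromℕ (0<δ-coatom F∈)))))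
      (bernoulli (δ M F) (0≤* 0≤1 (0≤inv (fromℕ (δ M F)) (0≤fromℕ (δ M F)))))

theorem1p7 : ∀ {n} (M : Matroid n) (r : ℕ) (rank : HasRank M r) → 1 ≤ℕ r →
  (ln (fromℚ (fromℕ (I M) ÷ fromℕ (Iₖ M r))) (0<I÷Iᵣ M rank)
    ≥ᴿ fromℚ (fromℕ (Iₖ M (r ∸ 1)) ÷ fromℕ (Iₖ M r))
       *ᴿ (fromℚ (1ℚ ÷ fromℕ (Iₖ M (r ∸ 1)))
           *ᴿ sumᴿ (map (λ F → fromℚ (fromℕ (δ M F)) *ᴿ ln (fromℚ (1ℚ + 1ℚ ÷ fromℕ (δ M F))) (0<1+inv (δ M F)))
                        (𝓘ₖ M (r ∸ 1)))))
  × (∀ (d : ℝ) (0<d : 0ᴿ <ᴿ d) →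
      (∀ F → F ∈ 𝓘ₖ M (r ∸ 1) → fromℚ (fromℕ (δ M F)) ≥ᴿ d) →
      ln (fromℚ (fromℕ (I M) ÷ fromℕ (Iₖ M r))) (0<I÷Iᵣ M rank)
        ≥ᴿ fromℚ (fromℕ (Iₖ M (r ∸ 1)) ÷ fromℕ (Iₖ M r))
           *ᴿ (d *ᴿ ln (1ᴿ +ᴿ recip d 0<d) (0<1+recip d 0<d)))
  × (fromℚ (fromℕ (I M) ÷ fromℕ (Iₖ M r))
      ≥ᴿ (2 ^[ Iₖ M (r ∸ 1) / Iₖ M r ]) {{Iᵣ≢0 M rank}})
theorem1p7 {n} M r rank 1≤r =
  average-bound (𝓘ₖ M (r ∸ 1)) (δ M) {Iₖ M r} {n} 0<∣𝓘ᵣ∣ ∑-δ-ln (0<I÷Iᵣ M rank) ,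
  uniform-bound (𝓘ₖ M (r ∸ 1)) (δ M) {Iₖ M r} {n} 0<∣𝓘ᵣ∣ ∑-δ-ln (0<I÷Iᵣ M rank) 0<δ-coatom ,
  root≤ (Iₖ M r) {{Iᵣ≢0 M rank}} (2 ℕ.^ Iₖ M (r ∸ 1)) (1≤⇒0≤ 1≤I÷Iᵣ) 2^≤
  where
  r≡ : r ≡ suc (r ∸ 1)
  r≡ = sym (ℕₚ.m+[n∸m]≡n 1≤r)
  open DoubleCounting M rank r≡
  open Inequalities M rank r≡
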